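{- Let $n\geq 7$ be an integer and $h$ an odd integer with $0<h<2^{n-6}$ and $h\not\equiv 0\pmod{17}$. Let $M=h\cdot 2^n+1$ or $M=h\cdot 2^n-1$, and let $M^*=(-1)^{(M-1)/2}M$, so that $M^*=(\pm h)2^n+1$. Let $\pi_1=1+2\zeta_8^3$ and $\pi_2=1-\zeta_{16}+\zeta_{16}^5$, and let $\{T_k\},\{N_k\},\{X_k\},\{Y_k\},\{Z_k\},\{W_k\}$ be the sequences defined in the context from $\pi_1,\pi_2$ and $h$. Let $Q_1,\dots,Q_7$ be the seven integers $Q$ with $1<Q<2^{n-3}$ and $Q\equiv \pm 5^{j2^{n-7}}\pmod{2^{n-3}}$ for some $j\in\{0,1,2,3\}$. Suppose that $M$ is divisible by none of $Q_1,\dots,Q_7$. Then $M$ is prime if and only if one of the following holds: (i) $M^*\equiv \pm 4\pmod{17}$, and $T_{n-3}\equiv -N_{n-3}\equiv -4\pmod{M}$; (ii) $M^*\equiv \pm 2,\pm 8\pmod{17}$, and $T_{n-3}\equiv N_{n-3}\equiv 0\pmod{M}$; (iii) $M^*\equiv \pm 3,\pm 5,\pm 6,\pm 7\pmod{17}$, and $T_{n-3}\equiv 0\pmod{M}$ and $N_{n-3}\equiv -2\pmod{M}$; (iv) $M^*\equiv -1\pmod{17}$, and $X_{n-4}\equiv -8$, $Y_{n-4}\equiv 24$, $Z_{n-4}\equiv -32$, $W_{n-4}\equiv 16\pmod{M}$.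
   Context: Let $\zeta_8=e^{2\pi i/8}$, $\zeta_{16}=e^{2\pi i/16}$, $L_1=\mathbb{Q}(\zeta_8)\subset L_2=\mathbb{Q}(\zeta_{16})$, with rings of integers $D_1=\mathbb{Z}[\zeta_8]$, $D_2=\mathbb{Z}[\zeta_{16}]$. For odd $c$, $\sigma_c$ denotes the automorphism of $L_2$ with $\zeta_{16}\mapsto\zeta_{16}^c$ (and also its restriction to $L_1$, which sends $\zeta_8\mapsto\zeta_8^c$). For nonzero $\alpha\in L_2$ and $\tau=\sum_\sigma k_\sigma\sigma\in\mathbb{Z}[\mathrm{Gal}(L_2/\mathbb{Q})]$, write $\alpha^\tau=\prod_\sigma \sigma(\alpha)^{k_\sigma}$, with $\sigma_1=1$. A bar denotes complex conjugation. Let $K_1=\mathbb{Q}(\sqrt2)$ and $K_2=\mathbb{Q}(\zeta_{16}+\zeta_{16}^{ -1})$ be the maximal real subfields of $L_1,L_2$; $\mathrm{Gal}(K_2/\mathbb{Q})=\{\sigma_1,\sigma_3,\sigma_5,\sigma_7\}$ restricted to $K_2$. Set $\alpha_1=(\pi_1/\bar\pi_1)^{1+3\sigma_3}$ and $\alpha_2=(\pi_2/\bar\pi_2)^{1+3\sigma_{ -5}+5\sigma_{ -3}+7\sigma_7}$. Sequences $T_k,N_k$: $T_0=\mathrm{Tr}_{K_1/\mathbb{Q}}(\alpha_1^h+\bar\alpha_1^h)$, $N_0=\mathrm{N}_{K_1/\mathbb{Q}}(\alpha_1^h+\bar\alpha_1^h)$, and for $k\ge0$: $T_{k+1}=T_k^2-2N_k-4$,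 $N_{k+1}=N_k^2-2T_k^2+4N_k+4$. Sequences $X_k,Y_k,Z_k,W_k$: let $\eta=\alpha_2^h+\bar\alpha_2^h\in K_2$ and let $X_0,Y_0,Z_0,W_0$ be the first, second, third and fourth elementary symmetric polynomials in $\eta,\sigma_3(\eta),\sigma_5(\eta),\sigma_7(\eta)$ (so $X_0=\mathrm{Tr}_{K_2/\mathbb{Q}}(\eta)$, $W_0=\mathrm{N}_{K_2/\mathbb{Q}}(\eta)$). For $k\ge0$: $X_{k+1}=X_k^2-2Y_k-8$, $Y_{k+1}=Y_k^2-2X_kZ_k+2W_k-6X_k^2+12Y_k+24$, $Z_{k+1}=Z_k^2-2W_kY_k-4Y_k^2+8X_kZ_k-8W_k+12X_k^2-24Y_k-32$, $W_{k+1}=W_k^2-2Z_k^2+4W_kY_k+4Y_k^2-8X_kZ_k+8W_k-8X_k^2+16Y_k+16$. -}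

module Defs where

open import Data.Nat as ℕ using (ℕ; zero; suc)
open import Data.Nat.DivMod using (_%_; _/_)
open import Data.Integer as ℤ using (ℤ; +_)
open import Data.Integer.Divisibility using () renaming (_∣_ to _∣ℤ_)
open import Data.Rational as ℚ using (ℚ; 0ℚ; 1ℚ; ↥_)
open import Data.Rational.Properties using (_≟_)
open import Data.Fin using (Fin; toℕ)
open import Data.List using (List; _∷_; []; foldr; allFin)
open import Data.Bool using (if_then_else_)
open import Relation.Nullary using (yes; no)
open import Data.Product using (_×_; _,_; proj₁; proj₂)

-- Exact arithmetic in L₂ = ℚ(ζ₁₆) ≅ ℚ[x]/(x⁸+1).
-- An element is its coefficient vector w.r.t. the basis 1, ζ, …, ζ⁷
-- (ζ = ζ₁₆).  L₁ = ℚ(ζ₈) is the subfield generated by ζ₈ = ζ².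

L : Set
L = Fin 8 → ℚ

ι : ℤ → ℚ
ι z = z ℚ./ 1

cst : ℚ → L
cst q i = if toℕ i ℕ.≡ᵇ 0 then q else 0ℚ

-- constant coefficient (for elements lying in ℚ this is the element itself)
const : L → ℚ
const a = a Data.Fin.zero

zeroL : L
zeroL _ = 0ℚ

oneL : L
oneL = cst 1ℚ

_⊕_ : L → L → L
(a ⊕ b) i = a i ℚ.+ b i

scale : ℚ → L → L
scale q a i = q ℚ.* a i

negL : L → L
negL a i = ℚ.- a i

sumL : List L → L
sumL = foldr _⊕_ zeroL

-- ζ^m for any m ∈ ℕ (using ζ⁸ = -1, ζ¹⁶ = 1)
ζpow : ℕ → L
ζpow m i with m % 16
... | r = if r ℕ.<ᵇ 8
           then (if toℕ i ℕ.≡ᵇ r then 1ℚ else 0ℚ)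
           else (if toℕ i ℕ.≡ᵇ (r ℕ.∸ 8) then ℚ.- 1ℚ else 0ℚ)

infixl 7 _⊗_
infixl 6 _⊕_
_⊗_ : L → L → L
a ⊗ b = sumL (Data.List.map (λ i → sumL (Data.List.map (λ j →
          scale (a i ℚ.* b j) (ζpow (toℕ i ℕ.+ toℕ j))) (allFin 8))) (allFin 8))

-- σ_c : ζ ↦ ζ^c  (c taken mod 16; σ_{-c} = σ_{16-c})
σ : ℕ → L → L
σ c a = sumL (Data.List.map (λ i → scale (a i) (ζpow (c ℕ.* toℕ i))) (allFin 8))

-- complex conjugation = σ_{-1} = σ_{15}
conj : L → L
conj = σ 15

pow : L → ℕ → L
pow a zero    = oneL
pow a (suc k) = a ⊗ pow a k

normL : L → ℚ
normL a = const (a ⊗ σ 3 a ⊗ σ 5 a ⊗ σ 7 a ⊗ σ 9 a ⊗ σ 11 a ⊗ σ 13 a ⊗ σ 15 a)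

recipℚ : ℚ → ℚ
recipℚ q with q ≟ 0ℚ
... | yes _  = 0ℚ
... | no q≢0 = ℚ.1/_ q {{ℚ.≢-nonZero q≢0}}

invL : L → L
invL a = scale (recipℚ (normL a))
           (σ 3 a ⊗ σ 5 a ⊗ σ 7 a ⊗ σ 9 a ⊗ σ 11 a ⊗ σ 13 a ⊗ σ 15 a)

-- π₁ = 1 + 2 ζ₈³ = 1 + 2 ζ₁₆⁶ ,  π₂ = 1 - ζ₁₆ + ζ₁₆⁵

π₁ : L
π₁ = oneL ⊕ scale (ι (+ 2)) (ζpow 6)

π₂ : L
π₂ = (oneL ⊕ negL (ζpow 1)) ⊕ ζpow 5

α₁ : L
α₁ = let r = π₁ ⊗ invL (conj π₁) in r ⊗ pow (σ 3 r) 3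

-- α₂ = (π₂/π̄₂)^{1 + 3σ_{-5} + 5σ_{-3} + 7σ_7}
α₂ : L
α₂ = let r = π₂ ⊗ invL (conj π₂) in
     ((r ⊗ pow (σ 11 r) 3) ⊗ pow (σ 13 r) 5) ⊗ pow (σ 7 r) 7

θ : ℕ → L
θ h = pow α₁ h ⊕ pow (conj α₁) h

-- Tr_{K₁/ℚ} and N_{K₁/ℚ}; σ₃ restricts to the nontrivial automorphism of K₁
T₀ N₀ : ℕ → ℚ
T₀ h = const (θ h ⊕ σ 3 (θ h))
N₀ h = const (θ h ⊗ σ 3 (θ h))

TN : ℕ → ℕ → ℚ × ℚ
TN h zero    = T₀ h , N₀ h
TN h (suc k) = step (TN h k)
  where
  step : ℚ × ℚ → ℚ × ℚ
  step (t , m) = (t ℚ.* t ℚ.- ι (+ 2) ℚ.* m ℚ.- ι (+ 4))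
               , (m ℚ.* m ℚ.- ι (+ 2) ℚ.* (t ℚ.* t) ℚ.+ ι (+ 4) ℚ.* m ℚ.+ ι (+ 4))

T N : ℕ → ℕ → ℚ
T h k = proj₁ (TN h k)
N h k = proj₂ (TN h k)

η : ℕ → L
η h = pow α₂ h ⊕ pow (conj α₂) h

record Q4 : Set where
  constructor q4
  field x y z w : ℚ

e4 : L → Q4
e4 a = q4 (const (((a ⊕ b) ⊕ c) ⊕ d))
          (const (((((a ⊗ b) ⊕ (a ⊗ c)) ⊕ (a ⊗ d)) ⊕ (b ⊗ c)) ⊕ ((b ⊗ d) ⊕ (c ⊗ d))))
          (const ((((a ⊗ b) ⊗ c) ⊕ ((a ⊗ b) ⊗ d)) ⊕ (((a ⊗ c) ⊗ d) ⊕ ((b ⊗ c) ⊗ d))))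
          (const (((a ⊗ b) ⊗ c) ⊗ d))
  where
  b = σ 3 a
  c = σ 5 a
  d = σ 7 a

XYZW : ℕ → ℕ → Q4
XYZW h zero    = e4 (η h)
XYZW h (suc k) = step (XYZW h k)
  where
  k' : ℤ → ℚ
  k' = ι
  step : Q4 → Q4
  step (q4 X Y Z W) = q4
    (X ℚ.* X ℚ.- k' (+ 2) ℚ.* Y ℚ.- k' (+ 8))
    (Y ℚ.* Y ℚ.- k' (+ 2) ℚ.* (X ℚ.* Z) ℚ.+ k' (+ 2) ℚ.* W ℚ.- k' (+ 6) ℚ.* (X ℚ.* X)
      ℚ.+ k' (+ 12) ℚ.* Y ℚ.+ k' (+ 24))
    (Z ℚ.* Z ℚ.- k' (+ 2) ℚ.* (W ℚ.* Y) ℚ.- k' (+ 4) ℚ.* (Y ℚ.* Y) ℚ.+ k' (+ 8) ℚ.* (X ℚ.* Z)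
      ℚ.- k' (+ 8) ℚ.* W ℚ.+ k' (+ 12) ℚ.* (X ℚ.* X) ℚ.- k' (+ 24) ℚ.* Y ℚ.- k' (+ 32))
    (W ℚ.* W ℚ.- k' (+ 2) ℚ.* (Z ℚ.* Z) ℚ.+ k' (+ 4) ℚ.* (W ℚ.* Y) ℚ.+ k' (+ 4) ℚ.* (Y ℚ.* Y)
      ℚ.- k' (+ 8) ℚ.* (X ℚ.* Z) ℚ.+ k' (+ 8) ℚ.* W ℚ.- k' (+ 8) ℚ.* (X ℚ.* X)
      ℚ.+ k' (+ 16) ℚ.* Y ℚ.+ k' (+ 16))

X Y Z W : ℕ → ℕ → ℚ
X h k = Q4.x (XYZW h k)
Y h k = Q4.y (XYZW h k)
Z h k = Q4.z (XYZW h k)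
W h k = Q4.w (XYZW h k)

-- Congruences.
-- All the rationals above lie in ℤ[1/17] (π₁π̄₁ and π₂π̄₂ have 17-power
-- norms).  For a rational a and a modulus M, "a ≡ b (mod M)" means that M
-- divides the numerator of a - b in lowest terms, i.e. a ≡ b in the
-- localisation ℤ_(M) (for M coprime to the denominators).
infix 4 _≡ℚ_[mod_] _≡ℤ_[mod_]
_≡ℚ_[mod_] : ℚ → ℚ → ℕ → Set
a ≡ℚ b [mod M ] = (+ M) ∣ℤ (↥ (a ℚ.- b))

_≡ℤ_[mod_] : ℤ → ℤ → ℕ → Set
a ≡ℤ b [mod m ] = (+ m) ∣ℤ (a ℤ.- b)

Mstar : ℕ → ℤ
Mstar M = if ((M ℕ.∸ 1) / 2) % 2 ℕ.≡ᵇ 0 then + M else ℤ.- (+ M)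

{-# OPTIONS --safe #-}
module Submission where

-- All computations take place in R = (ℤ/p)[ζ]/(ζ⁸+1) for a prime p ≠ 2, 17; the numbers T, N, X, Y, Z, W
-- have denominators that are powers of 17 and so reduce to elements of ℤ/p.
--
-- If M = p is prime, consider the Gauss sums g = Σ χ(t) xᵗ of characters of (ℤ/17)* in the group ring
-- R[C₁₇].  Multiplying out with Jacobi sums gives g¹⁶ = C (17 − Σ xᵗ) with C ∈ ℤ[ζ], and 17 C = 17⁸ α₂ by
-- an explicit factorisation (likewise 17 C = 17⁴ α₁ for a character of order 8).  Comparing gᵖ computed in
-- this way with gᵖ = Σ χ(t)ᵖ xᵗᵖ (Frobenius) determines α₁^((p∓1)/8) and α₂^((p∓1)/16) as roots of unity
-- that depend on p mod 17 only, which yields the four congruences.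
--
-- Conversely let p be a prime divisor of M.  Every x ∈ R satisfies x^(p⁴) = x, so R is reduced, and the
-- congruences say that a 2ᵏ-th power of β = αʰ is −1 with k ≥ n − 4.  As β^(p⁴−1) = 1, it follows that
-- 2^(n−3) divides p⁴ − 1, i.e. p ≡ ± 5^(j 2^(n−7)) mod 2^(n−3).  As M has no divisor among the Qᵢ,
-- p > 2^(n−3) > √M.

-- The group ring takes the place of a field containing a 17th root of unity: every element is a
-- table of integer coordinates, and Jacobi sums and factorisations are identities over ℤ[ζ] that
-- hold modulo every p at once. The price is that Σ xᵗ is not 0. Hence E = 17 - Σ xᵗ appears, which
-- acts as 17 on the Gauss sum of a nontrivial character.
--
-- The powers of 17 in gᵖ are not evaluated: the same computation for the quadratic character, whose
-- Gauss sum has square E, produces them too, and they cancel.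
--
-- The exponents in α₁, α₂ reflect Stickelberger's theorem. A prime above 17 and its conjugate occur
-- in g¹⁶ with exponents t and 16 - t, t odd; splitting off 17⁸ leaves π/π̄ to the power t - 8, that
-- is 1, 3, 5, 7 up to sign. For order 8 it is t - 4, that is 1, 3.
--
-- Two characters are needed because one of order 8 has the value 1 at -1: for M* ≡ -1 mod 17 the
-- power of α₁ would be 1 and bound no order from below, while a character of order 16 gives -1. The
-- residue M* ≡ 1 does not occur, since 17 does not divide h.

open import Defs

open import Algebra.Bundles using (CommutativeRing)
import Algebra.Consequences.Setoid
open import Algebra.Core using (Op₁; Op₂)
import Algebra.Definitions
open import Algebra.Solver.Ring.AlmostCommutativeRing using (fromCommutativeRing; _-Raw-AlmostCommutative⟶_)
open import Data.Bool as Bool using (true; false; if_then_else_)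
open import Data.Empty using (⊥)
open import Data.Fin as Fin using (Fin; toℕ; fromℕ; inject₁)
open import Data.Fin.Patterns
open import Data.Fin.Permutation using (permutation)
import Data.Fin.Properties as FinP
open import Data.Integer as ℤ using (ℤ; +_; -[1+_])
import Data.Integer.Divisibility as ℤU
import Data.Integer.Divisibility.Signed as ℤD
import Data.Integer.DivMod as ℤM
import Data.Integer.Properties as ℤP
import Data.Integer.Solver as ℤSolver
open import Data.List using (List; []; _∷_; map; foldr; allFin)
open import Data.List.Relation.Unary.All using (_∷_)
open import Data.Maybe using (Maybe; just; nothing)
open import Data.Nat as ℕ using (ℕ; zero; suc; z≤n; s≤s)
open import Data.Nat.Combinatorics using (_C_; nCk+nC[k+1]≡[n+1]C[k+1]; nCn≡1; nC1≡n; k>n⇒nCk≡0)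
import Data.Nat.Coprimality as Coprimality
import Data.Nat.Divisibility as ℕD
import Data.Nat.DivMod as ℕM
open import Data.Nat.GCD using (module Bézout)
open import Data.Nat.ListAction using (product)
open import Data.Nat.Primality using (Prime; _Rough_; euclidsLemma; prime?; prime[2]; prime⇒irreducible; prime⇒nonTrivial; prime⇒nonZero; rough∧square>⇒prime)
open import Data.Nat.Primality.Factorisation using (factorise)
import Data.Nat.Properties as ℕP
open import Data.Nat.Solver using (module +-*-Solver)
open import Data.Product using (_,_; proj₁; proj₂; ∃) renaming (_×_ to _∧_)
open import Data.Rational as ℚ using (ℚ; mkℚ; 0ℚ; 1ℚ; ↥_; ↧_)
import Data.Rational.Properties as ℚP
import Data.Rational.Solver as ℚSolver
open import Data.Sum as Sum using (_⊎_; inj₁; inj₂)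
open import Data.Unit using (⊤; tt)
open import Data.Vec using ([]; _∷_; lookup)
open import Function.Bundles using (_⇔_; mk⇔)
open import Function.Strict using (force; force-≡)
open import Level using (0ℓ)
open import Relation.Binary.Bundles using (Setoid)
open import Relation.Binary.Core using (Rel)
open import Relation.Binary.PropositionalEquality as ≡ using (_≡_)
open import Relation.Binary.Structures using (IsEquivalence)
open import Relation.Nullary using (¬_; yes; no; does; contradiction)
open import Relation.Nullary.Decidable using (from-yes)

-- Powers and the Frobenius map

absorption : ∀ n k → suc k ℕ.* (suc n C suc k) ≡ suc n ℕ.* (n C k)
absorption n zero = ≡.trans (ℕP.*-identityˡ (suc n C 1)) (≡.trans (nC1≡n (suc n)) (≡.sym (ℕP.*-identityʳ (suc n))))
absorption zero (suc k) =
  ≡.trans (≡.cong (suc (suc k) ℕ.*_) (k>n⇒nCk≡0 {1} {suc (suc k)} (s≤s (s≤s z≤n)))) (ℕP.*-zeroʳ (suc (suc k)))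
absorption (suc n) (suc k) = begin
  suc (suc k) ℕ.* (suc (suc n) C suc (suc k))
    ≡⟨ ≡.cong (suc (suc k) ℕ.*_) (nCk+nC[k+1]≡[n+1]C[k+1] (suc n) (suc k)) ⟨
  suc (suc k) ℕ.* (a ℕ.+ b)
    ≡⟨ solve 3 (λ k a b → (con 2 :+ k) :* (a :+ b) := a :+ ((con 1 :+ k) :* a :+ (con 2 :+ k) :* b)) ≡.refl k a b ⟩
  a ℕ.+ (suc k ℕ.* a ℕ.+ suc (suc k) ℕ.* b)
    ≡⟨ ≡.cong (a ℕ.+_) (≡.cong₂ ℕ._+_ (absorption n k) (absorption n (suc k))) ⟩
  a ℕ.+ (suc n ℕ.* (n C k) ℕ.+ suc n ℕ.* (n C suc k))
    ≡⟨ ≡.cong (a ℕ.+_) (ℕP.*-distribˡ-+ (suc n) (n C k) _) ⟨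
  a ℕ.+ suc n ℕ.* (n C k ℕ.+ n C suc k)
    ≡⟨ ≡.cong (λ z → a ℕ.+ suc n ℕ.* z) (nCk+nC[k+1]≡[n+1]C[k+1] n k) ⟩
  suc (suc n) ℕ.* (suc n C suc k) ∎
  where
  open ≡.≡-Reasoning
  open +-*-Solver
  a = suc n C suc k
  b = suc n C suc (suc k)

-- By absorption p divides k · C(p, k), and p does not divide k since 0 < k < p.
prime∣C : ∀ {p} → Prime p → ∀ k → 0 ℕ.< k → k ℕ.< p → p ℕD.∣ (p C k)
prime∣C {suc n} pp (suc k) _ k<p with euclidsLemma (suc k) (suc n C suc k) pp
    (ℕD.divides (n C k) (≡.trans (absorption n k) (ℕP.*-comm (suc n) _)))
... | inj₁ p∣k = contradiction (ℕD.∣⇒≤ p∣k) (ℕP.<⇒≱ k<p)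
... | inj₂ d = d

module PowerLemmas (R : CommutativeRing 0ℓ 0ℓ) where
  open CommutativeRing R
  open import Algebra.Properties.CommutativeSemiring.Exp commutativeSemiring public
  open import Relation.Binary.Reasoning.Setoid setoid

  1^ : ∀ n → 1# ^ n ≈ 1#
  1^ zero = refl
  1^ (suc n) = trans (*-identityˡ _) (1^ n)

  0^ : ∀ n → .{{ℕ.NonZero n}} → 0# ^ n ≈ 0#
  0^ (suc n) = zeroˡ _

  ^-one : ∀ x → x ^ 1 ≈ x
  ^-one x = *-identityʳ x

  ^-comm : ∀ x m n → (x ^ m) ^ n ≈ (x ^ n) ^ m
  ^-comm x m n = trans (^-assocʳ x m n) (trans (^-congʳ x (ℕP.*-comm m n)) (sym (^-assocʳ x n m)))

  ^-periodic : ∀ x m r k → x ^ m ≈ 1# → x ^ (r ℕ.+ k ℕ.* m) ≈ x ^ r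
  ^-periodic x m r k e = begin
    x ^ (r ℕ.+ k ℕ.* m)       ≈⟨ ^-homo-* x r (k ℕ.* m) ⟩
    x ^ r * x ^ (k ℕ.* m)     ≈⟨ *-congˡ (^-congʳ x (ℕP.*-comm k m)) ⟩
    x ^ r * x ^ (m ℕ.* k)     ≈⟨ *-congˡ (^-assocʳ x m k) ⟨
    x ^ r * (x ^ m) ^ k       ≈⟨ *-congˡ (^-congˡ k e) ⟩
    x ^ r * 1# ^ k            ≈⟨ *-congˡ (1^ k) ⟩
    x ^ r * 1#                ≈⟨ *-identityʳ _ ⟩
    x ^ r                     ∎

-- Characteristic p in a weak form that passes coefficientwise to quadratic extensions and group
-- rings, which need not be domains.
Annihilates : ℕ → CommutativeRing 0ℓ 0ℓ → Set
Annihilates p R = ∀ x → p × x ≈ 0#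
  where
  open CommutativeRing R
  open import Algebra.Properties.Semiring.Mult semiring using (_×_)

module Frobenius (R : CommutativeRing 0ℓ 0ℓ) (p : ℕ) (pp : Prime p) (char : Annihilates p R) where
  open CommutativeRing R
  open PowerLemmas R
  open import Algebra.Properties.Semiring.Mult semiring using (_×_; ×-congˡ; ×-homo-1; ×-assocˡ)
  open import Algebra.Properties.Semiring.Sum semiring
  open import Algebra.Properties.CommutativeSemiring.Binomial commutativeSemiring
  open import Data.Vec.Functional using (init; last)
  open import Relation.Binary.Reasoning.Setoid setoid

  private
    multiple-vanishes : ∀ {m} x → p ℕD.∣ m → m × x ≈ 0#
    multiple-vanishes {m} x (ℕD.divides q e) = begin
      m × x           ≈⟨ ×-congˡ {x = x} (≡.trans e (ℕP.*-comm q p)) ⟩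
      (p ℕ.* q) × x   ≈⟨ ×-assocˡ x p q ⟨
      p × (q × x)     ≈⟨ char _ ⟩
      0#              ∎

    -- Matching on `p ≡ suc m` exposes the binomial sum as a first term, `m` middle terms divisible
    -- by p, and a last term.
    frobenius-+′ : ∀ m → p ≡ suc m → ∀ x y → (x + y) ^ p ≈ x ^ p + y ^ p
    frobenius-+′ m ≡.refl x y = begin
      (x + y) ^ p                                     ≈⟨ theorem p x y ⟩
      t Fin.zero + sum (λ k → t (Fin.suc k))          ≈⟨ +-congˡ (sum-init-last (λ k → t (Fin.suc k))) ⟩
      t Fin.zero + (sum (init (λ k → t (Fin.suc k))) + last (λ k → t (Fin.suc k)))
        ≈⟨ +-cong first (+-cong middle final) ⟩
      y ^ p + (0# + x ^ p)                            ≈⟨ +-congˡ (+-identityˡ _) ⟩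
      y ^ p + x ^ p                                   ≈⟨ +-comm _ _ ⟩
      x ^ p + y ^ p                                   ∎
      where
      t = binomialTerm x y p
      first : t Fin.zero ≈ y ^ p
      first = trans (×-homo-1 _) (*-identityˡ _)
      middle : sum (init (λ k → t (Fin.suc k))) ≈ 0#
      middle = trans (sum-cong-≋ {m} (λ k → multiple-vanishes _ (prime∣C pp (suc (toℕ (inject₁ k)))
                        (s≤s z≤n) (s≤s (≡.subst (ℕ._< m) (≡.sym (FinP.toℕ-inject₁ k)) (FinP.toℕ<n k))))))
                     (sum-replicate-zero m)
      final : last (λ k → t (Fin.suc k)) ≈ x ^ p
      final = begin
        (p C suc (toℕ (fromℕ m))) × (x ^ suc (toℕ (fromℕ m)) * y ^ (m ℕ.∸ toℕ (fromℕ m)))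
          ≡⟨ ≡.cong (λ z → (p C suc z) × (x ^ suc z * y ^ (m ℕ.∸ z))) (FinP.toℕ-fromℕ m) ⟩
        (p C p) × (x ^ p * y ^ (m ℕ.∸ m))
          ≡⟨ ≡.cong₂ (λ a b → a × (x ^ p * y ^ b)) (nCn≡1 p) (ℕP.n∸n≡0 m) ⟩
        1 × (x ^ p * 1#)   ≈⟨ ×-homo-1 _ ⟩
        x ^ p * 1#         ≈⟨ *-identityʳ _ ⟩
        x ^ p              ∎

  frobenius-+ : ∀ x y → (x + y) ^ p ≈ x ^ p + y ^ p
  frobenius-+ = frobenius-+′ (ℕ.pred p) (≡.sym (ℕP.suc-pred p {{prime⇒nonZero pp}}))

  frobenius-iterate-+ : ∀ k x y → (x + y) ^ (p ℕ.^ k) ≈ x ^ (p ℕ.^ k) + y ^ (p ℕ.^ k)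
  frobenius-iterate-+ zero x y = trans (*-identityʳ _) (+-cong (sym (*-identityʳ _)) (sym (*-identityʳ _)))
  frobenius-iterate-+ (suc k) x y = begin
    (x + y) ^ (p ℕ.* q)        ≈⟨ ^-assocʳ (x + y) p q ⟨
    ((x + y) ^ p) ^ q          ≈⟨ ^-congˡ q (frobenius-+ x y) ⟩
    (x ^ p + y ^ p) ^ q        ≈⟨ frobenius-iterate-+ k _ _ ⟩
    (x ^ p) ^ q + (y ^ p) ^ q  ≈⟨ +-cong (^-assocʳ x p q) (^-assocʳ y p q) ⟩
    x ^ (p ℕ.* q) + y ^ (p ℕ.* q) ∎
    where q = p ℕ.^ k

  frobenius-sum : ∀ {n} (f : Fin n → Carrier) → sum f ^ p ≈ sum (λ i → f i ^ p)
  frobenius-sum {zero} f = 0^ p {{prime⇒nonZero pp}}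
  frobenius-sum {suc n} f = trans (frobenius-+ (f Fin.zero) _) (+-congˡ (frobenius-sum (λ i → f (Fin.suc i))))

-- Rings ℤ/m and R[√u]

commutativeRing :
  {A : Set} {_≈_ : Rel A 0ℓ} → IsEquivalence _≈_ → {_+_ _*_ : Op₂ A} { -_ : Op₁ A } {0# 1# : A} →
  let open Algebra.Definitions _≈_ in
  Congruent₂ _+_ → Associative _+_ → Commutative _+_ → LeftIdentity 0# _+_ →
  Congruent₁ -_ → LeftInverse 0# -_ _+_ →
  Congruent₂ _*_ → Associative _*_ → Commutative _*_ → LeftIdentity 1# _*_ →
  _*_ DistributesOverˡ _+_ → CommutativeRing 0ℓ 0ℓ
commutativeRing {_≈_ = _≈_} equiv {_+_} {_*_} { -_ } {0#} {1#} +-cong +-assoc +-comm +-idˡ -cong -invˡ *-cong *-assoc *-comm *-idˡ distribˡ =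
  record
  { _≈_ = _≈_ ; _+_ = _+_ ; _*_ = _*_ ; -_ = -_ ; 0# = 0# ; 1# = 1#
  ; isCommutativeRing = record
    { isRing = record
      { +-isAbelianGroup = record
        { isGroup = record
          { isMonoid = record
            { isSemigroup = record
              { isMagma = record { isEquivalence = equiv ; ∙-cong = +-cong }
              ; assoc = +-assoc }
            ; identity = comm∧idˡ⇒id +-comm +-idˡ }
          ; inverse = comm∧invˡ⇒inv +-comm -invˡ
          ; ⁻¹-cong = -cong }
        ; comm = +-comm }
      ; *-cong = *-cong
      ; *-assoc = *-assoc
      ; *-identity = comm∧idˡ⇒id *-comm *-idˡ
      ; distrib = comm∧distrˡ⇒distr +-cong *-comm distribˡ }
    ; *-comm = *-comm } }
  where
  setoid : Setoid 0ℓ 0ℓ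
  setoid = record { isEquivalence = equiv }
  open Algebra.Consequences.Setoid setoid

infix 4 _≡ₘ_[_]
-- A record rather than a synonym for divisibility, so that `a` and `b` can be recovered by
-- unification from the type of a congruence.
record _≡ₘ_[_] (a b : ℤ) (m : ℕ) : Set where
  constructor mod
  field divides-difference : (+ m) ℤD.∣ (a ℤ.- b)
open _≡ₘ_[_] public

-- The carrier is ℤ with a coarser equality: the operations do not mention m, so a closed identity
-- is checked once for all m. With m = 0 the ring is ℤ itself.
module Integers-mod (m : ℕ) where
  open ℤSolver.+-*-Solver
  private
    subst∣ : ∀ {a b} → a ≡ b → (+ m) ℤD.∣ a → (+ m) ℤD.∣ b
    subst∣ = ≡.subst ((+ m) ℤD.∣_)

  ≡ₘ-reflexive : ∀ {a b} → a ≡ b → a ≡ₘ b [ m ]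
  ≡ₘ-reflexive {a} ≡.refl = mod (ℤD.divides (+ 0) (ℤP.+-inverseʳ a))

  ≡ₘ-isEquivalence : IsEquivalence (_≡ₘ_[ m ])
  ≡ₘ-isEquivalence = record
    { refl = ≡ₘ-reflexive ≡.refl
    ; sym = λ { {a} {b} (mod d) → mod (subst∣ (solve 2 (λ a b → :- (a :- b) := b :- a) ≡.refl a b) (ℤD.∣m⇒∣-m d)) }
    ; trans = λ { {a} {b} {c} (mod d) (mod e) →
        mod (subst∣ (solve 3 (λ a b c → (a :- b) :+ (b :- c) := a :- c) ≡.refl a b c) (ℤD.∣m∣n⇒∣m+n d e)) } }

  ℤ/ : CommutativeRing 0ℓ 0ℓ
  ℤ/ = commutativeRing ≡ₘ-isEquivalence {ℤ._+_} {ℤ._*_} {ℤ.-_} {+ 0} {+ 1}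
    (λ { {a} {b} {c} {d} (mod e) (mod f) → mod (subst∣
        (solve 4 (λ a b c d → (a :- b) :+ (c :- d) := (a :+ c) :- (b :+ d)) ≡.refl a b c d) (ℤD.∣m∣n⇒∣m+n e f)) })
    (λ a b c → ≡ₘ-reflexive (ℤP.+-assoc a b c))
    (λ a b → ≡ₘ-reflexive (ℤP.+-comm a b))
    (λ a → ≡ₘ-reflexive (ℤP.+-identityˡ a))
    (λ { {a} {b} (mod e) → mod (subst∣ (solve 2 (λ a b → :- (a :- b) := :- a :- :- b) ≡.refl a b) (ℤD.∣m⇒∣-m e)) })
    (λ a → ≡ₘ-reflexive (ℤP.+-inverseˡ a))
    (λ { {a} {b} {c} {d} (mod e) (mod f) → mod (subst∣
        (solve 4 (λ a b c d → (a :- b) :* c :+ b :* (c :- d) := a :* c :- b :* d) ≡.refl a b c d)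
        (ℤD.∣m∣n⇒∣m+n (ℤD.∣m⇒∣m*n c e) (ℤD.∣n⇒∣m*n b f))) })
    (λ a b c → ≡ₘ-reflexive (ℤP.*-assoc a b c))
    (λ a b → ≡ₘ-reflexive (ℤP.*-comm a b))
    (λ a → ≡ₘ-reflexive (ℤP.*-identityˡ a))
    (λ a b c → ≡ₘ-reflexive (ℤP.*-distribˡ-+ a b c))

  open CommutativeRing ℤ/ using (semiring)
  open import Algebra.Properties.Semiring.Mult semiring using (_×_)

  ×≡* : ∀ n a → n × a ≡ + n ℤ.* a
  ×≡* zero a = ≡.sym (ℤP.*-zeroˡ a)
  ×≡* (suc n) a = ≡.trans (≡.cong (λ z → a ℤ.+ z) (×≡* n a)) (≡.sym (ℤP.suc-* (+ n) a))

  ≡ₘ0 : ∀ {a} → (+ m) ℤD.∣ a → a ≡ₘ + 0 [ m ]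
  ≡ₘ0 {a} d = mod (subst∣ (≡.sym (ℤP.+-identityʳ a)) d)

  ≡ₘ0⁻¹ : ∀ {a} → a ≡ₘ + 0 [ m ] → (+ m) ℤD.∣ a
  ≡ₘ0⁻¹ {a} (mod d) = subst∣ (ℤP.+-identityʳ a) d

  ℤ/-annihilated : Annihilates m ℤ/
  ℤ/-annihilated a = ≡ₘ0 (subst∣ (≡.sym (×≡* m a)) (ℤD.∣m⇒∣m*n a ℤD.∣-refl))

record Hom (R S : CommutativeRing 0ℓ 0ℓ) : Set where
  private
    module R = CommutativeRing R
    module S = CommutativeRing S
  field
    ⟦_⟧    : R.Carrier → S.Carrier
    ⟦⟧-cong : ∀ {x y} → x R.≈ y → ⟦ x ⟧ S.≈ ⟦ y ⟧
    +-homo : ∀ x y → ⟦ x R.+ y ⟧ S.≈ ⟦ x ⟧ S.+ ⟦ y ⟧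
    *-homo : ∀ x y → ⟦ x R.* y ⟧ S.≈ ⟦ x ⟧ S.* ⟦ y ⟧
    1-homo : ⟦ R.1# ⟧ S.≈ S.1#

  private
    module RE = PowerLemmas R
    module SE = PowerLemmas S
    import Algebra.Properties.Group as GP
    module SG = GP S.+-group

  0-homo : ⟦ R.0# ⟧ S.≈ S.0#
  0-homo = SG.identityˡ-unique _ _ (S.trans (S.sym (+-homo _ _)) (⟦⟧-cong (R.+-identityˡ R.0#)))

  -‿homo : ∀ x → ⟦ R.- x ⟧ S.≈ S.- ⟦ x ⟧
  -‿homo x = SG.inverseˡ-unique _ _ (S.trans (S.sym (+-homo _ _)) (S.trans (⟦⟧-cong (R.-‿inverseˡ x)) 0-homo))

  ^-homo : ∀ x n → ⟦ x RE.^ n ⟧ S.≈ ⟦ x ⟧ SE.^ n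
  ^-homo x zero = 1-homo
  ^-homo x (suc n) = S.trans (*-homo _ _) (S.*-congˡ (^-homo x n))

infixr 9 _∘ʰ_
_∘ʰ_ : ∀ {R S T} → Hom S T → Hom R S → Hom R T
_∘ʰ_ {T = T} g f = record
  { ⟦_⟧ = λ x → G.⟦ F.⟦ x ⟧ ⟧
  ; ⟦⟧-cong = λ e → G.⟦⟧-cong (F.⟦⟧-cong e)
  ; +-homo = λ x y → trans (G.⟦⟧-cong (F.+-homo x y)) (G.+-homo _ _)
  ; *-homo = λ x y → trans (G.⟦⟧-cong (F.*-homo x y)) (G.*-homo _ _)
  ; 1-homo = trans (G.⟦⟧-cong F.1-homo) G.1-homo }
  where
  module F = Hom f
  module G = Hom g
  open CommutativeRing T

-- R[√u], with (a , b) standing for a + b√u.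
module Quadratic (R : CommutativeRing 0ℓ 0ℓ) (u : CommutativeRing.Carrier R) where
  open CommutativeRing R
  open import Algebra.Solver.Ring.NaturalCoefficients.Default commutativeSemiring hiding (⟦_⟧)

  infix 4 _≈₂_
  record _≈₂_ (x y : Carrier ∧ Carrier) : Set where
    constructor _,_
    field
      re : proj₁ x ≈ proj₁ y
      im : proj₂ x ≈ proj₂ y
  open _≈₂_ public

  infixl 6 _+₂_
  infixl 7 _*₂_

  opaque
    -- Opaque, because products in a tower of three such extensions unfold into very large terms;
    -- the blocks that verify explicit identities unfold them locally.
    _+₂_ _*₂_ : Op₂ (Carrier ∧ Carrier)
    (a , b) +₂ (c , d) = (a + c) , (b + d)
    (a , b) *₂ (c , d) = (a * c + u * (b * d)) , (a * d + b * c)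

    -₂_ : Op₁ (Carrier ∧ Carrier)
    -₂ (a , b) = - a , - b

  open Algebra.Definitions _≈₂_

  opaque
    unfolding _+₂_

    +₂-cong : Congruent₂ _+₂_
    +₂-cong (p , q) (p′ , q′) = +-cong p p′ , +-cong q q′

    +₂-assoc : Associative _+₂_
    +₂-assoc (a , b) (c , d) (e , f) = +-assoc a c e , +-assoc b d f

    +₂-comm : Commutative _+₂_
    +₂-comm (a , b) (c , d) = +-comm a c , +-comm b d

    +₂-identityˡ : LeftIdentity (0# , 0#) _+₂_
    +₂-identityˡ (a , b) = +-identityˡ a , +-identityˡ b

    -₂-cong : Congruent₁ -₂_
    -₂-cong (p , q) = -‿cong p , -‿cong q

    -₂-inverseˡ : LeftInverse (0# , 0#) -₂_ _+₂_
    -₂-inverseˡ (a , b) = -‿inverseˡ a , -‿inverseˡ b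

    *₂-cong : Congruent₂ _*₂_
    *₂-cong (p , q) (p′ , q′) = +-cong (*-cong p p′) (*-congˡ (*-cong q q′)) , +-cong (*-cong p q′) (*-cong q p′)

    *₂-assoc : Associative _*₂_
    *₂-assoc (a , b) (c , d) (e , f) =
      solve 7 (λ u a b c d e f → (a :* c :+ u :* (b :* d)) :* e :+ u :* ((a :* d :+ b :* c) :* f)
                              := a :* (c :* e :+ u :* (d :* f)) :+ u :* (b :* (c :* f :+ d :* e))) refl u a b c d e f ,
      solve 7 (λ u a b c d e f → (a :* c :+ u :* (b :* d)) :* f :+ (a :* d :+ b :* c) :* e
                              := a :* (c :* f :+ d :* e) :+ b :* (c :* e :+ u :* (d :* f))) refl u a b c d e f

    *₂-comm : Commutative _*₂_
    *₂-comm (a , b) (c , d) =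
      solve 5 (λ u a b c d → a :* c :+ u :* (b :* d) := c :* a :+ u :* (d :* b)) refl u a b c d ,
      solve 5 (λ u a b c d → a :* d :+ b :* c := c :* b :+ d :* a) refl u a b c d

    *₂-identityˡ : LeftIdentity (1# , 0#) _*₂_
    *₂-identityˡ (a , b) =
      solve 3 (λ u a b → con 1 :* a :+ u :* (con 0 :* b) := a) refl u a b ,
      solve 3 (λ u a b → con 1 :* b :+ con 0 :* a := b) refl u a b

    *₂-distribˡ-+₂ : _*₂_ DistributesOverˡ _+₂_
    *₂-distribˡ-+₂ (a , b) (c , d) (e , f) =
      solve 7 (λ u a b c d e f → a :* (c :+ e) :+ u :* (b :* (d :+ f)) := (a :* c :+ u :* (b :* d)) :+ (a :* e :+ u :* (b :* f)))
        refl u a b c d e f ,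
      solve 7 (λ u a b c d e f → a :* (d :+ f) :+ b :* (c :+ e) := (a :* d :+ b :* c) :+ (a :* f :+ b :* e))
        refl u a b c d e f

    embed-+ : ∀ a b → (a + b , 0#) ≈₂ (a , 0#) +₂ (b , 0#)
    embed-+ a b = refl , sym (+-identityˡ 0#)

    embed-* : ∀ a b → (a * b , 0#) ≈₂ (a , 0#) *₂ (b , 0#)
    embed-* a b = solve 3 (λ u a b → a :* b := a :* b :+ u :* (con 0 :* con 0)) refl u a b
                , solve 2 (λ a b → con 0 := a :* con 0 :+ con 0 :* b) refl a b

    decompose : ∀ x → x ≈₂ (proj₁ x , 0#) +₂ (proj₂ x , 0#) *₂ (0# , 1#)
    decompose (a , b) =
      solve 3 (λ u a b → a := a :+ (b :* con 0 :+ u :* (con 0 :* con 1))) refl u a b ,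
      solve 1 (λ b → b := con 0 :+ (b :* con 1 :+ con 0 :* con 0)) refl b

    +₂-≈ : ∀ {a b c d} {y} → (c , d) ≈₂ y → (a + c , b + d) ≈₂ (a , b) +₂ y
    +₂-≈ (p , q) = +-congˡ p , +-congˡ q

  R[√u] : CommutativeRing 0ℓ 0ℓ
  R[√u] = commutativeRing {_≈_ = _≈₂_}
    record { refl = refl , refl ; sym = λ { (p , q) → sym p , sym q } ; trans = λ { (p , q) (p′ , q′) → trans p p′ , trans q q′ } }
    {_+₂_} {_*₂_} { -₂_ } {0# , 0#} {1# , 0#}
    +₂-cong +₂-assoc +₂-comm +₂-identityˡ -₂-cong -₂-inverseˡ *₂-cong *₂-assoc *₂-comm *₂-identityˡ *₂-distribˡ-+₂

  module Q = CommutativeRing R[√u]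

  √u : Q.Carrier
  √u = 0# , 1#

  embed : Hom R R[√u]
  embed = record
    { ⟦_⟧ = λ a → a , 0#
    ; ⟦⟧-cong = λ e → e , refl
    ; +-homo = embed-+
    ; *-homo = embed-*
    ; 1-homo = refl , refl }

  open Hom embed using (⟦_⟧)

  annihilated : ∀ p → Annihilates p R → Annihilates p R[√u]
  annihilated p ann (a , b) = Q.trans (pairwise p) (ann a , ann b)
    where
    open import Algebra.Properties.Semiring.Mult semiring using () renaming (_×_ to _×₁_)
    open import Algebra.Properties.Semiring.Mult Q.semiring using (_×_)
    pairwise : ∀ n → n × (a , b) Q.≈ (n ×₁ a , n ×₁ b)
    pairwise zero = Q.refl
    pairwise (suc n) = Q.sym (+₂-≈ (Q.sym (pairwise n)))

  -- The universal property of R[√u]: a homomorphism f on R extends as soon as the intended image w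
  -- of √u satisfies w² = f(u).
  module Lift {S : CommutativeRing 0ℓ 0ℓ} (f : Hom R S) (w : CommutativeRing.Carrier S)
    (w² : CommutativeRing._≈_ S (CommutativeRing._*_ S w w) (Hom.⟦_⟧ f u)) where
    private
      module S = CommutativeRing S
      module F = Hom f
      import Algebra.Solver.Ring.NaturalCoefficients.Default as Solver
      module SS = Solver S.commutativeSemiring

    liftMap : Carrier ∧ Carrier → S.Carrier
    liftMap x = F.⟦ proj₁ x ⟧ S.+ F.⟦ proj₂ x ⟧ S.* w

    opaque
      unfolding _+₂_

      liftMap-+ : ∀ x y → liftMap (x +₂ y) S.≈ liftMap x S.+ liftMap y
      liftMap-+ (a , b) (c , d) = S.trans (S.+-cong (F.+-homo a c) (S.*-congʳ (F.+-homo b d)))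
          (SS.solve 5 (λ a b c d w → (a SS.:+ c) SS.:+ (b SS.:+ d) SS.:* w SS.:= (a SS.:+ b SS.:* w) SS.:+ (c SS.:+ d SS.:* w))
            S.refl F.⟦ a ⟧ F.⟦ b ⟧ F.⟦ c ⟧ F.⟦ d ⟧ w)

      liftMap-* : ∀ x y → liftMap (x *₂ y) S.≈ liftMap x S.* liftMap y
      liftMap-* (a , b) (c , d) = S.trans
          (S.+-cong (S.trans (F.+-homo _ _) (S.+-cong (F.*-homo a c)
                       (S.trans (F.*-homo u _) (S.*-cong (S.sym w²) (F.*-homo b d)))))
                    (S.*-congʳ (S.trans (F.+-homo _ _) (S.+-cong (F.*-homo a d) (F.*-homo b c)))))
          (SS.solve 5 (λ a b c d w → (a SS.:* c SS.:+ (w SS.:* w) SS.:* (b SS.:* d)) SS.:+ (a SS.:* d SS.:+ b SS.:* c) SS.:* w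
                          SS.:= (a SS.:+ b SS.:* w) SS.:* (c SS.:+ d SS.:* w))
            S.refl F.⟦ a ⟧ F.⟦ b ⟧ F.⟦ c ⟧ F.⟦ d ⟧ w)

    lift : Hom R[√u] S
    lift = record
      { ⟦_⟧ = liftMap
      ; ⟦⟧-cong = λ { (p , q) → S.+-cong (F.⟦⟧-cong p) (S.*-congʳ (F.⟦⟧-cong q)) }
      ; +-homo = liftMap-+
      ; *-homo = liftMap-*
      ; 1-homo = S.trans (S.+-cong F.1-homo (S.trans (S.*-congʳ F.0-homo) (S.zeroˡ w))) (S.+-identityʳ S.1#) }

  hom-decompose : ∀ {S} (f : Hom R[√u] S) → let open CommutativeRing S renaming (_≈_ to _≈ₛ_; _+_ to _+ₛ_; _*_ to _*ₛ_) in
                  ∀ a b → Hom.⟦_⟧ f (a , b) ≈ₛ (Hom.⟦_⟧ f ⟦ a ⟧ +ₛ (Hom.⟦_⟧ f ⟦ b ⟧ *ₛ Hom.⟦_⟧ f √u))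
  hom-decompose {S} f a b = S.trans (F.⟦⟧-cong (decompose (a , b))) (S.trans (F.+-homo _ _) (S.+-congˡ (F.*-homo _ _)))
    where
    module S = CommutativeRing S
    module F = Hom f

  hom-ext : ∀ {S} (f g : Hom R[√u] S) → let open CommutativeRing S renaming (_≈_ to _≈ₛ_) in
            (∀ a → Hom.⟦_⟧ f ⟦ a ⟧ ≈ₛ Hom.⟦_⟧ g ⟦ a ⟧) → Hom.⟦_⟧ f √u ≈ₛ Hom.⟦_⟧ g √u →
            ∀ x → Hom.⟦_⟧ f x ≈ₛ Hom.⟦_⟧ g x
  hom-ext {S} f g base root (a , b) = S.trans (hom-decompose f a b) (S.trans
      (S.+-cong (base a) (S.*-cong (base b) root)) (S.sym (hom-decompose g a b)))
    where module S = CommutativeRing S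

-- The ring ℤ[ζ₁₆]/m

module PolynomialIdentities (S : CommutativeRing 0ℓ 0ℓ) where
  open CommutativeRing S
  open PowerLemmas S

  open import Algebra.Solver.Ring.NaturalCoefficients.Default commutativeSemiring

  degree-7-rearrange : ∀ a e c g b f d h z →
    ((a + e * z ^ 4) + (c + g * z ^ 4) * z ^ 2) + ((b + f * z ^ 4) + (d + h * z ^ 4) * z ^ 2) * z
    ≈ a * z ^ 0 + (b * z ^ 1 + (c * z ^ 2 + (d * z ^ 3 + (e * z ^ 4 + (f * z ^ 5 + (g * z ^ 6 + (h * z ^ 7 + 0#)))))))
  degree-7-rearrange = solve 9 (λ a e c g b f d h z →
    ((a :+ e :* z :^ 4) :+ (c :+ g :* z :^ 4) :* z :^ 2) :+ ((b :+ f :* z :^ 4) :+ (d :+ h :* z :^ 4) :* z :^ 2) :* z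
    := a :* z :^ 0 :+ (b :* z :^ 1 :+ (c :* z :^ 2 :+ (d :* z :^ 3 :+ (e :* z :^ 4 :+ (f :* z :^ 5 :+ (g :* z :^ 6 :+ (h :* z :^ 7 :+ con 0)))))))) refl

-- ℤ[ζ₁₆]/m as the tower ℤ/m ⊂ ℤ[i]/m ⊂ ℤ[√i]/m ⊂ ℤ[√√i]/m.
module Cyclotomic (m : ℕ) where
  open Integers-mod m public
  module Q₁ = Quadratic ℤ/ (-[1+ 0 ])
  module Q₂ = Quadratic Q₁.R[√u] Q₁.√u
  module Q₃ = Quadratic Q₂.R[√u] Q₂.√u

  R : CommutativeRing 0ℓ 0ℓ
  R = Q₃.R[√u]

  open CommutativeRing R
  open PowerLemmas R
  module F = CommutativeRing ℤ/

  ζ : Carrier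
  ζ = Q₃.√u

  embedding : Hom ℤ/ R
  embedding = Q₃.embed ∘ʰ (Q₂.embed ∘ʰ Q₁.embed)
  open Hom embedding public using () renaming (⟦_⟧ to emb; ⟦⟧-cong to emb-cong; +-homo to emb-+; *-homo to emb-*; -‿homo to emb-neg)

  emb-injective : ∀ {a b} → emb a ≈ emb b → a F.≈ b
  emb-injective e = Q₁.re (Q₂.re (Q₃.re e))

  -- The order of the indices is bit reversal, since each adjunction of a square root splits the
  -- exponents of ζ into even and odd ones.
  toR : (Fin 8 → ℤ) → Carrier
  toR v = ((v 0F , v 4F) , (v 2F , v 6F)) , ((v 1F , v 5F) , (v 3F , v 7F))

  -- The integer counterpart of `ζpow` for r < 16, with the same conditionals, so that the two can
  -- be compared branch by branch.
  ζ-coefficient : ℕ → Fin 8 → ℤ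
  ζ-coefficient r i = if r ℕ.<ᵇ 8 then (if toℕ i ℕ.≡ᵇ r then + 1 else + 0)
                                  else (if toℕ i ℕ.≡ᵇ (r ℕ.∸ 8) then -[1+ 0 ] else + 0)

  constant : Carrier → ℤ
  constant x = proj₁ (proj₁ (proj₁ x))

  constant-cong : ∀ {x y} → x ≈ y → constant x F.≈ constant y
  constant-cong e = Q₁.re (Q₂.re (Q₃.re e))

  open PolynomialIdentities R

  -- The statements of this block are equalities of integer coordinates, which `refl` proves for all
  -- m at once.
  opaque
    unfolding Quadratic._+₂_

    i≈ζ⁴ : Hom.⟦_⟧ Q₃.embed (Hom.⟦_⟧ Q₂.embed Q₁.√u) ≈ ζ ^ 4
    i≈ζ⁴ = refl

    ζ₈≈ζ² : Hom.⟦_⟧ Q₃.embed Q₂.√u ≈ ζ ^ 2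
    ζ₈≈ζ² = refl

    i¹⁶ : PowerLemmas._^_ Q₁.R[√u] Q₁.√u 16 Q₁.≈₂ (+ 1 , + 0)
    i¹⁶ = Q₁.Q.refl

    ζ₈¹⁶ : PowerLemmas._^_ Q₂.R[√u] Q₂.√u 16 Q₂.≈₂ ((+ 1 , + 0) , (+ 0 , + 0))
    ζ₈¹⁶ = Q₂.Q.refl

    ζ¹⁶ : ζ ^ 16 ≈ 1#
    ζ¹⁶ = refl

    toR-+ : ∀ v w → toR (λ i → v i ℤ.+ w i) ≈ toR v + toR w
    toR-+ v w = refl

    -- Odd powers of ζ are again roots of X⁸ + 1, which is what a substitution for ζ requires.
    ζ-odd-power : (k : Fin 8) → (ζ ^ suc (2 ℕ.* toℕ k)) ^ 8 ≈ emb -[1+ 0 ]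
    ζ-odd-power 0F = refl
    ζ-odd-power 1F = refl
    ζ-odd-power 2F = refl
    ζ-odd-power 3F = refl
    ζ-odd-power 4F = refl
    ζ-odd-power 5F = refl
    ζ-odd-power 6F = refl
    ζ-odd-power 7F = refl

    toR-ζ-power : (r : Fin 16) → toR (ζ-coefficient (toℕ r)) ≈ ζ ^ toℕ r
    toR-ζ-power 0F = refl
    toR-ζ-power 1F = refl
    toR-ζ-power 2F = refl
    toR-ζ-power 3F = refl
    toR-ζ-power 4F = refl
    toR-ζ-power 5F = refl
    toR-ζ-power 6F = refl
    toR-ζ-power 7F = refl
    toR-ζ-power 8F = refl
    toR-ζ-power 9F = refl
    toR-ζ-power (Fin.suc 9F) = refl
    toR-ζ-power (Fin.suc (Fin.suc 9F)) = refl
    toR-ζ-power (Fin.suc (Fin.suc (Fin.suc 9F))) = refl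
    toR-ζ-power (Fin.suc (Fin.suc (Fin.suc (Fin.suc 9F)))) = refl
    toR-ζ-power (Fin.suc (Fin.suc (Fin.suc (Fin.suc (Fin.suc 9F))))) = refl
    toR-ζ-power (Fin.suc (Fin.suc (Fin.suc (Fin.suc (Fin.suc (Fin.suc 9F)))))) = refl

  toR-expand : ∀ v → toR v ≈ emb (v 0F) * ζ ^ 0 + (emb (v 1F) * ζ ^ 1 + (emb (v 2F) * ζ ^ 2 + (emb (v 3F) * ζ ^ 3
             + (emb (v 4F) * ζ ^ 4 + (emb (v 5F) * ζ ^ 5 + (emb (v 6F) * ζ ^ 6 + (emb (v 7F) * ζ ^ 7 + 0#)))))))
  toR-expand v = begin
    toR v
      ≈⟨ Q₃.decompose (toR v) ⟩
    E₃.⟦ proj₁ (toR v) ⟧ + E₃.⟦ proj₂ (toR v) ⟧ * ζ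
      ≈⟨ +-cong (expand₂ (v 0F) (v 4F) (v 2F) (v 6F)) (*-congʳ {ζ} (expand₂ (v 1F) (v 5F) (v 3F) (v 7F))) ⟩
    ((emb (v 0F) + emb (v 4F) * ζ ^ 4) + (emb (v 2F) + emb (v 6F) * ζ ^ 4) * ζ ^ 2)
      + ((emb (v 1F) + emb (v 5F) * ζ ^ 4) + (emb (v 3F) + emb (v 7F) * ζ ^ 4) * ζ ^ 2) * ζ
      ≈⟨ degree-7-rearrange (emb (v 0F)) (emb (v 4F)) (emb (v 2F)) (emb (v 6F)) (emb (v 1F)) (emb (v 5F)) (emb (v 3F)) (emb (v 7F)) ζ ⟩
    emb (v 0F) * ζ ^ 0 + (emb (v 1F) * ζ ^ 1 + (emb (v 2F) * ζ ^ 2 + (emb (v 3F) * ζ ^ 3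
      + (emb (v 4F) * ζ ^ 4 + (emb (v 5F) * ζ ^ 5 + (emb (v 6F) * ζ ^ 6 + (emb (v 7F) * ζ ^ 7 + 0#))))))) ∎
    where
    open import Relation.Binary.Reasoning.Setoid setoid
    module E₂ = Hom Q₂.embed
    module E₃ = Hom Q₃.embed
    expand₁ : ∀ a b → E₃.⟦ E₂.⟦ a , b ⟧ ⟧ ≈ emb a + emb b * ζ ^ 4
    expand₁ a b = begin
      E₃.⟦ E₂.⟦ a , b ⟧ ⟧                  ≈⟨ Q₁.hom-decompose {R} (Q₃.embed ∘ʰ Q₂.embed) a b ⟩
      emb a + emb b * E₃.⟦ E₂.⟦ Q₁.√u ⟧ ⟧  ≈⟨ +-congˡ {emb a} (*-congˡ {emb b} i≈ζ⁴) ⟩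
      emb a + emb b * ζ ^ 4                ∎
    expand₂ : ∀ a b c d → E₃.⟦ (a , b) , (c , d) ⟧ ≈ (emb a + emb b * ζ ^ 4) + (emb c + emb d * ζ ^ 4) * ζ ^ 2
    expand₂ a b c d = begin
      E₃.⟦ (a , b) , (c , d) ⟧                                  ≈⟨ Q₂.hom-decompose {R} Q₃.embed (a , b) (c , d) ⟩
      E₃.⟦ E₂.⟦ a , b ⟧ ⟧ + E₃.⟦ E₂.⟦ c , d ⟧ ⟧ * E₃.⟦ Q₂.√u ⟧   ≈⟨ +-cong (expand₁ a b) (*-cong (expand₁ c d) ζ₈≈ζ²) ⟩
      (emb a + emb b * ζ ^ 4) + (emb c + emb d * ζ ^ 4) * ζ ^ 2  ∎

  -- The endomorphism ζ ↦ w, lifted through the tower one square root at a time with i ↦ w⁴, ζ₈ ↦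
  -- w², ζ ↦ w.
  module Substitution (w : Carrier) (w⁸ : w ^ 8 ≈ emb -[1+ 0 ]) where
    private
      module L₁ = Q₁.Lift embedding (w ^ 4) (trans (sym (^-homo-* w 4 4)) w⁸)
      root : ∀ {S : CommutativeRing 0ℓ 0ℓ} (f : Hom S R) x y → x ≈ y →
             x ≈ Hom.⟦_⟧ f (CommutativeRing.0# S) + Hom.⟦_⟧ f (CommutativeRing.1# S) * y
      root f x y e = trans e (sym (trans (+-cong (Hom.0-homo f) (trans (*-congʳ (Hom.1-homo f)) (*-identityˡ y))) (+-identityˡ y)))
      module L₂ = Q₂.Lift L₁.lift (w ^ 2)
        (root embedding _ _ (sym (^-homo-* w 2 2)))
      module L₃ = Q₃.Lift L₂.lift w
        (root L₁.lift _ _ (*-congˡ (sym (^-one w))))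
    substitution : Hom R R
    substitution = L₃.lift

    open Hom substitution

    private
      lift-base : ∀ {S : CommutativeRing 0ℓ 0ℓ} (f : Hom S R) x y → Hom.⟦_⟧ f x + Hom.⟦_⟧ f (CommutativeRing.0# S) * y ≈ Hom.⟦_⟧ f x
      lift-base f x y = trans (+-congˡ (trans (*-congʳ (Hom.0-homo f)) (zeroˡ y))) (+-identityʳ _)

    substitution-emb : ∀ a → ⟦ emb a ⟧ ≈ emb a
    substitution-emb a = trans (lift-base L₂.lift _ _) (trans (lift-base L₁.lift _ _) (lift-base embedding _ _))

    substitution-ζ : ⟦ ζ ⟧ ≈ w
    substitution-ζ = sym (root L₂.lift w w refl)

  hom-ext : ∀ (f g : Hom R R) → (∀ a → Hom.⟦_⟧ f (emb a) ≈ Hom.⟦_⟧ g (emb a)) → Hom.⟦_⟧ f ζ ≈ Hom.⟦_⟧ g ζ → ∀ x → Hom.⟦_⟧ f x ≈ Hom.⟦_⟧ g x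
  hom-ext f g base root = Q₃.hom-ext {R} f g
    (Q₂.hom-ext {R} (f ∘ʰ Q₃.embed) (g ∘ʰ Q₃.embed)
      (Q₁.hom-ext {R} (f ∘ʰ (Q₃.embed ∘ʰ Q₂.embed)) (g ∘ʰ (Q₃.embed ∘ʰ Q₂.embed)) base (via 4 i≈ζ⁴))
      (via 2 ζ₈≈ζ²)) root
    where
    powers : ∀ n → Hom.⟦_⟧ f (ζ ^ n) ≈ Hom.⟦_⟧ g (ζ ^ n)
    powers n = trans (Hom.^-homo f ζ n) (trans (^-congˡ n root) (sym (Hom.^-homo g ζ n)))
    via : ∀ {x} → (n : ℕ) → x ≈ ζ ^ n → Hom.⟦_⟧ f x ≈ Hom.⟦_⟧ g x
    via n e = trans (Hom.⟦⟧-cong f e) (trans (powers n) (sym (Hom.⟦⟧-cong g e)))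

  private module Galois (k : Fin 8) = Substitution (ζ ^ suc (2 ℕ.* toℕ k)) (ζ-odd-power k)

  ζ-power : ∀ n → ζ ^ n ≈ toR (ζ-coefficient (n ℕ.% 16))
  ζ-power n = begin
    ζ ^ n                                  ≡⟨ ≡.cong (ζ ^_) (ℕM.m≡m%n+[m/n]*n n 16) ⟩
    ζ ^ (n ℕ.% 16 ℕ.+ n ℕ./ 16 ℕ.* 16)     ≈⟨ ^-periodic ζ 16 (n ℕ.% 16) (n ℕ./ 16) ζ¹⁶ ⟩
    ζ ^ (n ℕ.% 16)                         ≡⟨ ≡.cong (ζ ^_) (≡.sym r≡) ⟩
    ζ ^ toℕ r                              ≈⟨ sym (toR-ζ-power r) ⟩
    toR (ζ-coefficient (toℕ r))            ≡⟨ ≡.cong (λ z → toR (ζ-coefficient z)) r≡ ⟩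
    toR (ζ-coefficient (n ℕ.% 16))         ∎
    where
    open import Relation.Binary.Reasoning.Setoid setoid
    r : Fin 16
    r = Fin.fromℕ< (ℕM.m%n<n n 16)
    r≡ : toℕ r ≡ n ℕ.% 16
    r≡ = FinP.toℕ-fromℕ< (ℕM.m%n<n n 16)

  opaque
    -- The index k stands for the automorphism σ of index 2k + 1: 1F, 2F, 3F, 4F are σ₃, σ₅, σ₇, σ₉,
    -- while 5F and 6F are σ₋₅ and σ₋₃, and 7F is complex conjugation.
    σᴿ : Fin 8 → Carrier → Carrier
    σᴿ k = Hom.⟦_⟧ (Galois.substitution k)

    σ-cong : ∀ k {x y} → x ≈ y → σᴿ k x ≈ σᴿ k y
    σ-cong k = Hom.⟦⟧-cong (Galois.substitution k)

    σ-+ : ∀ k x y → σᴿ k (x + y) ≈ σᴿ k x + σᴿ k y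
    σ-+ k = Hom.+-homo (Galois.substitution k)

    σ-* : ∀ k x y → σᴿ k (x * y) ≈ σᴿ k x * σᴿ k y
    σ-* k = Hom.*-homo (Galois.substitution k)

    σ-1 : ∀ k → σᴿ k 1# ≈ 1#
    σ-1 k = Hom.1-homo (Galois.substitution k)

    σ-emb : ∀ k a → σᴿ k (emb a) ≈ emb a
    σ-emb = Galois.substitution-emb

    σ-ζ : ∀ k → σᴿ k ζ ≈ ζ ^ suc (2 ℕ.* toℕ k)
    σ-ζ = Galois.substitution-ζ

  σ-hom : Fin 8 → Hom R R
  σ-hom k = record { ⟦_⟧ = σᴿ k ; ⟦⟧-cong = σ-cong k ; +-homo = σ-+ k ; *-homo = σ-* k ; 1-homo = σ-1 k }

module FrobeniusFixed (p : ℕ) (pp : Prime p) where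
  open Cyclotomic p

  private
    module FZ = Frobenius ℤ/ p pp ℤ/-annihilated
    open PowerLemmas ℤ/ using () renaming (_^_ to _^ᶠ_; 1^ to 1^ᶠ; 0^ to 0^ᶠ)
    import Algebra.Properties.Group as GP

  fermat : ∀ a → (a ^ᶠ p) F.≈ a
  fermat (+ zero) = 0^ᶠ p {{prime⇒nonZero pp}}
  fermat (+ suc n) = F.trans (FZ.frobenius-+ (+ 1) (+ n)) (F.+-cong (1^ᶠ p) (fermat (+ n)))
  -- (-1)^p + 1^p = (-1 + 1)^p = 0, so the parity of p does not enter.
  fermat -[1+ zero ] = GP.inverseˡ-unique F.+-group _ _
    (F.trans (F.+-congˡ {(-[1+ 0 ]) ^ᶠ p} (F.sym (1^ᶠ p))) (F.trans (F.sym (FZ.frobenius-+ -[1+ 0 ] (+ 1))) (0^ᶠ p {{prime⇒nonZero pp}})))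
  fermat -[1+ suc n ] = F.trans (FZ.frobenius-+ -[1+ 0 ] -[1+ n ]) (F.+-cong (fermat -[1+ 0 ]) (fermat -[1+ n ]))

  module Extend (S : CommutativeRing 0ℓ 0ℓ) (u : CommutativeRing.Carrier S) (ann : Annihilates p S) (k : ℕ) where
    open Quadratic S u
    open PowerLemmas S using () renaming (_^_ to _^ₛ_)
    open PowerLemmas R[√u]
    open CommutativeRing S using () renaming (_≈_ to _≈ₛ_)
    module FQ = Frobenius R[√u] p pp (annihilated p ann)

    -- The iterated Frobenius map is additive and multiplicative, so on a + b√u only its effect on
    -- a, b and √u matters.
    extend : (∀ a → (a ^ₛ (p ℕ.^ k)) ≈ₛ a) → (√u ^ (p ℕ.^ k)) Q.≈ √u → ∀ x → (x ^ (p ℕ.^ k)) Q.≈ x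
    extend base root x@(a , b) = begin
      x ^ q                          ≈⟨ ^-congˡ q (decompose x) ⟩
      (⟦ a ⟧ Q.+ ⟦ b ⟧ Q.* √u) ^ q    ≈⟨ FQ.frobenius-iterate-+ k _ _ ⟩
      ⟦ a ⟧ ^ q Q.+ (⟦ b ⟧ Q.* √u) ^ q ≈⟨ Q.+-cong (base′ a) (Q.trans (^-distrib-* _ _ q) (Q.*-cong (base′ b) root)) ⟩
      ⟦ a ⟧ Q.+ ⟦ b ⟧ Q.* √u           ≈⟨ decompose x ⟨
      x                              ∎
      where
      q = p ℕ.^ k
      open Hom embed
      open import Relation.Binary.Reasoning.Setoid Q.setoid
      base′ : ∀ a → (⟦ a ⟧ ^ q) Q.≈ ⟦ a ⟧
      base′ a = Q.trans (Q.sym (^-homo a q)) (⟦⟧-cong (base a))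

  open CommutativeRing R
  open PowerLemmas R

  fermat-iterate : ∀ k a → (a ^ᶠ (p ℕ.^ k)) F.≈ a
  fermat-iterate zero a = F.*-identityʳ a
  fermat-iterate (suc k) a = F.trans (F.sym (PL.^-assocʳ a p (p ℕ.^ k))) (F.trans (PL.^-congˡ (p ℕ.^ k) (fermat a)) (fermat-iterate k a))
    where module PL = PowerLemmas ℤ/

  -- The k-th iterate of Frobenius fixes ℤ/p and, as p^k ≡ 1 mod 16, every element with 16th power
  -- 1; i, ζ₈ and ζ are such elements and generate the tower.
  frobenius-fixed : ∀ k t → p ℕ.^ k ≡ 1 ℕ.+ t ℕ.* 16 → ∀ x → x ^ (p ℕ.^ k) ≈ x
  frobenius-fixed k t e =
    E₃.extend (E₂.extend (E₁.extend (fermat-iterate k)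
      (root Q₁.R[√u] Q₁.√u i¹⁶))
      (root Q₂.R[√u] Q₂.√u ζ₈¹⁶))
      (root R ζ ζ¹⁶)
    where
    module E₁ = Extend ℤ/ (-[1+ 0 ]) ℤ/-annihilated k
    module E₂ = Extend Q₁.R[√u] Q₁.√u (Q₁.annihilated p ℤ/-annihilated) k
    module E₃ = Extend Q₂.R[√u] Q₂.√u (Q₂.annihilated p (Q₁.annihilated p ℤ/-annihilated)) k
    root : ∀ (S : CommutativeRing 0ℓ 0ℓ) → let open CommutativeRing S using () renaming (_≈_ to _≈ₛ_; 1# to 1ₛ)
                                               open PowerLemmas S using () renaming (_^_ to _^ₛ_) in
           ∀ w → (w ^ₛ 16) ≈ₛ 1ₛ → (w ^ₛ (p ℕ.^ k)) ≈ₛ w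
    root S w w¹⁶ = S.trans (P.^-congʳ w e) (S.trans (P.^-periodic w 16 1 t w¹⁶) (S.*-identityʳ w))
      where
      module S = CommutativeRing S
      module P = PowerLemmas S

-- The group ring of a cyclic group

module Cyclic (k : ℕ) where
  n : ℕ
  n = suc k

  infixl 6 _⊞_ _⊟_
  residue : ℕ → Fin n
  residue m = Fin.fromℕ< (ℕM.m%n<n m n)

  toℕ-residue : ∀ m → toℕ (residue m) ≡ m ℕ.% n
  toℕ-residue m = FinP.toℕ-fromℕ< _

  residue-cong : ∀ m m′ → m ℕ.% n ≡ m′ ℕ.% n → residue m ≡ residue m′
  residue-cong m m′ e = FinP.toℕ-injective (≡.trans (toℕ-residue m) (≡.trans e (≡.sym (toℕ-residue m′))))

  residue-toℕ : ∀ i → residue (toℕ i) ≡ i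
  residue-toℕ i = FinP.toℕ-injective (≡.trans (toℕ-residue (toℕ i)) (ℕM.m<n⇒m%n≡m (FinP.toℕ<n i)))

  _⊞_ : Fin n → Fin n → Fin n
  a ⊞ b = residue (toℕ a ℕ.+ toℕ b)

  neg : Fin n → Fin n
  neg a = residue (n ℕ.∸ toℕ a)

  private
    absorbˡ : ∀ m l → (m ℕ.% n ℕ.+ l) ℕ.% n ≡ (m ℕ.+ l) ℕ.% n
    absorbˡ m l = ≡.trans (ℕM.%-distribˡ-+ (m ℕ.% n) l n)
      (≡.trans (≡.cong (λ z → (z ℕ.+ l ℕ.% n) ℕ.% n) (ℕM.m%n%n≡m%n m n)) (≡.sym (ℕM.%-distribˡ-+ m l n)))

  residue-+ˡ : ∀ m l → residue (toℕ (residue m) ℕ.+ l) ≡ residue (m ℕ.+ l)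
  residue-+ˡ m l = residue-cong (toℕ (residue m) ℕ.+ l) (m ℕ.+ l) (≡.trans (≡.cong (λ z → (z ℕ.+ l) ℕ.% n) (toℕ-residue m)) (absorbˡ m l))

  residue-+ʳ : ∀ m l → residue (l ℕ.+ toℕ (residue m)) ≡ residue (l ℕ.+ m)
  residue-+ʳ m l = ≡.trans (≡.cong residue (ℕP.+-comm l _)) (≡.trans (residue-+ˡ m l) (≡.cong residue (ℕP.+-comm m l)))

  ⊞-comm : ∀ a b → a ⊞ b ≡ b ⊞ a
  ⊞-comm a b = ≡.cong residue (ℕP.+-comm (toℕ a) (toℕ b))

  ⊞-assoc : ∀ a b c → (a ⊞ b) ⊞ c ≡ a ⊞ (b ⊞ c)
  ⊞-assoc a b c = ≡.trans (residue-+ˡ (toℕ a ℕ.+ toℕ b) (toℕ c))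
    (≡.trans (≡.cong residue (ℕP.+-assoc (toℕ a) (toℕ b) (toℕ c))) (≡.sym (residue-+ʳ (toℕ b ℕ.+ toℕ c) (toℕ a))))

  ⊞-identityʳ : ∀ a → a ⊞ Fin.zero ≡ a
  ⊞-identityʳ a = ≡.trans (≡.cong residue (ℕP.+-identityʳ (toℕ a))) (residue-toℕ a)

  ⊞-inverseʳ : ∀ a → a ⊞ (neg a) ≡ Fin.zero
  ⊞-inverseʳ a = ≡.trans (residue-+ʳ (n ℕ.∸ toℕ a) (toℕ a))
    (residue-cong (toℕ a ℕ.+ (n ℕ.∸ toℕ a)) 0 (≡.trans (≡.cong (ℕ._% n) (ℕP.m+[n∸m]≡n (ℕP.<⇒≤ (FinP.toℕ<n a)))) (ℕM.n%n≡0 n)))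

  _⊟_ : Fin n → Fin n → Fin n
  a ⊟ b = a ⊞ (neg b)

  ⊞-⊟-cancel : ∀ a b → (a ⊞ b) ⊟ b ≡ a
  ⊞-⊟-cancel a b = ≡.trans (⊞-assoc a b (neg b)) (≡.trans (≡.cong (a ⊞_) (⊞-inverseʳ b)) (⊞-identityʳ a))

  ⊟-⊞-cancel : ∀ a b → (a ⊟ b) ⊞ b ≡ a
  ⊟-⊞-cancel a b = ≡.trans (⊞-assoc a (neg b) b)
    (≡.trans (≡.cong (a ⊞_) (≡.trans (⊞-comm (neg b) b) (⊞-inverseʳ b))) (⊞-identityʳ a))

  ⊟-unique : ∀ {a b c} → a ⊞ b ≡ c → a ≡ c ⊟ b
  ⊟-unique {a} {b} e = ≡.trans (≡.sym (⊞-⊟-cancel a b)) (≡.cong (_⊟ b) e)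

  ⊟-involutive : ∀ u s → u ⊟ (u ⊟ s) ≡ s
  ⊟-involutive u s = ≡.sym (⊟-unique (≡.trans (⊞-comm s (u ⊟ s)) (⊟-⊞-cancel u s)))

  ⊟-⊞ : ∀ u v r → (u ⊟ r) ⊟ v ≡ u ⊟ (v ⊞ r)
  ⊟-⊞ u v r = ⊟-unique (≡.trans (≡.sym (⊞-assoc ((u ⊟ r) ⊟ v) v r))
    (≡.trans (≡.cong (_⊞ r) (⊟-⊞-cancel (u ⊟ r) v)) (⊟-⊞-cancel u r)))

  ⊟-zero : ∀ u → u ⊟ Fin.zero ≡ u
  ⊟-zero u = ≡.sym (⊟-unique (⊞-identityʳ u))

  infixr 8 _•_
  _•_ : ℕ → Fin n → Fin n
  m • t = residue (m ℕ.* toℕ t)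

  •-suc : ∀ m t → t ⊞ m • t ≡ suc m • t
  •-suc m t = residue-+ʳ (m ℕ.* toℕ t) (toℕ t)

  •-mod : ∀ m t → m • t ≡ (m ℕ.% n) • t
  •-mod m t = residue-cong (m ℕ.* toℕ t) (m ℕ.% n ℕ.* toℕ t) (≡.trans (ℕM.%-distribˡ-* m (toℕ t) n) (≡.trans
    (≡.cong (λ z → (z ℕ.* (toℕ t ℕ.% n)) ℕ.% n) (≡.sym (ℕM.m%n%n≡m%n m n))) (≡.sym (ℕM.%-distribˡ-* (m ℕ.% n) (toℕ t) n))))

module GroupRing (R : CommutativeRing 0ℓ 0ℓ) (k : ℕ) where
  open Cyclic k
  open CommutativeRing R
  open import Algebra.Properties.Semiring.Sum semiring
  open import Relation.Binary.Reasoning.Setoid setoid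
  import Algebra.Definitions

  Group-algebra : Set
  Group-algebra = Fin n → Carrier

  infix 4 _≈ᵍ_
  record _≈ᵍ_ (f g : Group-algebra) : Set where
    constructor pointwise
    field at : ∀ u → f u ≈ g u
  open _≈ᵍ_ public

  monomial : Carrier → Fin n → Group-algebra
  monomial c s r = if does (r Fin.≟ s) then c else 0#

  infixl 6 _+ᵍ_
  infixl 7 _*ᵍ_
  opaque
    _+ᵍ_ _*ᵍ_ : Group-algebra → Group-algebra → Group-algebra
    (f +ᵍ g) u = f u + g u
    (f *ᵍ g) u = sum (λ s → f s * g (u ⊟ s))

    -ᵍ_ : Group-algebra → Group-algebra
    (-ᵍ f) u = - f u

  open Algebra.Definitions _≈ᵍ_

  private
    sum-single : ∀ {m} (f : Fin m → Carrier) s → (∀ r → r ≡ s → f r ≈ f s) → (∀ r → (r ≡ s → ⊥) → f r ≈ 0#) → sum f ≈ f s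
    sum-single {suc m} f Fin.zero _ off = trans (+-congˡ (trans (sum-cong-≋ (λ r → off (Fin.suc r) λ ())) (sum-replicate-zero m))) (+-identityʳ _)
    sum-single {suc m} f (Fin.suc s) on off = trans (+-cong (off Fin.zero λ ())
      (sum-single (λ r → f (Fin.suc r)) s (λ { r ≡.refl → refl }) (λ r ne → off (Fin.suc r) (λ e → ne (FinP.suc-injective e))))) (+-identityˡ _)

    monomial-on : ∀ c s → monomial c s s ≈ c
    monomial-on c s with s Fin.≟ s
    ... | yes _ = refl
    ... | no ne = contradiction ≡.refl ne

    monomial-off : ∀ c s r → (r ≡ s → ⊥) → monomial c s r ≈ 0#
    monomial-off c s r ne with r Fin.≟ s
    ... | yes e = contradiction e ne
    ... | no _ = refl

  opaque
    unfolding _+ᵍ_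

    +ᵍ-cong : Congruent₂ _+ᵍ_
    +ᵍ-cong (pointwise p) (pointwise q) = pointwise λ u → +-cong (p u) (q u)

    +ᵍ-assoc : Associative _+ᵍ_
    +ᵍ-assoc f g h = pointwise λ u → +-assoc _ _ _

    +ᵍ-comm : Commutative _+ᵍ_
    +ᵍ-comm f g = pointwise λ u → +-comm _ _

    +ᵍ-identityˡ : LeftIdentity (λ _ → 0#) _+ᵍ_
    +ᵍ-identityˡ f = pointwise λ u → +-identityˡ _

    -ᵍ-cong : Congruent₁ -ᵍ_
    -ᵍ-cong (pointwise p) = pointwise λ u → -‿cong (p u)

    -ᵍ-inverseˡ : LeftInverse (λ _ → 0#) -ᵍ_ _+ᵍ_
    -ᵍ-inverseˡ f = pointwise λ u → -‿inverseˡ _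

    *ᵍ-cong : Congruent₂ _*ᵍ_
    *ᵍ-cong (pointwise p) (pointwise q) = pointwise λ u → sum-cong-≋ (λ s → *-cong (p s) (q (u ⊟ s)))

    *ᵍ-comm : Commutative _*ᵍ_
    *ᵍ-comm f g = pointwise λ u → begin
      sum (λ s → f s * g (u ⊟ s))
        ≈⟨ sum-permute (λ s → f s * g (u ⊟ s)) (permutation (u ⊟_) (u ⊟_) (⊟-involutive u) (⊟-involutive u)) ⟩
      sum (λ s → f (u ⊟ s) * g (u ⊟ (u ⊟ s)))
        ≈⟨ sum-cong-≋ (λ s → trans (*-comm (f (u ⊟ s)) (g (u ⊟ (u ⊟ s)))) (*-congʳ {f (u ⊟ s)} (reflexive (≡.cong g (⊟-involutive u s))))) ⟩
      sum (λ s → g s * f (u ⊟ s)) ∎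

    *ᵍ-assoc : Associative _*ᵍ_
    *ᵍ-assoc f g h = pointwise λ u → begin
      sum (λ s → sum (λ r → f r * g (s ⊟ r)) * h (u ⊟ s))
        ≈⟨ sum-cong-≋ (λ s → trans (*-distribʳ-sum (h (u ⊟ s)) (λ r → f r * g (s ⊟ r))) (sum-cong-≋ {n} (λ r → *-assoc (f r) (g (s ⊟ r)) (h (u ⊟ s))))) ⟩
      sum (λ s → sum (λ r → f r * (g (s ⊟ r) * h (u ⊟ s))))
        ≈⟨ ∑-comm (λ s r → f r * (g (s ⊟ r) * h (u ⊟ s))) ⟩
      sum (λ r → sum (λ s → f r * (g (s ⊟ r) * h (u ⊟ s))))
        ≈⟨ sum-cong-≋ {n} (λ r → sym (*-distribˡ-sum (f r) (λ s → g (s ⊟ r) * h (u ⊟ s)))) ⟩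
      sum (λ r → f r * sum (λ s → g (s ⊟ r) * h (u ⊟ s)))
        ≈⟨ sum-cong-≋ {n} (λ r → *-congˡ {f r} (sum-permute (λ s → g (s ⊟ r) * h (u ⊟ s))
             (permutation (_⊞ r) (_⊟ r) (λ v → ⊟-⊞-cancel v r) (λ v → ⊞-⊟-cancel v r)))) ⟩
      sum (λ r → f r * sum (λ v → g ((v ⊞ r) ⊟ r) * h (u ⊟ (v ⊞ r))))
        ≈⟨ sum-cong-≋ {n} (λ r → *-congˡ {f r} (sum-cong-≋ {n} (λ v → *-cong (reflexive (≡.cong g (⊞-⊟-cancel v r)))
             (reflexive (≡.cong h (≡.sym (⊟-⊞ u v r))))))) ⟩
      sum (λ r → f r * sum (λ v → g v * h ((u ⊟ r) ⊟ v))) ∎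

    monomial-* : ∀ c s g u → (monomial c s *ᵍ g) u ≈ c * g (u ⊟ s)
    monomial-* c s g u = trans
      (sum-single (λ r → monomial c s r * g (u ⊟ r)) s (λ { r ≡.refl → refl }) (λ r ne → trans (*-congʳ {g (u ⊟ r)} (monomial-off c s r ne)) (zeroˡ (g (u ⊟ r)))))
      (*-congʳ (monomial-on c s))

    *ᵍ-identityˡ : LeftIdentity (monomial 1# Fin.zero) _*ᵍ_
    *ᵍ-identityˡ g = pointwise λ u → trans (monomial-* 1# Fin.zero g u) (trans (*-identityˡ _) (reflexive (≡.cong g (⊟-zero u))))

    *ᵍ-distribˡ-+ᵍ : _*ᵍ_ DistributesOverˡ _+ᵍ_
    *ᵍ-distribˡ-+ᵍ f g h = pointwise λ u → trans (sum-cong-≋ {n} (λ s → distribˡ (f s) (g (u ⊟ s)) (h (u ⊟ s))))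
      (∑-distrib-+ (λ s → f s * g (u ⊟ s)) (λ s → f s * h (u ⊟ s)))

    monomial-+ : ∀ c d s → monomial (c + d) s ≈ᵍ monomial c s +ᵍ monomial d s
    monomial-+ c d s = pointwise helper
      where
      helper : ∀ u → monomial (c + d) s u ≈ monomial c s u + monomial d s u
      helper u with u Fin.≟ s
      ... | yes _ = refl
      ... | no _ = sym (+-identityˡ 0#)

    +ᵍ-pointwise : ∀ f {g} u {x} → g u ≈ x → f u + x ≈ (f +ᵍ g) u
    +ᵍ-pointwise f u e = +-congˡ (sym e)

  R[C] : CommutativeRing 0ℓ 0ℓ
  R[C] = commutativeRing {_≈_ = _≈ᵍ_}
    record { refl = pointwise λ _ → refl ; sym = λ e → pointwise λ u → sym (at e u) ; trans = λ e f → pointwise λ u → trans (at e u) (at f u) }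
    {_+ᵍ_} {_*ᵍ_} { -ᵍ_ } {λ _ → 0#} {monomial 1# Fin.zero}
    +ᵍ-cong +ᵍ-assoc +ᵍ-comm +ᵍ-identityˡ -ᵍ-cong -ᵍ-inverseˡ *ᵍ-cong *ᵍ-assoc *ᵍ-comm *ᵍ-identityˡ *ᵍ-distribˡ-+ᵍ

  module G = CommutativeRing R[C]
  open PowerLemmas R[C] using () renaming (_^_ to _^ᵍ_)
  open PowerLemmas R using (_^_; ^-congʳ)

  monomial-cong : ∀ {c d s t} → c ≈ d → s ≡ t → monomial c s ≈ᵍ monomial d t
  monomial-cong {c} {d} {s} e ≡.refl = pointwise helper
    where
    helper : ∀ u → monomial c s u ≈ monomial d s u
    helper u with u Fin.≟ s
    ... | yes _ = e
    ... | no _ = refl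

  monomial-*-monomial : ∀ c s d t → monomial c s *ᵍ monomial d t ≈ᵍ monomial (c * d) (s ⊞ t)
  monomial-*-monomial c s d t = pointwise λ u → trans (monomial-* c s (monomial d t) u) (helper u)
    where
    helper : ∀ u → c * monomial d t (u ⊟ s) ≈ monomial (c * d) (s ⊞ t) u
    helper u with (u ⊟ s) Fin.≟ t | u Fin.≟ (s ⊞ t)
    ... | yes _ | yes _ = refl
    ... | no _  | no _  = zeroʳ c
    ... | yes e | no ne = contradiction (≡.trans (≡.sym (⊟-⊞-cancel u s)) (≡.trans (≡.cong (_⊞ s) e) (⊞-comm t s))) ne
    ... | no ne | yes e = contradiction (≡.trans (≡.cong (_⊟ s) (≡.trans e (⊞-comm s t))) (⊞-⊟-cancel t s)) ne

  monomial-^ : ∀ c t m → monomial c t ^ᵍ m ≈ᵍ monomial (c ^ m) (m • t)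
  monomial-^ c t zero = G.refl
  monomial-^ c t (suc m) = G.trans (G.*-congˡ (monomial-^ c t m))
    (G.trans (monomial-*-monomial c t (c ^ m) (m • t)) (monomial-cong refl (•-suc m t)))

  constants : Hom R R[C]
  constants = record
    { ⟦_⟧ = λ c → monomial c Fin.zero
    ; ⟦⟧-cong = λ e → monomial-cong e ≡.refl
    ; +-homo = λ c d → monomial-+ c d Fin.zero
    ; *-homo = λ c d → G.sym (G.trans (monomial-*-monomial c Fin.zero d Fin.zero) (monomial-cong refl (⊞-identityʳ Fin.zero)))
    ; 1-homo = G.refl }

  constants-* : ∀ c g u → (monomial c Fin.zero *ᵍ g) u ≈ c * g u
  constants-* c g u = trans (monomial-* c Fin.zero g u) (*-congˡ (reflexive (≡.cong g (⊟-zero u))))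

  annihilated : ∀ p → Annihilates p R → Annihilates p R[C]
  annihilated p ann f = pointwise λ u → trans (pairwise p u) (ann (f u))
    where
    open import Algebra.Properties.Semiring.Mult semiring using () renaming (_×_ to _×₁_)
    open import Algebra.Properties.Semiring.Mult G.semiring using (_×_)
    pairwise : ∀ m u → (m × f) u ≈ m ×₁ f u
    pairwise zero u = refl
    pairwise (suc m) u = sym (+ᵍ-pointwise f u (pairwise m u))

  open import Algebra.Properties.Semiring.Sum G.semiring using () renaming (sum to sumᵍ)

  opaque
    unfolding _+ᵍ_

    sumᵍ-at : ∀ {m} (F : Fin m → Group-algebra) u → sumᵍ F u ≈ sum (λ t → F t u)
    sumᵍ-at {zero} F u = refl
    sumᵍ-at {suc m} F u = +-congˡ (sumᵍ-at (λ t → F (Fin.suc t)) u)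

  -- Brings an element into the shape to which `frobenius-sum` applies, where only powers of
  -- monomials remain to be computed.
  sum-of-monomials : ∀ f → f ≈ᵍ sumᵍ (λ t → monomial (f t) t)
  sum-of-monomials f = pointwise λ u → sym (trans (sumᵍ-at (λ t → monomial (f t) t) u)
    (trans (sum-single (λ t → monomial (f t) t u) u (λ { t ≡.refl → refl })
             (λ t ne → monomial-off (f t) t u (λ e → ne (≡.sym e)))) (monomial-on (f u) u)))

-- Reduction of ℚ(ζ₁₆) modulo p

-- `ι z` normalises z/1 through a gcd, which is stuck for a variable z. Supplying the coprimality
-- proof by hand gives the same number with a numerator and a denominator that compute.
ιᵏ : ℤ → ℚ
ιᵏ z = mkℚ z 0 (Coprimality.sym (Coprimality.1-coprimeTo ℤ.∣ z ∣))

ι≡ιᵏ : ∀ z → ι z ≡ ιᵏ z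
ι≡ιᵏ z = ℚP.↥p/↧p≡p (ιᵏ z)

ι-+ : ∀ a b → ι (a ℤ.+ b) ≡ ι a ℚ.+ ι b
ι-+ a b = ≡.sym (≡.trans (≡.cong₂ ℚ._+_ (ι≡ιᵏ a) (ι≡ιᵏ b))
  (≡.cong ι (≡.cong₂ ℤ._+_ (ℤP.*-identityʳ a) (ℤP.*-identityʳ b))))

ι-* : ∀ a b → ι (a ℤ.* b) ≡ ι a ℚ.* ι b
ι-* a b = ≡.sym (≡.cong₂ ℚ._*_ (ι≡ιᵏ a) (ι≡ιᵏ b))

ι-neg : ∀ a → ι (ℤ.- a) ≡ ℚ.- ι a
ι-neg (+ zero) = ≡.refl
ι-neg (+ suc n) = ≡.refl
ι-neg -[1+ n ] = ≡.trans (ι≡ιᵏ (+ suc n)) (≡.sym (≡.cong ℚ.-_ (ι≡ιᵏ -[1+ n ])))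

ι-injective : ∀ {a b} → ι a ≡ ι b → a ≡ b
ι-injective {a} {b} e = ≡.cong ↥_ (≡.trans (≡.sym (ι≡ιᵏ a)) (≡.trans e (ι≡ιᵏ b)))

-- A relation between rationals and residues mod m that behaves like a partial ring homomorphism.
record Reduction (m : ℕ) : Set₁ where
  field
    _↦_     : ℚ → ℤ → Set
    ↦-ι     : ∀ z → ι z ↦ z
    ↦-+     : ∀ {q r a b} → q ↦ a → r ↦ b → (q ℚ.+ r) ↦ (a ℤ.+ b)
    ↦-*     : ∀ {q r a b} → q ↦ a → r ↦ b → (q ℚ.* r) ↦ (a ℤ.* b)
    ↦-neg   : ∀ {q a} → q ↦ a → (ℚ.- q) ↦ (ℤ.- a)
    ↦-cong  : ∀ {q a b} → a ≡ₘ b [ m ] → q ↦ a → q ↦ b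

  ↦-- : ∀ {q r a b} → q ↦ a → r ↦ b → (q ℚ.- r) ↦ (a ℤ.- b)
  ↦-- x y = ↦-+ x (↦-neg y)

-- With m = 0 reduction is equality with an integer. It serves to compute the rational norms of π̄₁
-- and π̄₂ exactly, by evaluation in ℤ[ζ].
integral : Reduction 0
integral = record
  { _↦_ = λ q a → q ≡ ι a
  ; ↦-ι = λ z → ≡.refl
  ; ↦-+ = λ { {a = a} {b} ≡.refl ≡.refl → ≡.sym (ι-+ a b) }
  ; ↦-* = λ { {a = a} {b} ≡.refl ≡.refl → ≡.sym (ι-* a b) }
  ; ↦-neg = λ { {a = a} ≡.refl → ≡.sym (ι-neg a) }
  ; ↦-cong = λ { {a = a} {b} (mod d) ≡.refl → ≡.cong ι (ℤP.i-j≡0⇒i≡j a b (0∣⇒≡0 d)) } }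
  where
  0∣⇒≡0 : ∀ {a} → (+ 0) ℤD.∣ a → a ≡ + 0
  0∣⇒≡0 (ℤD.divides q e) = ≡.trans e (ℤP.*-zeroʳ q)

module Localisation (p : ℕ) (pp : Prime p) where
  open Integers-mod p
  open CommutativeRing ℤ/
  open ℤSolver.+-*-Solver using (solve; _:+_; _:*_; _:-_; :-_; _:=_; con)

  -- The denominator need not be the reduced one, only invertible modulo p; thus sums and products
  -- are formed without cancelling.
  record _↦_ (q : ℚ) (a : ℤ) : Set where
    constructor fraction
    field
      denominator numerator inverse : ℤ
      clears   : q ℚ.* ι denominator ≡ ι numerator
      inverts  : denominator * inverse ≈ + 1
      reduces  : numerator ≈ a * denominator

  private
    module ℚS = ℚSolver.+-*-Solver

    product-inverts : ∀ d d′ i i′ → d * i ≈ + 1 → d′ * i′ ≈ + 1 → (d * d′) * (i * i′) ≈ + 1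
    product-inverts d d′ i i′ e e′ =
      trans (reflexive (solve 4 (λ d d′ i i′ → (d :* d′) :* (i :* i′) := (d :* i) :* (d′ :* i′)) ≡.refl d d′ i i′))
            (*-cong {d * i} {+ 1} {d′ * i′} e e′)

  ↦-invert : ∀ d i q → q ℚ.* ι d ≡ 1ℚ → d * i ≈ + 1 → q ↦ i
  ↦-invert d i q e inv = fraction d (+ 1) i e inv (trans (sym inv) (*-comm d i))

  localisation : Reduction p
  localisation = record
    { _↦_ = _↦_
    ; ↦-ι = λ z → fraction (+ 1) z (+ 1) (ℚP.*-identityʳ (ι z)) refl (reflexive (≡.sym (ℤP.*-identityʳ z)))
    ; ↦-+ = λ { {q} {r} {a} {b} (fraction d s i c v w) (fraction d′ s′ i′ c′ v′ w′) →
        fraction (d * d′) (s * d′ + s′ * d) (i * i′)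
          (≡.trans (≡.cong ((q ℚ.+ r) ℚ.*_) (ι-* d d′)) (≡.trans
            (ℚS.solve 4 (λ q r d d′ → (q ℚS.:+ r) ℚS.:* (d ℚS.:* d′) ℚS.:= (q ℚS.:* d) ℚS.:* d′ ℚS.:+ (r ℚS.:* d′) ℚS.:* d)
              ≡.refl q r (ι d) (ι d′))
            (≡.trans (≡.cong₂ (λ x y → x ℚ.* ι d′ ℚ.+ y ℚ.* ι d) c c′)
              (≡.sym (≡.trans (ι-+ (s * d′) (s′ * d)) (≡.cong₂ ℚ._+_ (ι-* s d′) (ι-* s′ d)))))))
          (product-inverts d d′ i i′ v v′)
          (trans (+-cong {s * d′} {a * d * d′} (*-congʳ {d′} {s} w) (*-congʳ {d} {s′} w′))
            (reflexive (solve 4 (λ a b d d′ → a :* d :* d′ :+ b :* d′ :* d := (a :+ b) :* (d :* d′)) ≡.refl a b d d′))) }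
    ; ↦-* = λ { {q} {r} {a} {b} (fraction d s i c v w) (fraction d′ s′ i′ c′ v′ w′) →
        fraction (d * d′) (s * s′) (i * i′)
          (≡.trans (≡.cong ((q ℚ.* r) ℚ.*_) (ι-* d d′)) (≡.trans
            (ℚS.solve 4 (λ q r d d′ → (q ℚS.:* r) ℚS.:* (d ℚS.:* d′) ℚS.:= (q ℚS.:* d) ℚS.:* (r ℚS.:* d′))
              ≡.refl q r (ι d) (ι d′))
            (≡.trans (≡.cong₂ ℚ._*_ c c′) (≡.sym (ι-* s s′)))))
          (product-inverts d d′ i i′ v v′)
          (trans (*-cong {s} {a * d} w w′)
            (reflexive (solve 4 (λ a b d d′ → a :* d :* (b :* d′) := (a :* b) :* (d :* d′)) ≡.refl a b d d′))) }
    ; ↦-neg = λ { {q} {a} (fraction d s i c v w) →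
        fraction d (- s) i
          (≡.trans (≡.sym (ℚP.neg-distribˡ-* q (ι d))) (≡.trans (≡.cong ℚ.-_ c) (≡.sym (ι-neg s))))
          v (trans (-‿cong {s} w) (reflexive (ℤP.neg-distribˡ-* a d))) }
    ; ↦-cong = λ { {q} {a} {b} e (fraction d s i c v w) → fraction d s i c v (trans w (*-congʳ {d} {a} e)) } }

  private
    cross : ∀ q d s → q ℚ.* ι d ≡ ι s → ↥ q * d ≡ s * ↧ q
    cross q@(mkℚ _ n _) d s e = lemma (ℚP.toℚᵘ-homo-* q (ιᵏ d))
      where
      open import Data.Rational.Unnormalised as ℚᵘ using (*≡*)
      e′ : q ℚ.* ιᵏ d ≡ ιᵏ s
      e′ = ≡.trans (≡.cong (q ℚ.*_) (≡.sym (ι≡ιᵏ d))) (≡.trans e (ι≡ιᵏ s))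
      lemma : ℚ.toℚᵘ (q ℚ.* ιᵏ d) ℚᵘ.≃ ℚ.toℚᵘ q ℚᵘ.* ℚ.toℚᵘ (ιᵏ d) → ↥ q * d ≡ s * ↧ q
      lemma z with ≡.subst (λ y → ℚ.toℚᵘ y ℚᵘ.≃ ℚ.toℚᵘ q ℚᵘ.* ℚ.toℚᵘ (ιᵏ d)) e′ z
      ... | *≡* f = ≡.trans (≡.sym (ℤP.*-identityʳ _)) (≡.trans (≡.sym f)
                      (≡.cong (λ z → s * + z) (ℕP.*-identityʳ (suc n))))

  -- Cross multiplication gives ↥q · d = s · ↧q with s ≡ 0, and d is invertible modulo p.
  ↦0⇒∣ : ∀ {q a} → q ↦ a → a ≈ + 0 → (+ p) ℤD.∣ ↥ q
  ↦0⇒∣ {q} {a} (fraction d s i c v w) a≈0 = ≡ₘ0⁻¹ (begin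
    ↥ q                ≈⟨ sym (*-identityʳ (↥ q)) ⟩
    ↥ q * + 1          ≈⟨ *-congˡ {↥ q} (sym v) ⟩
    ↥ q * (d * i)      ≈⟨ sym (*-assoc (↥ q) d i) ⟩
    (↥ q * d) * i      ≡⟨ ≡.cong (_* i) (cross q d s c) ⟩
    (s * ↧ q) * i      ≈⟨ *-congʳ {i} {s * ↧ q} (*-congʳ {↧ q} {s} (trans w (*-congʳ {d} {a} a≈0))) ⟩
    (+ 0 * d * ↧ q) * i ≡⟨ solve 3 (λ d q i → (con (+ 0) :* d :* q) :* i := con (+ 0)) ≡.refl d (↧ q) i ⟩
    + 0                ∎)
    where open import Relation.Binary.Reasoning.Setoid setoid

  -- From p ∣ ↥q follows p ∣ s · ↧q. As q is in lowest terms, p cannot divide ↧q as well, so it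
  -- divides s.
  ∣⇒↦0 : ∀ {q a} → q ↦ a → (+ p) ℤD.∣ ↥ q → a ≈ + 0
  ∣⇒↦0 {q} {a} (fraction d s i c v w) p∣q = begin
    a                  ≈⟨ sym (*-identityʳ a) ⟩
    a * + 1            ≈⟨ *-congˡ {a} (sym v) ⟩
    a * (d * i)        ≈⟨ sym (*-assoc a d i) ⟩
    (a * d) * i        ≈⟨ *-congʳ {i} {a * d} (sym w) ⟩
    s * i              ≈⟨ *-congʳ {i} {s} (≡ₘ0 p∣s) ⟩
    + 0 * i            ≡⟨ ℤP.*-zeroˡ i ⟩
    + 0                ∎
    where
    open import Relation.Binary.Reasoning.Setoid setoid
    p∣s↧q : p ℕD.∣ ℤ.∣ s ∣ ℕ.* ℤ.∣ ↧ q ∣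
    p∣s↧q = ≡.subst (p ℕD.∣_) (ℤP.abs-* s (↧ q)) (ℤD.∣⇒∣ᵤ (≡.subst ((+ p) ℤD.∣_) (cross q d s c) (ℤD.∣m⇒∣m*n d p∣q)))
    coprime : ∀ q → Coprimality.Coprime ℤ.∣ ↥ q ∣ ℤ.∣ ↧ q ∣
    coprime (mkℚ _ _ c) = Coprimality.recompute c
    p∣s : (+ p) ℤD.∣ s
    p∣s with euclidsLemma ℤ.∣ s ∣ ℤ.∣ ↧ q ∣ pp p∣s↧q
    ... | inj₁ r = ℤD.∣ᵤ⇒∣ r
    ... | inj₂ r = contradiction (coprime q (ℤD.∣⇒∣ᵤ p∣q , r)) (λ p≡1 → ℕ.nonTrivial⇒≢1 {{prime⇒nonTrivial pp}} p≡1)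

into-force : (P : L → Set) (a : L) → P a → force a P
into-force P a = ≡.subst (λ A → A) (≡.sym (force-≡ a P))

out-of-force : (P : L → Set) (a : L) → force a P → P a
out-of-force P a = ≡.subst (λ A → A) (force-≡ a P)

-- Comparing two terms of type L = Fin 8 → ℚ makes the type checker evaluate their coefficients, which is
-- hopeless for α₁ and α₂.  Under `force` both sides are only unfolded to their outermost sum.
invL-unfold : (P : L → Set) → ∀ a →
              P (scale (recipℚ (normL a)) (σ 3 a ⊗ σ 5 a ⊗ σ 7 a ⊗ σ 9 a ⊗ σ 11 a ⊗ σ 13 a ⊗ σ 15 a)) → P (invL a)
invL-unfold P a x = out-of-force P (invL a)
  (into-force P (scale (recipℚ (normL a)) (σ 3 a ⊗ σ 5 a ⊗ σ 7 a ⊗ σ 9 a ⊗ σ 11 a ⊗ σ 13 a ⊗ σ 15 a)) x)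

module Representation {m : ℕ} (reduction : Reduction m) where
  open Reduction reduction
  open Cyclotomic m
  open CommutativeRing R
  open PowerLemmas R

  infix 4 _⇝_
  -- A relation and not a function on L, because a coefficient has a residue only if its denominator
  -- is invertible; the evidence is collected along the construction of the element.
  record _⇝_ (a : L) (s : Carrier) : Set where
    constructor coefficients
    field
      residues : Fin 8 → ℤ
      reduce   : ∀ i → a i ↦ residues i
      sum      : s ≈ toR residues
  open _⇝_ public

  ⇝-cong : ∀ {a s t} → s ≈ t → a ⇝ s → a ⇝ t
  ⇝-cong e (coefficients v r eq) = coefficients v r (trans (sym e) eq)

  Σᴿ : List Carrier → Carrier
  Σᴿ = foldr _+_ 0#

  Σᴿ-cong : ∀ {A : Set} (l : List A) {f g : A → Carrier} → (∀ x → f x ≈ g x) → Σᴿ (map f l) ≈ Σᴿ (map g l)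
  Σᴿ-cong [] e = refl
  Σᴿ-cong (x ∷ l) e = +-cong (e x) (Σᴿ-cong l e)

  Σᴿ-*ˡ : ∀ {A : Set} (l : List A) c (f : A → Carrier) → c * Σᴿ (map f l) ≈ Σᴿ (map (λ x → c * f x) l)
  Σᴿ-*ˡ [] c f = zeroʳ c
  Σᴿ-*ˡ (x ∷ l) c f = trans (distribˡ c _ _) (+-congˡ (Σᴿ-*ˡ l c f))

  Σᴿ-*ʳ : ∀ {A : Set} (l : List A) c (f : A → Carrier) → Σᴿ (map f l) * c ≈ Σᴿ (map (λ x → f x * c) l)
  Σᴿ-*ʳ l c f = trans (*-comm _ c) (trans (Σᴿ-*ˡ l c f) (Σᴿ-cong l (λ x → *-comm c (f x))))

  Σᴿ-hom : ∀ {A : Set} (φ : Hom R R) (l : List A) (f : A → Carrier) → Hom.⟦_⟧ φ (Σᴿ (map f l)) ≈ Σᴿ (map (λ x → Hom.⟦_⟧ φ (f x)) l)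
  Σᴿ-hom φ [] f = Hom.0-homo φ
  Σᴿ-hom φ (x ∷ l) f = trans (Hom.+-homo φ _ _) (+-congˡ (Σᴿ-hom φ l f))

  toR-sum : ∀ v → toR v ≈ Σᴿ (map (λ i → emb (v i) * ζ ^ toℕ i) (allFin 8))
  toR-sum = toR-expand

  toR-scale : ∀ z v → toR (λ i → z ℤ.* v i) ≈ emb z * toR v
  toR-scale z v = begin
    toR (λ i → z ℤ.* v i)                                ≈⟨ toR-sum (λ i → z ℤ.* v i) ⟩
    Σᴿ (map (λ i → emb (z ℤ.* v i) * ζ ^ toℕ i) I)
      ≈⟨ Σᴿ-cong I {λ i → emb (z ℤ.* v i) * ζ ^ toℕ i} {λ i → emb z * x i}
           (λ i → trans (*-congʳ {ζ ^ toℕ i} (emb-* z (v i))) (*-assoc (emb z) (emb (v i)) (ζ ^ toℕ i))) ⟩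
    Σᴿ (map (λ i → emb z * x i) I)                       ≈⟨ sym (Σᴿ-*ˡ I (emb z) x) ⟩
    emb z * Σᴿ (map x I)                                 ≈⟨ *-congˡ {emb z} (sym (toR-sum v)) ⟩
    emb z * toR v                                        ∎
    where
    open import Relation.Binary.Reasoning.Setoid setoid
    I = allFin 8
    x : Fin 8 → Carrier
    x i = emb (v i) * ζ ^ toℕ i

  ⇝-⊕ : ∀ a b {s t} → a ⇝ s → b ⇝ t → a ⊕ b ⇝ s + t
  ⇝-⊕ a b (coefficients v r e) (coefficients w q f) =
    coefficients (λ i → v i ℤ.+ w i) (λ i → ↦-+ (r i) (q i)) (trans (+-cong e f) (sym (toR-+ v w)))

  ⇝-scale : ∀ q {z} a {s} → q ↦ z → a ⇝ s → scale q a ⇝ emb z * s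
  ⇝-scale q {z} a x (coefficients v r e) = coefficients (λ i → z ℤ.* v i) (λ i → ↦-* x (r i)) (trans (*-congˡ e) (sym (toR-scale z v)))

  ⇝-zero : zeroL ⇝ 0#
  ⇝-zero = coefficients (λ _ → + 0) (λ _ → ↦-ι (+ 0)) refl

  private
    ↦-if : ∀ b {q r : ℚ} {x y} → q ↦ x → r ↦ y → (if b then q else r) ↦ (if b then x else y)
    ↦-if true  p _ = p
    ↦-if false _ p = p

  ⇝-ζpow : ∀ k → ζpow k ⇝ ζ ^ k
  ⇝-ζpow k = coefficients (ζ-coefficient r)
    (λ i → ↦-if (r ℕ.<ᵇ 8) (↦-if (toℕ i ℕ.≡ᵇ r) (↦-ι (+ 1)) (↦-ι (+ 0)))
                           (↦-if (toℕ i ℕ.≡ᵇ (r ℕ.∸ 8)) (↦-ι -[1+ 0 ]) (↦-ι (+ 0))))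
    (ζ-power k)
    where r = k ℕM.% 16

  ⇝-one : oneL ⇝ 1#
  ⇝-one = coefficients (ζ-coefficient 0) (λ i → ↦-if (toℕ i ℕ.≡ᵇ 0) (↦-ι (+ 1)) (↦-ι (+ 0))) (sym (toR-ζ-power 0F))

  ⇝-neg : ∀ a {s} → a ⇝ s → negL a ⇝ emb -[1+ 0 ] * s
  ⇝-neg a (coefficients v r e) = coefficients (λ i → -[1+ 0 ] ℤ.* v i)
    (λ i → ≡.subst (_ ↦_) (≡.sym (ℤP.-1*i≡-i (v i))) (↦-neg (r i))) (trans (*-congˡ e) (sym (toR-scale -[1+ 0 ] v)))

  ⇝-sum : ∀ {A : Set} (l : List A) {f : A → L} {g : A → Carrier} → (∀ x → f x ⇝ g x) → sumL (map f l) ⇝ Σᴿ (map g l)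
  ⇝-sum [] e = ⇝-zero
  ⇝-sum (x ∷ l) e = ⇝-⊕ _ _ (e x) (⇝-sum l e)

  -- `_⊗_` is by definition the double sum of coefficient products times powers of ζ, so both
  -- factors are expanded in powers of ζ and multiplied out.
  ⇝-⊗ : ∀ a b {s t} → a ⇝ s → b ⇝ t → a ⊗ b ⇝ s * t
  ⇝-⊗ a b {s} {t} (coefficients v r e) (coefficients w q f) = ⇝-cong (sym expand)
    (⇝-sum (allFin 8) (λ i → ⇝-sum (allFin 8) (λ j → ⇝-scale _ _ (↦-* (r i) (q j)) (⇝-ζpow (toℕ i ℕ.+ toℕ j)))))
    where
    open import Relation.Binary.Reasoning.Setoid setoid
    I = allFin 8
    x y : Fin 8 → Carrier
    x i = emb (v i) * ζ ^ toℕ i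
    y j = emb (w j) * ζ ^ toℕ j
    term : ∀ i j → x i * y j ≈ emb (v i ℤ.* w j) * ζ ^ (toℕ i ℕ.+ toℕ j)
    term i j = trans (interchange _ _ _ _) (*-cong (sym (emb-* (v i) (w j))) (sym (^-homo-* ζ (toℕ i) (toℕ j))))
      where open import Algebra.Properties.CommutativeSemigroup *-commutativeSemigroup using (interchange)
    expand : s * t ≈ Σᴿ (map (λ i → Σᴿ (map (λ j → emb (v i ℤ.* w j) * ζ ^ (toℕ i ℕ.+ toℕ j)) I)) I)
    expand = begin
      s * t                                        ≈⟨ *-cong (trans e (toR-sum v)) (trans f (toR-sum w)) ⟩
      Σᴿ (map x I) * Σᴿ (map y I)                  ≈⟨ Σᴿ-*ʳ I (Σᴿ (map y I)) x ⟩
      Σᴿ (map (λ i → x i * Σᴿ (map y I)) I)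
        ≈⟨ Σᴿ-cong I (λ i → trans (Σᴿ-*ˡ I (x i) y) (Σᴿ-cong I (term i))) ⟩
      Σᴿ (map (λ i → Σᴿ (map (λ j → emb (v i ℤ.* w j) * ζ ^ (toℕ i ℕ.+ toℕ j)) I)) I) ∎

  ⇝-σ : ∀ k c → c ≡ suc (2 ℕ.* toℕ k) → ∀ a {s} → a ⇝ s → σ c a ⇝ σᴿ k s
  ⇝-σ k c ≡.refl a {s} (coefficients v r e) = ⇝-cong (sym expand) (⇝-sum I (λ i → ⇝-scale _ _ (r i) (⇝-ζpow (c ℕ.* toℕ i))))
    where
    open import Relation.Binary.Reasoning.Setoid setoid
    open Hom (σ-hom k)
    I = allFin 8
    expand : ⟦ s ⟧ ≈ Σᴿ (map (λ i → emb (v i) * ζ ^ (c ℕ.* toℕ i)) I)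
    expand = begin
      ⟦ s ⟧                                               ≈⟨ ⟦⟧-cong (trans e (toR-sum v)) ⟩
      ⟦ Σᴿ (map (λ i → emb (v i) * ζ ^ toℕ i) I) ⟧         ≈⟨ Σᴿ-hom (σ-hom k) I (λ i → emb (v i) * ζ ^ toℕ i) ⟩
      Σᴿ (map (λ i → ⟦ emb (v i) * ζ ^ toℕ i ⟧) I)
        ≈⟨ Σᴿ-cong I (λ i → trans (*-homo _ _) (*-cong (σ-emb k (v i))
             (trans (^-homo ζ (toℕ i)) (trans (^-congˡ (toℕ i) (σ-ζ k)) (^-assocʳ ζ c (toℕ i)))))) ⟩
      Σᴿ (map (λ i → emb (v i) * ζ ^ (c ℕ.* toℕ i)) I) ∎

  ⇝-pow : ∀ a {s} → a ⇝ s → ∀ n → pow a n ⇝ s ^ n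
  ⇝-pow a x zero = ⇝-one
  ⇝-pow a x (suc n) = ⇝-⊗ a (pow a n) x (⇝-pow a x n)

  ⇝-const : ∀ a {s} → a ⇝ s → const a ↦ constant s
  ⇝-const a (coefficients v r e) = ↦-cong (F.sym (constant-cong e)) (r 0F)

  conjugates : Carrier → Carrier
  conjugates s = σᴿ 1F s * σᴿ 2F s * σᴿ 3F s * σᴿ 4F s * σᴿ 5F s * σᴿ 6F s * σᴿ 7F s

  norm : Carrier → Carrier
  norm s = s * σᴿ 1F s * σᴿ 2F s * σᴿ 3F s * σᴿ 4F s * σᴿ 5F s * σᴿ 6F s * σᴿ 7F s

  ⇝-normL : ∀ a {s} → a ⇝ s → normL a ↦ constant (norm s)
  ⇝-normL a x = ⇝-const (a ⊗ σ 3 a ⊗ σ 5 a ⊗ σ 7 a ⊗ σ 9 a ⊗ σ 11 a ⊗ σ 13 a ⊗ σ 15 a)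
    (⇝-⊗ (a ⊗ σ 3 a ⊗ σ 5 a ⊗ σ 7 a ⊗ σ 9 a ⊗ σ 11 a ⊗ σ 13 a) (σ 15 a)
    (⇝-⊗ (a ⊗ σ 3 a ⊗ σ 5 a ⊗ σ 7 a ⊗ σ 9 a ⊗ σ 11 a) (σ 13 a)
    (⇝-⊗ (a ⊗ σ 3 a ⊗ σ 5 a ⊗ σ 7 a ⊗ σ 9 a) (σ 11 a)
    (⇝-⊗ (a ⊗ σ 3 a ⊗ σ 5 a ⊗ σ 7 a) (σ 9 a)
    (⇝-⊗ (a ⊗ σ 3 a ⊗ σ 5 a) (σ 7 a)
    (⇝-⊗ (a ⊗ σ 3 a) (σ 5 a)
    (⇝-⊗ a (σ 3 a) x
      (⇝-σ 1F 3 ≡.refl a x)) (⇝-σ 2F 5 ≡.refl a x)) (⇝-σ 3F 7 ≡.refl a x)) (⇝-σ 4F 9 ≡.refl a x))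
      (⇝-σ 5F 11 ≡.refl a x)) (⇝-σ 6F 13 ≡.refl a x)) (⇝-σ 7F 15 ≡.refl a x))

  ⇝-conjugates : ∀ a {s} → a ⇝ s → (σ 3 a ⊗ σ 5 a ⊗ σ 7 a ⊗ σ 9 a ⊗ σ 11 a ⊗ σ 13 a ⊗ σ 15 a) ⇝ conjugates s
  ⇝-conjugates a x = 
    (⇝-⊗ (σ 3 a ⊗ σ 5 a ⊗ σ 7 a ⊗ σ 9 a ⊗ σ 11 a ⊗ σ 13 a) (σ 15 a)
    (⇝-⊗ (σ 3 a ⊗ σ 5 a ⊗ σ 7 a ⊗ σ 9 a ⊗ σ 11 a) (σ 13 a)
    (⇝-⊗ (σ 3 a ⊗ σ 5 a ⊗ σ 7 a ⊗ σ 9 a) (σ 11 a)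
    (⇝-⊗ (σ 3 a ⊗ σ 5 a ⊗ σ 7 a) (σ 9 a)
    (⇝-⊗ (σ 3 a ⊗ σ 5 a) (σ 7 a)
    (⇝-⊗ (σ 3 a) (σ 5 a)
      (⇝-σ 1F 3 ≡.refl a x) (⇝-σ 2F 5 ≡.refl a x)) (⇝-σ 3F 7 ≡.refl a x)) (⇝-σ 4F 9 ≡.refl a x))
      (⇝-σ 5F 11 ≡.refl a x)) (⇝-σ 6F 13 ≡.refl a x)) (⇝-σ 7F 15 ≡.refl a x))

  ⇝-invL : ∀ a {s z} → recipℚ (normL a) ↦ z → a ⇝ s → invL a ⇝ emb z * conjugates s
  ⇝-invL a {s} {z} y x = invL-unfold (λ b → b ⇝ emb z * conjugates s) a
    (⇝-scale (recipℚ (normL a)) (σ 3 a ⊗ σ 5 a ⊗ σ 7 a ⊗ σ 9 a ⊗ σ 11 a ⊗ σ 13 a ⊗ σ 15 a) y (⇝-conjugates a x))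

-- The elements π₁, π₂, α₁, α₂

α₁-unfold : (P : L → Set) → P ((π₁ ⊗ invL (conj π₁)) ⊗ pow (σ 3 (π₁ ⊗ invL (conj π₁))) 3) → P α₁
α₁-unfold P x = out-of-force P α₁ (into-force P ((π₁ ⊗ invL (conj π₁)) ⊗ pow (σ 3 (π₁ ⊗ invL (conj π₁))) 3) x)

α₂-unfold : (P : L → Set) →
  P (((π₂ ⊗ invL (conj π₂)) ⊗ pow (σ 11 (π₂ ⊗ invL (conj π₂))) 3) ⊗ pow (σ 13 (π₂ ⊗ invL (conj π₂))) 5 ⊗ pow (σ 7 (π₂ ⊗ invL (conj π₂))) 7) → P α₂
α₂-unfold P x = out-of-force P α₂ (into-force P
  (((π₂ ⊗ invL (conj π₂)) ⊗ pow (σ 11 (π₂ ⊗ invL (conj π₂))) 3) ⊗ pow (σ 13 (π₂ ⊗ invL (conj π₂))) 5 ⊗ pow (σ 7 (π₂ ⊗ invL (conj π₂))) 7) x)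

conj-unfold : (P : L → Set) → ∀ a → P (σ 15 a) → P (conj a)
conj-unfold P a x = out-of-force P (conj a) (into-force P (σ 15 a) x)

recipℚ-inverse : ∀ q → ¬ q ≡ 0ℚ → recipℚ q ℚ.* q ≡ 1ℚ
recipℚ-inverse q q≢0 with q ℚP.≟ 0ℚ
... | yes e = contradiction e q≢0
... | no ne = ℚP.*-inverseˡ q {{ℚ.≢-nonZero ne}}

module Pi {m : ℕ} (reduction : Reduction m) where
  open Representation reduction
  open Reduction reduction
  open Cyclotomic m
  open CommutativeRing R
  open PowerLemmas R

  π₁ᴿ π₂ᴿ : Carrier
  π₁ᴿ = 1# + emb (+ 2) * ζ ^ 6
  π₂ᴿ = 1# + emb -[1+ 0 ] * ζ ^ 1 + ζ ^ 5

  π₁⇝ : π₁ ⇝ π₁ᴿ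
  π₁⇝ = ⇝-⊕ oneL (scale (ι (+ 2)) (ζpow 6)) ⇝-one (⇝-scale (ι (+ 2)) (ζpow 6) (↦-ι (+ 2)) (⇝-ζpow 6))

  π₂⇝ : π₂ ⇝ π₂ᴿ
  π₂⇝ = ⇝-⊕ (oneL ⊕ negL (ζpow 1)) (ζpow 5) (⇝-⊕ oneL (negL (ζpow 1)) ⇝-one (⇝-neg (ζpow 1) (⇝-ζpow 1))) (⇝-ζpow 5)

  ⇝-conj : ∀ a {s} → a ⇝ s → conj a ⇝ σᴿ 7F s
  ⇝-conj a {s} x = conj-unfold (λ b → b ⇝ σᴿ 7F s) a (⇝-σ 7F 15 ≡.refl a x)

module _ where
  open Cyclotomic 0
  open Representation integral using (norm; ⇝-normL)
  open Pi integral

  private opaque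
    unfolding Quadratic._+₂_ σᴿ

    -- 289 = 17², because π₁ lies in L₁ and has norm 17 there.
    norm-π₁ : constant (norm (σᴿ 7F π₁ᴿ)) ≡ + 289
    norm-π₁ = ≡.refl

    norm-π₂ : constant (norm (σᴿ 7F π₂ᴿ)) ≡ + 17
    norm-π₂ = ≡.refl

  normL-conj-π₁ : normL (conj π₁) ≡ ι (+ 289)
  normL-conj-π₁ = ≡.trans (⇝-normL (conj π₁) (⇝-conj π₁ π₁⇝)) (≡.cong ι norm-π₁)

  normL-conj-π₂ : normL (conj π₂) ≡ ι (+ 17)
  normL-conj-π₂ = ≡.trans (⇝-normL (conj π₂) (⇝-conj π₂ π₂⇝)) (≡.cong ι norm-π₂)

-- Galois action and constants

identity-hom : ∀ R → Hom R R
identity-hom R = record { ⟦_⟧ = λ x → x ; ⟦⟧-cong = λ e → e ; +-homo = λ _ _ → refl ; *-homo = λ _ _ → refl ; 1-homo = refl }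
  where open CommutativeRing R

module GaloisAction (m : ℕ) where
  open Cyclotomic m
  open CommutativeRing R
  open PowerLemmas R
  open import Relation.Binary.Reasoning.Setoid setoid

  exponent : Fin 8 → ℕ
  exponent k = suc (2 ℕ.* toℕ k)

  σ-^ : ∀ k x n → σᴿ k (x ^ n) ≈ σᴿ k x ^ n
  σ-^ k = Hom.^-homo (σ-hom k)

  σσ-ζ : ∀ j k → σᴿ j (σᴿ k ζ) ≈ ζ ^ (exponent j ℕ.* exponent k)
  σσ-ζ j k = begin
    σᴿ j (σᴿ k ζ)                    ≈⟨ σ-cong j (σ-ζ k) ⟩
    σᴿ j (ζ ^ exponent k)            ≈⟨ σ-^ j ζ (exponent k) ⟩
    σᴿ j ζ ^ exponent k              ≈⟨ ^-congˡ (exponent k) (σ-ζ j) ⟩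
    (ζ ^ exponent j) ^ exponent k    ≈⟨ ^-assocʳ ζ (exponent j) (exponent k) ⟩
    ζ ^ (exponent j ℕ.* exponent k)  ∎

  σσ-emb : ∀ j k a → σᴿ j (σᴿ k (emb a)) ≈ emb a
  σσ-emb j k a = trans (σ-cong j (σ-emb k a)) (σ-emb j a)

  σ-comm : ∀ j k x → σᴿ j (σᴿ k x) ≈ σᴿ k (σᴿ j x)
  σ-comm j k = hom-ext (σ-hom j ∘ʰ σ-hom k) (σ-hom k ∘ʰ σ-hom j)
    (λ a → trans (σσ-emb j k a) (sym (σσ-emb k j a)))
    (trans (σσ-ζ j k) (trans (^-congʳ ζ (ℕP.*-comm (exponent j) (exponent k))) (sym (σσ-ζ k j))))

  -- An automorphism is determined by the image of ζ, so composing multiplies exponents modulo 16; t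
  -- counts the multiples of 16 that are removed.
  σ-∘ : ∀ j k l t → exponent j ℕ.* exponent k ≡ exponent l ℕ.+ t ℕ.* 16 → ∀ x → σᴿ j (σᴿ k x) ≈ σᴿ l x
  σ-∘ j k l t e = hom-ext (σ-hom j ∘ʰ σ-hom k) (σ-hom l)
    (λ a → trans (σσ-emb j k a) (sym (σ-emb l a)))
    (begin
      σᴿ j (σᴿ k ζ)                    ≈⟨ σσ-ζ j k ⟩
      ζ ^ (exponent j ℕ.* exponent k)  ≡⟨ ≡.cong (ζ ^_) e ⟩
      ζ ^ (exponent l ℕ.+ t ℕ.* 16)    ≈⟨ ^-periodic ζ 16 (exponent l) t ζ¹⁶ ⟩
      ζ ^ exponent l                   ≈⟨ sym (σ-ζ l) ⟩
      σᴿ l ζ                           ∎)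

  σ-identity : ∀ x → σᴿ 0F x ≈ x
  σ-identity = hom-ext (σ-hom 0F) (identity-hom R) (σ-emb 0F) (trans (σ-ζ 0F) (^-one ζ))

  conjᴿ : Carrier → Carrier
  conjᴿ = σᴿ 7F

  conjᴿ-involutive : ∀ x → conjᴿ (conjᴿ x) ≈ x
  conjᴿ-involutive x = trans (σ-∘ 7F 7F 0F 14 ≡.refl x) (σ-identity x)

  trace : Carrier → Carrier
  trace x = σᴿ 0F x + (σᴿ 1F x + (σᴿ 2F x + (σᴿ 3F x + (σᴿ 4F x + (σᴿ 5F x + (σᴿ 6F x + σᴿ 7F x))))))

  private
    rootSum : ℕ → Carrier
    rootSum i = r 0F + (r 1F + (r 2F + (r 3F + (r 4F + (r 5F + (r 6F + r 7F))))))
      where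
      r : Fin 8 → Carrier
      r k = toR (ζ-coefficient ((exponent k ℕ.* i) ℕ.% 16))

    trace-power : ∀ i → trace (ζ ^ i) ≈ rootSum i
    trace-power i = +-cong (p 0F) (+-cong (p 1F) (+-cong (p 2F) (+-cong (p 3F) (+-cong (p 4F) (+-cong (p 5F) (+-cong (p 6F) (p 7F)))))))
      where
      p : ∀ k → σᴿ k (ζ ^ i) ≈ toR (ζ-coefficient ((exponent k ℕ.* i) ℕ.% 16))
      p k = trans (σ-^ k ζ i) (trans (^-congˡ i (σ-ζ k)) (trans (^-assocʳ ζ (exponent k) i) (ζ-power (exponent k ℕ.* i))))

    opaque
      unfolding Quadratic._+₂_

      rootSum-0 : rootSum 0 ≈ emb (+ 8)
      rootSum-0 = refl

      rootSum-suc : (i : Fin 7) → rootSum (suc (toℕ i)) ≈ 0#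
      rootSum-suc 0F = refl
      rootSum-suc 1F = refl
      rootSum-suc 2F = refl
      rootSum-suc 3F = refl
      rootSum-suc 4F = refl
      rootSum-suc 5F = refl
      rootSum-suc 6F = refl

    trace-ζ⁰ : trace (ζ ^ 0) ≈ emb (+ 8)
    trace-ζ⁰ = trans (trace-power 0) rootSum-0

    trace-ζ : (i : Fin 7) → trace (ζ ^ suc (toℕ i)) ≈ 0#
    trace-ζ i = trans (trace-power (suc (toℕ i))) (rootSum-suc i)

  open import Algebra.Properties.CommutativeSemigroup +-commutativeSemigroup using () renaming (interchange to +-interchange)

  trace-cong : ∀ {x y} → x ≈ y → trace x ≈ trace y
  trace-cong e = +-cong (σ-cong 0F e) (+-cong (σ-cong 1F e) (+-cong (σ-cong 2F e) (+-cong (σ-cong 3F e)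
    (+-cong (σ-cong 4F e) (+-cong (σ-cong 5F e) (+-cong (σ-cong 6F e) (σ-cong 7F e)))))))

  trace-+ : ∀ x y → trace (x + y) ≈ trace x + trace y
  trace-+ x y = step 0F (step 1F (step 2F (step 3F (step 4F (step 5F (step 6F (σ-+ 7F x y)))))))
    where
    step : ∀ k {s t u} → s ≈ t + u → σᴿ k (x + y) + s ≈ (σᴿ k x + t) + (σᴿ k y + u)
    step k {s} {t} {u} e = trans (+-cong (σ-+ k x y) e) (+-interchange (σᴿ k x) (σᴿ k y) t u)

  trace-emb* : ∀ a x → trace (emb a * x) ≈ emb a * trace x
  trace-emb* a x = step 0F (step 1F (step 2F (step 3F (step 4F (step 5F (step 6F (linear 7F)))))))
    where
    linear : ∀ k → σᴿ k (emb a * x) ≈ emb a * σᴿ k x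
    linear k = trans (σ-* k (emb a) x) (*-congʳ (σ-emb k a))
    step : ∀ k {s t} → s ≈ emb a * t → σᴿ k (emb a * x) + s ≈ emb a * (σᴿ k x + t)
    step k {s} {t} e = trans (+-cong (linear k) e) (sym (distribˡ (emb a) (σᴿ k x) t))

  coordinates : Carrier → Fin 8 → ℤ
  coordinates (((a , e) , (c , g)) , ((b , f) , (d , h))) =
    λ { 0F → a ; 1F → b ; 2F → c ; 3F → d ; 4F → e ; 5F → f ; 6F → g ; 7F → h }

  toR-coordinates : ∀ x → x ≈ toR (coordinates x)
  toR-coordinates x = refl

  -- The trace is 8 on 1 and kills ζ, ..., ζ⁷.
  trace≈8constant : ∀ x → trace x ≈ emb (+ 8) * emb (constant x)
  trace≈8constant x = begin
    trace x                                ≈⟨ trace-cong (trans (toR-coordinates x) (toR-expand v)) ⟩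
    trace (emb (v 0F) * ζ ^ 0 + tail)      ≈⟨ trace-+ (emb (v 0F) * ζ ^ 0) tail ⟩
    trace (emb (v 0F) * ζ ^ 0) + trace tail ≈⟨ +-cong (trans (trace-emb* (v 0F) (ζ ^ 0)) (*-congˡ {emb (v 0F)} trace-ζ⁰)) trace-tail ⟩
    emb (v 0F) * emb (+ 8) + 0#            ≈⟨ trans (+-identityʳ (emb (v 0F) * emb (+ 8))) (*-comm (emb (v 0F)) (emb (+ 8))) ⟩
    emb (+ 8) * emb (constant x)           ∎
    where
    v : Fin 8 → ℤ
    v = coordinates x
    tail₆ = emb (v 7F) * ζ ^ 7 + 0#
    tail₅ = emb (v 6F) * ζ ^ 6 + tail₆
    tail₄ = emb (v 5F) * ζ ^ 5 + tail₅
    tail₃ = emb (v 4F) * ζ ^ 4 + tail₄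
    tail₂ = emb (v 3F) * ζ ^ 3 + tail₃
    tail₁ = emb (v 2F) * ζ ^ 2 + tail₂
    tail  = emb (v 1F) * ζ ^ 1 + tail₁
    trace-0 : trace 0# ≈ 0#
    trace-0 = trans (trace-cong (sym (zeroʳ (emb (+ 0))))) (trans (trace-emb* (+ 0) 0#) (zeroˡ (trace 0#)))
    vanish : (i : Fin 7) → ∀ a s → trace s ≈ 0# → trace (emb a * ζ ^ suc (toℕ i) + s) ≈ 0#
    vanish i a s e = trans (trace-+ (emb a * ζ ^ suc (toℕ i)) s)
      (trans (+-cong (trans (trace-emb* a (ζ ^ suc (toℕ i))) (trans (*-congˡ {emb a} (trace-ζ i)) (zeroʳ (emb a)))) e) (+-identityˡ 0#))
    trace-tail : trace tail ≈ 0#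
    trace-tail = vanish 0F (v 1F) tail₁ (vanish 1F (v 2F) tail₂ (vanish 2F (v 3F) tail₃ (vanish 3F (v 4F) tail₄
      (vanish 4F (v 5F) tail₅ (vanish 5F (v 6F) tail₆ (vanish 6F (v 7F) 0# trace-0))))))

  module Invariants (i₂ : ℤ) (inverts : (+ 2 ℤ.* i₂) F.≈ + 1) where
    private
      i₈ : ℤ
      i₈ = i₂ ℤ.* (i₂ ℤ.* i₂)
      inverts₈ : emb i₈ * emb (+ 8) ≈ 1#
      inverts₈ = trans (sym (emb-* i₈ (+ 8))) (emb-cong {i₈ ℤ.* + 8} (F.trans
        (F.reflexive (solve 1 (λ i → (i :* (i :* i)) :* con (+ 8) := (con (+ 2) :* i) :* ((con (+ 2) :* i) :* (con (+ 2) :* i))) ≡.refl i₂))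
        (F.*-cong {+ 2 ℤ.* i₂} {+ 1} inverts (F.*-cong {+ 2 ℤ.* i₂} {+ 1} inverts inverts))))
        where
        open ℤSolver.+-*-Solver

    -- σ₃ and conjugation generate the Galois group, so an element fixed by both satisfies 8x =
    -- trace x, which is 8 times the constant coefficient, and 8 is invertible.
    constant-if-invariant : ∀ x → σᴿ 1F x ≈ x → conjᴿ x ≈ x → x ≈ emb (constant x)
    constant-if-invariant x f₃ f₁₅ = begin
      x                                           ≈⟨ cancel x ⟩
      emb i₈ * (emb (+ 8) * x)                    ≈⟨ *-congˡ {emb i₈} (trans (sym 8x) (trace≈8constant x)) ⟩
      emb i₈ * (emb (+ 8) * emb (constant x))     ≈⟨ sym (cancel (emb (constant x))) ⟩
      emb (constant x)                            ∎
      where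
      cancel : ∀ y → y ≈ emb i₈ * (emb (+ 8) * y)
      cancel y = sym (trans (sym (*-assoc (emb i₈) (emb (+ 8)) y)) (trans (*-congʳ {y} inverts₈) (*-identityˡ y)))
      compose : ∀ j k l t → exponent j ℕ.* exponent k ≡ exponent l ℕ.+ t ℕ.* 16 → σᴿ j x ≈ x → σᴿ k x ≈ x → σᴿ l x ≈ x
      compose j k l t e fj fk = trans (sym (σ-∘ j k l t e x)) (trans (σ-cong j fk) fj)
      f₉ = compose 1F 1F 4F 0 ≡.refl f₃ f₃
      f₁₁ = compose 1F 4F 5F 1 ≡.refl f₃ f₉
      f₁₃ = compose 7F 1F 6F 2 ≡.refl f₁₅ f₃
      f₇ = compose 7F 4F 3F 8 ≡.refl f₁₅ f₉
      f₅ = compose 7F 5F 2F 10 ≡.refl f₁₅ f₁₁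
      sum8 : ∀ y → y + (y + (y + (y + (y + (y + (y + y)))))) ≈ emb (+ 8) * y
      sum8 y = begin
        y + (y + (y + (y + (y + (y + (y + y))))))  ≈⟨ step 7 (step 6 (step 5 (step 4 (step 3 (step 2 (step 1 (sym (*-identityˡ y)))))))) ⟩
        emb (+ 8) * y ∎
        where
        step : ∀ n {s} → s ≈ emb (+ n) * y → y + s ≈ emb (+ suc n) * y
        step n e = trans (+-cong (sym (*-identityˡ y)) e) (trans (sym (distribʳ y (emb (+ 1)) (emb (+ n)))) (*-congʳ {y} (sym (emb-+ (+ 1) (+ n)))))
      8x : trace x ≈ emb (+ 8) * x
      8x = trans (+-cong (σ-identity x) (+-cong f₃ (+-cong f₅ (+-cong f₇ (+-cong f₉ (+-cong f₁₁ (+-cong f₁₃ f₁₅))))))) (sum8 x)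

module Alpha (p : ℕ) (pp : Prime p) (i₁₇ : ℤ) (inverts₁₇ : (+ 17 ℤ.* i₁₇) ≡ₘ + 1 [ p ]) where
  open Localisation p pp
  open Representation localisation
  open Pi localisation
  open GaloisAction p
  open Cyclotomic p
  open CommutativeRing R
  open PowerLemmas R
  open import Algebra.Properties.CommutativeSemigroup *-commutativeSemigroup using (interchange)
  open import Relation.Binary.Reasoning.Setoid setoid

  private
    inverts₂₈₉ : (+ 289 ℤ.* (i₁₇ ℤ.* i₁₇)) F.≈ + 1
    inverts₂₈₉ = F.trans (F.reflexive (solve 1 (λ i → con (+ 289) :* (i :* i) := (con (+ 17) :* i) :* (con (+ 17) :* i)) ≡.refl i₁₇))
      (F.*-cong {+ 17 ℤ.* i₁₇} {+ 1} inverts₁₇ inverts₁₇)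
      where
      open ℤSolver.+-*-Solver

    recip-↦ : ∀ q n i → q ≡ ι (+ suc n) → (+ suc n ℤ.* i) F.≈ + 1 → recipℚ q ↦ i
    recip-↦ q n i ≡.refl inv = ↦-invert (+ suc n) i (recipℚ q) (recipℚ-inverse q nonzero) inv
      where
      nonzero : ¬ ι (+ suc n) ≡ 0ℚ
      nonzero e with ι-injective {+ suc n} {+ 0} e
      ... | ()

    opaque
      unfolding Quadratic._+₂_ σᴿ

      norm-conj-π₁ : conjᴿ π₁ᴿ * conjugates (conjᴿ π₁ᴿ) ≈ emb (+ 289)
      norm-conj-π₁ = refl

      norm-conj-π₂ : conjᴿ π₂ᴿ * conjugates (conjᴿ π₂ᴿ) ≈ emb (+ 17)
      norm-conj-π₂ = refl

      σ₉-π₁ : σᴿ 4F π₁ᴿ ≈ π₁ᴿ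
      σ₉-π₁ = refl

  -- `ι₁`, `ι₂` are the inverses of π̄₁, π̄₂, formed from the other conjugates and the norms 17² and
  -- 17, so that ρ = π/π̄. `A₁`, `A₂` are the reductions of α₁, α₂, and `N₁`, `N₂` their numerators,
  -- with A = N/N̄.
  ι₁ ι₂ ρ₁ ρ₂ A₁ A₂ N₁ N₂ : Carrier
  ι₁ = emb (i₁₇ ℤ.* i₁₇) * conjugates (conjᴿ π₁ᴿ)
  ι₂ = emb i₁₇ * conjugates (conjᴿ π₂ᴿ)
  ρ₁ = π₁ᴿ * ι₁
  ρ₂ = π₂ᴿ * ι₂
  A₁ = ρ₁ * σᴿ 1F ρ₁ ^ 3
  A₂ = ρ₂ * σᴿ 5F ρ₂ ^ 3 * σᴿ 6F ρ₂ ^ 5 * σᴿ 3F ρ₂ ^ 7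
  N₁ = π₁ᴿ * σᴿ 1F π₁ᴿ ^ 3
  N₂ = π₂ᴿ * σᴿ 5F π₂ᴿ ^ 3 * σᴿ 6F π₂ᴿ ^ 5 * σᴿ 3F π₂ᴿ ^ 7

  ρ₁⇝ : (π₁ ⊗ invL (conj π₁)) ⇝ ρ₁
  ρ₁⇝ = ⇝-⊗ π₁ (invL (conj π₁)) π₁⇝
    (⇝-invL (conj π₁) (recip-↦ (normL (conj π₁)) 288 (i₁₇ ℤ.* i₁₇) normL-conj-π₁ inverts₂₈₉) (⇝-conj π₁ π₁⇝))

  ρ₂⇝ : (π₂ ⊗ invL (conj π₂)) ⇝ ρ₂
  ρ₂⇝ = ⇝-⊗ π₂ (invL (conj π₂)) π₂⇝
    (⇝-invL (conj π₂) (recip-↦ (normL (conj π₂)) 16 i₁₇ normL-conj-π₂ inverts₁₇) (⇝-conj π₂ π₂⇝))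

  ⇝-σ-pow : ∀ k c → c ≡ suc (2 ℕ.* toℕ k) → ∀ n a {s} → a ⇝ s → pow (σ c a) n ⇝ σᴿ k s ^ n
  ⇝-σ-pow k c e n a x = ⇝-pow (σ c a) (⇝-σ k c e a x) n

  α₁⇝ : α₁ ⇝ A₁
  α₁⇝ = α₁-unfold (λ a → a ⇝ A₁) (⇝-⊗ (π₁ ⊗ invL (conj π₁)) (pow (σ 3 (π₁ ⊗ invL (conj π₁))) 3) ρ₁⇝
    (⇝-σ-pow 1F 3 ≡.refl 3 (π₁ ⊗ invL (conj π₁)) ρ₁⇝))

  α₂⇝ : α₂ ⇝ A₂
  α₂⇝ = α₂-unfold (λ a → a ⇝ A₂)
    (⇝-⊗ ((π₂ ⊗ invL (conj π₂)) ⊗ pow (σ 11 (π₂ ⊗ invL (conj π₂))) 3 ⊗ pow (σ 13 (π₂ ⊗ invL (conj π₂))) 5) (pow (σ 7 (π₂ ⊗ invL (conj π₂))) 7)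
    (⇝-⊗ ((π₂ ⊗ invL (conj π₂)) ⊗ pow (σ 11 (π₂ ⊗ invL (conj π₂))) 3) (pow (σ 13 (π₂ ⊗ invL (conj π₂))) 5)
    (⇝-⊗ (π₂ ⊗ invL (conj π₂)) (pow (σ 11 (π₂ ⊗ invL (conj π₂))) 3) ρ₂⇝
      (⇝-σ-pow 5F 11 ≡.refl 3 (π₂ ⊗ invL (conj π₂)) ρ₂⇝))
      (⇝-σ-pow 6F 13 ≡.refl 5 (π₂ ⊗ invL (conj π₂)) ρ₂⇝))
      (⇝-σ-pow 3F 7 ≡.refl 7 (π₂ ⊗ invL (conj π₂)) ρ₂⇝))

  NormOne : Carrier → Set
  NormOne x = x * conjᴿ x ≈ 1#

  normOne-* : ∀ {x y} → NormOne x → NormOne y → NormOne (x * y)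
  normOne-* {x} {y} e f = trans (*-congˡ (σ-* 7F x y)) (trans (interchange x y (conjᴿ x) (conjᴿ y)) (trans (*-cong e f) (*-identityˡ 1#)))

  normOne-^ : ∀ {x} → NormOne x → ∀ n → NormOne (x ^ n)
  normOne-^ e zero = trans (*-identityˡ _) (σ-1 7F)
  normOne-^ e (suc n) = normOne-* e (normOne-^ e n)

  normOne-σ : ∀ {x} k → NormOne x → NormOne (σᴿ k x)
  normOne-σ {x} k e = trans (*-congˡ (σ-comm 7F k x)) (trans (sym (σ-* k x (conjᴿ x))) (trans (σ-cong k e) (σ-1 k)))

  -- x = n / n̄, without division
  _isFractionOf_ : Carrier → Carrier → Set
  x isFractionOf n = x * conjᴿ n ≈ n

  fraction-* : ∀ {x y n m} → x isFractionOf n → y isFractionOf m → (x * y) isFractionOf (n * m)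
  fraction-* {x} {y} {n} {m} e f = trans (*-congˡ (σ-* 7F n m)) (trans (interchange x y (conjᴿ n) (conjᴿ m)) (*-cong e f))

  fraction-^ : ∀ {x n} → x isFractionOf n → ∀ k → (x ^ k) isFractionOf (n ^ k)
  fraction-^ e zero = trans (*-identityˡ _) (σ-1 7F)
  fraction-^ e (suc k) = fraction-* e (fraction-^ e k)

  fraction-σ : ∀ {x n} k → x isFractionOf n → σᴿ k x isFractionOf σᴿ k n
  fraction-σ {x} {n} k e = trans (*-congˡ (σ-comm 7F k n)) (trans (sym (σ-* k x (conjᴿ n))) (σ-cong k e))

  private
    inverse : ∀ π c d → conjᴿ π * c ≈ emb d → ∀ i → (d ℤ.* i) F.≈ + 1 → conjᴿ π * (emb i * c) ≈ 1#
    inverse π c d e i inv = begin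
      conjᴿ π * (emb i * c)   ≈⟨ *-congˡ (*-comm (emb i) c) ⟩
      conjᴿ π * (c * emb i)   ≈⟨ sym (*-assoc _ _ _) ⟩
      (conjᴿ π * c) * emb i   ≈⟨ *-congʳ e ⟩
      emb d * emb i           ≈⟨ sym (emb-* d i) ⟩
      emb (d ℤ.* i)           ≈⟨ emb-cong {d ℤ.* i} {+ 1} inv ⟩
      1#                      ∎

    ratio-fraction : ∀ π i → conjᴿ π * i ≈ 1# → (π * i) isFractionOf π
    ratio-fraction π i e = begin
      (π * i) * conjᴿ π     ≈⟨ *-assoc π i (conjᴿ π) ⟩
      π * (i * conjᴿ π)     ≈⟨ *-congˡ (trans (*-comm i (conjᴿ π)) e) ⟩
      π * 1#                ≈⟨ *-identityʳ π ⟩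
      π                     ∎

    ratio-normOne : ∀ π i → conjᴿ π * i ≈ 1# → NormOne (π * i)
    ratio-normOne π i e = begin
      (π * i) * conjᴿ (π * i)          ≈⟨ *-congˡ (σ-* 7F π i) ⟩
      (π * i) * (conjᴿ π * conjᴿ i)    ≈⟨ sym (*-assoc _ _ _) ⟩
      ((π * i) * conjᴿ π) * conjᴿ i    ≈⟨ *-congʳ (ratio-fraction π i e) ⟩
      π * conjᴿ i                      ≈⟨ *-congʳ (sym (conjᴿ-involutive π)) ⟩
      conjᴿ (conjᴿ π) * conjᴿ i        ≈⟨ sym (σ-* 7F (conjᴿ π) i) ⟩
      conjᴿ (conjᴿ π * i)              ≈⟨ σ-cong 7F e ⟩
      conjᴿ 1#                         ≈⟨ σ-1 7F ⟩
      1#                               ∎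

    inverse₁ : conjᴿ π₁ᴿ * ι₁ ≈ 1#
    inverse₁ = inverse π₁ᴿ (conjugates (conjᴿ π₁ᴿ)) (+ 289) norm-conj-π₁ (i₁₇ ℤ.* i₁₇) inverts₂₈₉

    inverse₂ : conjᴿ π₂ᴿ * ι₂ ≈ 1#
    inverse₂ = inverse π₂ᴿ (conjugates (conjᴿ π₂ᴿ)) (+ 17) norm-conj-π₂ i₁₇ inverts₁₇

    normOne-ρ₁ : NormOne ρ₁
    normOne-ρ₁ = ratio-normOne π₁ᴿ ι₁ inverse₁
    normOne-ρ₂ : NormOne ρ₂
    normOne-ρ₂ = ratio-normOne π₂ᴿ ι₂ inverse₂
    fraction-ρ₁ : ρ₁ isFractionOf π₁ᴿ
    fraction-ρ₁ = ratio-fraction π₁ᴿ ι₁ inverse₁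
    fraction-ρ₂ : ρ₂ isFractionOf π₂ᴿ
    fraction-ρ₂ = ratio-fraction π₂ᴿ ι₂ inverse₂

  normOne-A₁ : NormOne A₁
  normOne-A₁ = normOne-* normOne-ρ₁ (normOne-^ (normOne-σ 1F normOne-ρ₁) 3)

  normOne-A₂ : NormOne A₂
  normOne-A₂ = normOne-* (normOne-* (normOne-* normOne-ρ₂ (normOne-^ (normOne-σ 5F normOne-ρ₂) 3))
    (normOne-^ (normOne-σ 6F normOne-ρ₂) 5)) (normOne-^ (normOne-σ 3F normOne-ρ₂) 7)

  fraction-A₁ : A₁ isFractionOf N₁
  fraction-A₁ = fraction-* fraction-ρ₁ (fraction-^ (fraction-σ 1F fraction-ρ₁) 3)

  fraction-A₂ : A₂ isFractionOf N₂
  fraction-A₂ = fraction-* (fraction-* (fraction-* fraction-ρ₂ (fraction-^ (fraction-σ 5F fraction-ρ₂) 3))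
    (fraction-^ (fraction-σ 6F fraction-ρ₂) 5)) (fraction-^ (fraction-σ 3F fraction-ρ₂) 7)

  Unit : Carrier → Set
  Unit x = ∃ λ y → x * y ≈ 1#

  unit-* : ∀ {x y} → Unit x → Unit y → Unit (x * y)
  unit-* {x} {y} (x′ , e) (y′ , f) = x′ * y′ , trans (interchange x y x′ y′) (trans (*-cong e f) (*-identityˡ 1#))

  unit-^ : ∀ {x} → Unit x → ∀ n → Unit (x ^ n)
  unit-^ u zero = 1# , *-identityˡ 1#
  unit-^ u (suc n) = unit-* u (unit-^ u n)

  unit-σ : ∀ {x} k → Unit x → Unit (σᴿ k x)
  unit-σ {x} k (y , e) = σᴿ k y , trans (sym (σ-* k x y)) (trans (σ-cong k e) (σ-1 k))

  private
    unit-π₁ : Unit π₁ᴿ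
    unit-π₁ = conjᴿ ι₁ , trans (*-congʳ (sym (conjᴿ-involutive π₁ᴿ))) (trans (sym (σ-* 7F (conjᴿ π₁ᴿ) ι₁)) (trans (σ-cong 7F inverse₁) (σ-1 7F)))
    unit-π₂ : Unit π₂ᴿ
    unit-π₂ = conjᴿ ι₂ , trans (*-congʳ (sym (conjᴿ-involutive π₂ᴿ))) (trans (sym (σ-* 7F (conjᴿ π₂ᴿ) ι₂)) (trans (σ-cong 7F inverse₂) (σ-1 7F)))

  unit-conj-N₁ : Unit (conjᴿ N₁)
  unit-conj-N₁ = unit-σ 7F (unit-* unit-π₁ (unit-^ (unit-σ 1F unit-π₁) 3))

  unit-conj-N₂ : Unit (conjᴿ N₂)
  unit-conj-N₂ = unit-σ 7F (unit-* (unit-* (unit-* unit-π₂ (unit-^ (unit-σ 5F unit-π₂) 3))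
    (unit-^ (unit-σ 6F unit-π₂) 5)) (unit-^ (unit-σ 3F unit-π₂) 7))

  unit-cancelʳ : ∀ {x y z} → Unit z → x * z ≈ y * z → x ≈ y
  unit-cancelʳ {x} {y} {z} (w , e) f = trans (expand x) (trans (*-congʳ f) (sym (expand y)))
    where
    expand : ∀ t → t ≈ (t * z) * w
    expand t = sym (trans (*-assoc t z w) (trans (*-congˡ e) (*-identityʳ t)))

  -- σ₉ fixes π₁, which lies in L₁, and hence N₁; and A₁ is determined by A₁ · N̄₁ = N₁ because N̄₁
  -- is a unit.
  σ₉-fixed : σᴿ 4F A₁ ≈ A₁
  σ₉-fixed = unit-cancelʳ unit-conj-N₁ (trans (*-congˡ (sym conj-N)) (trans (fraction-σ 4F fraction-A₁) (trans σ₉-N (sym fraction-A₁))))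
    where
    σ₉-N : σᴿ 4F N₁ ≈ N₁
    σ₉-N = trans (σ-* 4F _ _) (*-cong σ₉-π₁ (trans (σ-^ 4F _ 3) (^-congˡ 3 (trans (σ-comm 4F 1F π₁ᴿ) (σ-cong 1F σ₉-π₁)))))
    conj-N : conjᴿ (σᴿ 4F N₁) ≈ conjᴿ N₁
    conj-N = σ-cong 7F σ₉-N

-- The recursions for T, N, X, Y, Z, W

-- The ring solver takes its coefficients in ℤ and maps them along φ, so numerals and subtraction
-- are normalised as integers.
module IntegerPolynomials {m : ℕ} {S : CommutativeRing 0ℓ 0ℓ} (φ : Hom (Integers-mod.ℤ/ m) S) where
  open CommutativeRing S
  open Hom φ public using () renaming (⟦_⟧ to #)
  private
    module Φ = Hom φ

    morphism : CommutativeRing.rawRing ℤP.+-*-commutativeRing -Raw-AlmostCommutative⟶ fromCommutativeRing S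
    morphism = record { ⟦_⟧ = # ; +-homo = Φ.+-homo ; *-homo = Φ.*-homo ; -‿homo = Φ.-‿homo ; 0-homo = Φ.0-homo ; 1-homo = Φ.1-homo }

    equal? : ∀ a b → Maybe (# a ≈ # b)
    equal? a b with a ℤP.≟ b
    ... | yes ≡.refl = just refl
    ... | no _ = nothing

  open import Algebra.Solver.Ring (CommutativeRing.rawRing ℤP.+-*-commutativeRing) (fromCommutativeRing S) morphism equal?
    using (solve; _:=_; _:+_; _:*_; _:-_; :-_; con; Polynomial)

  private
    e₁ᵖ e₂ᵖ e₃ᵖ e₄ᵖ : ∀ {n} (a b c d : Polynomial n) → Polynomial n
    e₁ᵖ a b c d = ((a :+ b) :+ c) :+ d
    e₂ᵖ a b c d = ((((a :* b) :+ (a :* c)) :+ (a :* d)) :+ (b :* c)) :+ ((b :* d) :+ (c :* d))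
    e₃ᵖ a b c d = (((a :* b) :* c) :+ ((a :* b) :* d)) :+ (((a :* c) :* d) :+ ((b :* c) :* d))
    e₄ᵖ a b c d = ((a :* b) :* c) :* d
    dbl : ∀ {n} → Polynomial n → Polynomial n
    dbl a = a :* a :- con (+ 2)

  e₁ e₂ e₃ e₄ : (a b c d : Carrier) → Carrier
  e₁ a b c d = ((a + b) + c) + d
  e₂ a b c d = ((((a * b) + (a * c)) + (a * d)) + (b * c)) + ((b * d) + (c * d))
  e₃ a b c d = (((a * b) * c) + ((a * b) * d)) + (((a * c) * d) + ((b * c) * d))
  e₄ a b c d = ((a * b) * c) * d

  -- The map x + x⁻¹ ↦ x² + x⁻². The recursions for T, N and for X, Y, Z, W are its effect on the
  -- elementary symmetric functions of two and of four conjugates.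
  double : Carrier → Carrier
  double a = a * a - # (+ 2)

  double-reciprocal : ∀ x y → x * y ≈ 1# → x * x + y * y ≈ double (x + y)
  double-reciprocal x y e = trans
    (solve 2 (λ x y → x :* x :+ y :* y := (x :+ y) :* (x :+ y) :- con (+ 2) :* (x :* y)) refl x y)
    (+-congˡ (-‿cong (trans (*-congˡ e) (*-identityʳ _))))

  trace-double : ∀ a b → double a + double b ≈ (a + b) * (a + b) - # (+ 2) * (a * b) - # (+ 4)
  trace-double = solve 2 (λ a b → dbl a :+ dbl b := (a :+ b) :* (a :+ b) :- con (+ 2) :* (a :* b) :- con (+ 4)) refl

  norm-double : ∀ a b → double a * double b ≈
    (a * b) * (a * b) - # (+ 2) * ((a + b) * (a + b)) + # (+ 4) * (a * b) + # (+ 4)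
  norm-double = solve 2 (λ a b → dbl a :* dbl b :=
    (a :* b) :* (a :* b) :- con (+ 2) :* ((a :+ b) :* (a :+ b)) :+ con (+ 4) :* (a :* b) :+ con (+ 4)) refl

  e₁-double : ∀ a b c d → e₁ (double a) (double b) (double c) (double d) ≈
    e₁ a b c d * e₁ a b c d - # (+ 2) * e₂ a b c d - # (+ 8)
  e₁-double = solve 4 (λ a b c d → e₁ᵖ (dbl a) (dbl b) (dbl c) (dbl d) :=
    e₁ᵖ a b c d :* e₁ᵖ a b c d :- con (+ 2) :* e₂ᵖ a b c d :- con (+ 8)) refl

  e₂-double : ∀ a b c d → (let X = e₁ a b c d; Y = e₂ a b c d; Z = e₃ a b c d; W = e₄ a b c d) →
    e₂ (double a) (double b) (double c) (double d) ≈
    Y * Y - # (+ 2) * (X * Z) + # (+ 2) * W - # (+ 6) * (X * X) + # (+ 12) * Y + # (+ 24)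
  e₂-double = solve 4 (λ a b c d → let X = e₁ᵖ a b c d; Y = e₂ᵖ a b c d; Z = e₃ᵖ a b c d; W = e₄ᵖ a b c d in
    e₂ᵖ (dbl a) (dbl b) (dbl c) (dbl d) :=
    Y :* Y :- con (+ 2) :* (X :* Z) :+ con (+ 2) :* W :- con (+ 6) :* (X :* X) :+ con (+ 12) :* Y :+ con (+ 24)) refl

  e₃-double : ∀ a b c d → (let X = e₁ a b c d; Y = e₂ a b c d; Z = e₃ a b c d; W = e₄ a b c d) →
    e₃ (double a) (double b) (double c) (double d) ≈
    Z * Z - # (+ 2) * (W * Y) - # (+ 4) * (Y * Y) + # (+ 8) * (X * Z) - # (+ 8) * W + # (+ 12) * (X * X) - # (+ 24) * Y - # (+ 32)
  e₃-double = solve 4 (λ a b c d → let X = e₁ᵖ a b c d; Y = e₂ᵖ a b c d; Z = e₃ᵖ a b c d; W = e₄ᵖ a b c d in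
    e₃ᵖ (dbl a) (dbl b) (dbl c) (dbl d) :=
    Z :* Z :- con (+ 2) :* (W :* Y) :- con (+ 4) :* (Y :* Y) :+ con (+ 8) :* (X :* Z) :- con (+ 8) :* W
      :+ con (+ 12) :* (X :* X) :- con (+ 24) :* Y :- con (+ 32)) refl

  e₄-double : ∀ a b c d → (let X = e₁ a b c d; Y = e₂ a b c d; Z = e₃ a b c d; W = e₄ a b c d) →
    e₄ (double a) (double b) (double c) (double d) ≈
    W * W - # (+ 2) * (Z * Z) + # (+ 4) * (W * Y) + # (+ 4) * (Y * Y) - # (+ 8) * (X * Z) + # (+ 8) * W - # (+ 8) * (X * X) + # (+ 16) * Y + # (+ 16)
  e₄-double = solve 4 (λ a b c d → let X = e₁ᵖ a b c d; Y = e₂ᵖ a b c d; Z = e₃ᵖ a b c d; W = e₄ᵖ a b c d in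
    e₄ᵖ (dbl a) (dbl b) (dbl c) (dbl d) :=
    W :* W :- con (+ 2) :* (Z :* Z) :+ con (+ 4) :* (W :* Y) :+ con (+ 4) :* (Y :* Y) :- con (+ 8) :* (X :* Z) :+ con (+ 8) :* W
      :- con (+ 8) :* (X :* X) :+ con (+ 16) :* Y :+ con (+ 16)) refl

  -- b, d, a, c is the order into which σ₃ moves the conjugates under 1, σ₃, σ₅, σ₇ of a real
  -- element: there σ₃σ₃ = σ₉ acts as σ₇, σ₃σ₅ = σ₁₅ as 1, and σ₃σ₇ = σ₅.
  e₁-cycle : ∀ a b c d → e₁ b d a c ≈ e₁ a b c d
  e₁-cycle = solve 4 (λ a b c d → e₁ᵖ b d a c := e₁ᵖ a b c d) refl
  e₂-cycle : ∀ a b c d → e₂ b d a c ≈ e₂ a b c d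
  e₂-cycle = solve 4 (λ a b c d → e₂ᵖ b d a c := e₂ᵖ a b c d) refl
  e₃-cycle : ∀ a b c d → e₃ b d a c ≈ e₃ a b c d
  e₃-cycle = solve 4 (λ a b c d → e₃ᵖ b d a c := e₃ᵖ a b c d) refl
  e₄-cycle : ∀ a b c d → e₄ b d a c ≈ e₄ a b c d
  e₄-cycle = solve 4 (λ a b c d → e₄ᵖ b d a c := e₄ᵖ a b c d) refl

  quadratic-root : ∀ a b → a * a ≈ (a + b) * a - a * b
  quadratic-root = solve 2 (λ a b → a :* a := (a :+ b) :* a :- a :* b) refl

  quartic-root : ∀ a b c d → (a * a) * (a * a) ≈
    e₁ a b c d * (a * (a * a)) - e₂ a b c d * (a * a) + e₃ a b c d * a - e₄ a b c d
  quartic-root = solve 4 (λ a b c d → (a :* a) :* (a :* a) :=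
    e₁ᵖ a b c d :* (a :* (a :* a)) :- e₂ᵖ a b c d :* (a :* a) :+ e₃ᵖ a b c d :* a :- e₄ᵖ a b c d) refl

  -- T = -4 and N = 4 are the coefficients belonging to (X + 2)²; the bracket is the value that
  -- `quadratic-root` then gives to a².
  square-+2 : ∀ a → (a + # (+ 2)) * (a + # (+ 2)) ≈ a * a - (# -[1+ 3 ] * a - # (+ 4))
  square-+2 = solve 1 (λ a → (a :+ con (+ 2)) :* (a :+ con (+ 2)) := a :* a :- (con -[1+ 3 ] :* a :- con (+ 4))) refl

  -- -8, 24, -32, 16 are the elementary symmetric functions of -2 taken four times.
  fourth-+2 : ∀ a → ((a + # (+ 2)) * (a + # (+ 2))) * ((a + # (+ 2)) * (a + # (+ 2))) ≈
    (a * a) * (a * a) - (# -[1+ 7 ] * (a * (a * a)) - # (+ 24) * (a * a) + # -[1+ 31 ] * a - # (+ 16))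
  fourth-+2 = solve 1 (λ a → ((a :+ con (+ 2)) :* (a :+ con (+ 2))) :* ((a :+ con (+ 2)) :* (a :+ con (+ 2))) :=
    (a :* a) :* (a :* a) :- (con -[1+ 7 ] :* (a :* (a :* a)) :- con (+ 24) :* (a :* a) :+ con -[1+ 31 ] :* a :- con (+ 16))) refl

  -- In a reduced ring this makes x = -1 as soon as x + x⁻¹ = -2.
  reciprocal-square-+1 : ∀ x y → x * y ≈ 1# → (x + 1#) * (x + 1#) ≈ x * ((x + y) + # (+ 2))
  reciprocal-square-+1 x y e = trans (trans (*-cong (+-congˡ (sym Φ.1-homo)) (+-congˡ (sym Φ.1-homo)))
    (solve 2 (λ x y → (x :+ con (+ 1)) :* (x :+ con (+ 1)) := x :* ((x :+ y) :+ con (+ 2)) :+ (con (+ 1) :- x :* y)) refl x y))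
    (trans (+-congˡ (trans (+-cong Φ.1-homo (-‿cong e)) (-‿inverseʳ 1#))) (+-identityʳ _))

  -- Hence x + x⁻¹ = 0 gives x² = -1.
  reciprocal-square : ∀ x y → x * y ≈ 1# → x * x ≈ x * (x + y) + # -[1+ 0 ]
  reciprocal-square x y e = trans (solve 2 (λ x y → x :* x := x :* (x :+ y) :- x :* y) refl x y)
    (+-congˡ (trans (-‿cong (trans e (sym Φ.1-homo))) (sym (Φ.-‿homo (+ 1)))))

opaque
  -- For a variable `a` the projections of `e4` unfold without arithmetic. At `η h` values are
  -- transported along these equations, in order not to compare coefficients of α₂.
  e4-z : ∀ a → Q4.z (e4 a) ≡ const ((((a ⊗ σ 3 a) ⊗ σ 5 a) ⊕ ((a ⊗ σ 3 a) ⊗ σ 7 a)) ⊕ (((a ⊗ σ 5 a) ⊗ σ 7 a) ⊕ ((σ 3 a ⊗ σ 5 a) ⊗ σ 7 a)))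
  e4-z a = ≡.refl

  e4-w : ∀ a → Q4.w (e4 a) ≡ const (((a ⊗ σ 3 a) ⊗ σ 5 a) ⊗ σ 7 a)
  e4-w a = ≡.refl

e4-x : ∀ a → Q4.x (e4 a) ≡ const (((a ⊕ σ 3 a) ⊕ σ 5 a) ⊕ σ 7 a)
e4-x a = ≡.refl

e4-y : ∀ a → Q4.y (e4 a) ≡ const (((((a ⊗ σ 3 a) ⊕ (a ⊗ σ 5 a)) ⊕ (a ⊗ σ 7 a)) ⊕ (σ 3 a ⊗ σ 5 a)) ⊕ ((σ 3 a ⊗ σ 7 a) ⊕ (σ 5 a ⊗ σ 7 a)))
e4-y a = ≡.refl

X-suc : ∀ h k → X h (suc k) ≡ X h k ℚ.* X h k ℚ.- ι (+ 2) ℚ.* Y h k ℚ.- ι (+ 8)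
X-suc h k = ≡.refl

Y-suc : ∀ h k → Y h (suc k) ≡ Y h k ℚ.* Y h k ℚ.- ι (+ 2) ℚ.* (X h k ℚ.* Z h k) ℚ.+ ι (+ 2) ℚ.* W h k ℚ.- ι (+ 6) ℚ.* (X h k ℚ.* X h k)
  ℚ.+ ι (+ 12) ℚ.* Y h k ℚ.+ ι (+ 24)
Y-suc h k = ≡.refl

Z-suc : ∀ h k → Z h (suc k) ≡ Z h k ℚ.* Z h k ℚ.- ι (+ 2) ℚ.* (W h k ℚ.* Y h k) ℚ.- ι (+ 4) ℚ.* (Y h k ℚ.* Y h k) ℚ.+ ι (+ 8) ℚ.* (X h k ℚ.* Z h k)
  ℚ.- ι (+ 8) ℚ.* W h k ℚ.+ ι (+ 12) ℚ.* (X h k ℚ.* X h k) ℚ.- ι (+ 24) ℚ.* Y h k ℚ.- ι (+ 32)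
Z-suc h k = ≡.refl

W-suc : ∀ h k → W h (suc k) ≡ W h k ℚ.* W h k ℚ.- ι (+ 2) ℚ.* (Z h k ℚ.* Z h k) ℚ.+ ι (+ 4) ℚ.* (W h k ℚ.* Y h k) ℚ.+ ι (+ 4) ℚ.* (Y h k ℚ.* Y h k)
  ℚ.- ι (+ 8) ℚ.* (X h k ℚ.* Z h k) ℚ.+ ι (+ 8) ℚ.* W h k ℚ.- ι (+ 8) ℚ.* (X h k ℚ.* X h k) ℚ.+ ι (+ 16) ℚ.* Y h k ℚ.+ ι (+ 16)
W-suc h k = ≡.refl

module Sequences (p : ℕ) (pp : Prime p) (i₁₇ : ℤ) (inverts₁₇ : (+ 17 ℤ.* i₁₇) ≡ₘ + 1 [ p ])
                 (i₂ : ℤ) (inverts₂ : (+ 2 ℤ.* i₂) ≡ₘ + 1 [ p ]) where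
  open Localisation p pp using (localisation)
  open Reduction localisation
  open Representation localisation
  open Pi localisation
  open GaloisAction p
  open Cyclotomic p
  open CommutativeRing R
  open PowerLemmas R
  open Alpha p pp i₁₇ inverts₁₇
  open Invariants i₂ inverts₂
  open IntegerPolynomials embedding hiding (#)

  module Orbit (A : Carrier) (normOne : NormOne A) (h : ℕ) where
    β β̄ : Carrier
    β = A ^ h
    β̄ = conjᴿ A ^ h

    -- `T h k` and `N h k`, respectively `X h k` to `W h k`, will be the elementary symmetric
    -- functions of the conjugates of `orbit k`.
    orbit : ℕ → Carrier
    orbit k = β ^ (2 ℕ.^ k) + β̄ ^ (2 ℕ.^ k)

    ββ̄ : ∀ n → β ^ n * β̄ ^ n ≈ 1#
    ββ̄ n = trans (sym (^-distrib-* β β̄ n)) (trans (^-congˡ n (trans (sym (^-distrib-* A (conjᴿ A) h)) (trans (^-congˡ h normOne) (1^ h)))) (1^ n))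

    orbit-suc : ∀ k → orbit (suc k) ≈ double (orbit k)
    orbit-suc k = trans (+-cong (square β) (square β̄)) (double-reciprocal (β ^ (2 ℕ.^ k)) (β̄ ^ (2 ℕ.^ k)) (ββ̄ (2 ℕ.^ k)))
      where
      square : ∀ x → x ^ (2 ℕ.* 2 ℕ.^ k) ≈ x ^ (2 ℕ.^ k) * x ^ (2 ℕ.^ k)
      square x = trans (^-congʳ x (≡.cong (2 ℕ.^ k ℕ.+_) (ℕP.+-identityʳ (2 ℕ.^ k)))) (^-homo-* x (2 ℕ.^ k) (2 ℕ.^ k))

    orbit₀ : β + β̄ ≈ orbit 0
    orbit₀ = +-cong (sym (^-one β)) (sym (^-one β̄))

    conj-orbit₀ : conjᴿ (β + β̄) ≈ β + β̄
    conj-orbit₀ = trans (σ-+ 7F β β̄) (trans (+-cong (σ-^ 7F A h) (trans (σ-^ 7F (conjᴿ A) h) (^-congˡ h (conjᴿ-involutive A)))) (+-comm β̄ β))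

    ⇝-orbit₀ : ∀ a → a ⇝ A → (pow a h ⊕ pow (conj a) h) ⇝ (β + β̄)
    ⇝-orbit₀ a x = ⇝-⊕ (pow a h) (pow (conj a) h) (⇝-pow a x h) (⇝-pow (conj a) (⇝-conj a x) h)

    double-σ : ∀ k x → σᴿ k (double x) ≈ double (σᴿ k x)
    double-σ k x = trans (σ-+ k _ _) (+-cong (σ-* k x x) (trans (Hom.-‿homo (σ-hom k) _) (-‿cong (σ-emb k (+ 2)))))

    orbit-σ-suc : ∀ j k → σᴿ j (orbit (suc k)) ≈ double (σᴿ j (orbit k))
    orbit-σ-suc j k = trans (σ-cong j (orbit-suc k)) (double-σ j (orbit k))

  emb-- : ∀ a b → emb (a ℤ.- b) ≈ emb a - emb b
  emb-- a b = trans (emb-+ a (ℤ.- b)) (+-congˡ (emb-neg b))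

  -- Ties a rational number to an element of R lying in ℤ/p, so that a recursion over ℚ can be
  -- followed inside R, where the conjugates live.
  record Value (q : ℚ) (x : Carrier) : Set where
    constructor value
    field
      residue : ℤ
      reduces : q ↦ residue
      embeds  : emb residue ≈ x
  open Value public

  value-+ : ∀ {q r x y} → Value q x → Value r y → Value (q ℚ.+ r) (x + y)
  value-+ (value a r e) (value b s f) = value (a ℤ.+ b) (↦-+ r s) (trans (emb-+ a b) (+-cong e f))

  value-* : ∀ {q r x y} → Value q x → Value r y → Value (q ℚ.* r) (x * y)
  value-* (value a r e) (value b s f) = value (a ℤ.* b) (↦-* r s) (trans (emb-* a b) (*-cong e f))

  value-- : ∀ {q r x y} → Value q x → Value r y → Value (q ℚ.- r) (x - y)
  value-- (value a r e) (value b s f) = value (a ℤ.- b) (↦-- r s) (trans (emb-- a b) (+-cong e (-‿cong f)))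

  value-ι : ∀ z → Value (ι z) (emb z)
  value-ι z = value z (↦-ι z) refl

  value-cong : ∀ {q x y} → x ≈ y → Value q x → Value q y
  value-cong e (value a r f) = value a r (trans f e)

  -- `const` keeps one coefficient out of eight; invariance under σ₃ and conjugation ensures that
  -- nothing is lost.
  value-const : ∀ a {s} → a ⇝ s → σᴿ 1F s ≈ s → conjᴿ s ≈ s → Value (const a) s
  value-const a {s} x f₃ f₁₅ = value (constant s) (⇝-const a x) (sym (constant-if-invariant s f₃ f₁₅))

  module TN-values (h : ℕ) where
    open Orbit A₁ normOne-A₁ h renaming (orbit to θᴿ)

    private
      θ₀ = β + β̄
      θ₀′ = σᴿ 1F θ₀

      θ⇝ : θ h ⇝ θ₀
      θ⇝ = ⇝-orbit₀ α₁ α₁⇝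

      σ₃θ⇝ : σ 3 (θ h) ⇝ θ₀′
      σ₃θ⇝ = ⇝-σ 1F 3 ≡.refl (θ h) θ⇝

      -- σ₃² = σ₉ is trivial on L₁, which contains α₁.
      σ₃-θ₀′ : σᴿ 1F θ₀′ ≈ θ₀
      σ₃-θ₀′ = trans (σ-∘ 1F 1F 4F 0 ≡.refl θ₀) (trans (σ-+ 4F β β̄) (+-cong
        (trans (σ-^ 4F A₁ h) (^-congˡ h σ₉-fixed))
        (trans (σ-^ 4F (conjᴿ A₁) h) (^-congˡ h (trans (σ-comm 4F 7F A₁) (σ-cong 7F σ₉-fixed))))))

      conj-θ₀′ : conjᴿ θ₀′ ≈ θ₀′
      conj-θ₀′ = trans (σ-comm 7F 1F θ₀) (σ-cong 1F conj-orbit₀)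

      T₀-value : Value (T₀ h) (θ₀ + θ₀′)
      T₀-value = value-const (θ h ⊕ σ 3 (θ h)) (⇝-⊕ (θ h) (σ 3 (θ h)) θ⇝ σ₃θ⇝)
        (trans (σ-+ 1F θ₀ θ₀′) (trans (+-congˡ σ₃-θ₀′) (+-comm θ₀′ θ₀)))
        (trans (σ-+ 7F θ₀ θ₀′) (+-cong conj-orbit₀ conj-θ₀′))

      N₀-value : Value (N₀ h) (θ₀ * θ₀′)
      N₀-value = value-const (θ h ⊗ σ 3 (θ h)) (⇝-⊗ (θ h) (σ 3 (θ h)) θ⇝ σ₃θ⇝)
        (trans (σ-* 1F θ₀ θ₀′) (trans (*-congˡ σ₃-θ₀′) (*-comm θ₀′ θ₀)))
        (trans (σ-* 7F θ₀ θ₀′) (*-cong conj-orbit₀ conj-θ₀′))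

    TN-value : ∀ k → Value (T h k) (θᴿ k + σᴿ 1F (θᴿ k)) ∧ Value (N h k) (θᴿ k * σᴿ 1F (θᴿ k))
    TN-value zero = value-cong (+-cong orbit₀ (σ-cong 1F orbit₀)) T₀-value , value-cong (*-cong orbit₀ (σ-cong 1F orbit₀)) N₀-value
    TN-value (suc k) =
      value-cong (trans (sym (trace-double a b)) (sym (+-cong (orbit-suc k) (orbit-σ-suc 1F k))))
        (value-- (value-- (value-* t t) (value-* (value-ι (+ 2)) n)) (value-ι (+ 4))) ,
      value-cong (trans (sym (norm-double a b)) (sym (*-cong (orbit-suc k) (orbit-σ-suc 1F k))))
        (value-+ (value-+ (value-- (value-* n n) (value-* (value-ι (+ 2)) (value-* t t))) (value-* (value-ι (+ 4)) n)) (value-ι (+ 4)))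
      where
      t = proj₁ (TN-value k)
      n = proj₂ (TN-value k)
      a = θᴿ k
      b = σᴿ 1F (θᴿ k)

  module XYZW-values (h : ℕ) where
    open Orbit A₂ normOne-A₂ h renaming (orbit to ηᴿ)

    private
      a₀ = β + β̄
      b₀ = σᴿ 1F a₀
      c₀ = σᴿ 2F a₀
      d₀ = σᴿ 3F a₀

      a⇝ : η h ⇝ a₀
      a⇝ = ⇝-orbit₀ α₂ α₂⇝
      b⇝ : σ 3 (η h) ⇝ b₀
      b⇝ = ⇝-σ 1F 3 ≡.refl (η h) a⇝
      c⇝ : σ 5 (η h) ⇝ c₀
      c⇝ = ⇝-σ 2F 5 ≡.refl (η h) a⇝
      d⇝ : σ 7 (η h) ⇝ d₀
      d⇝ = ⇝-σ 3F 7 ≡.refl (η h) a⇝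

      conj-σ : ∀ k → conjᴿ (σᴿ k a₀) ≈ σᴿ k a₀
      conj-σ k = trans (σ-comm 7F k a₀) (σ-cong k conj-orbit₀)

      σ₃b : σᴿ 1F b₀ ≈ d₀
      σ₃b = trans (σ-∘ 1F 1F 4F 0 ≡.refl a₀) (trans (sym (σ-∘ 3F 7F 4F 6 ≡.refl a₀)) (σ-cong 3F conj-orbit₀))
      σ₃c : σᴿ 1F c₀ ≈ a₀
      σ₃c = trans (σ-∘ 1F 2F 7F 0 ≡.refl a₀) conj-orbit₀
      σ₃d : σᴿ 1F d₀ ≈ c₀
      σ₃d = σ-∘ 1F 3F 2F 1 ≡.refl a₀

      -- σ₃ permutes the four conjugates cyclically and conjugation fixes each of them, so
      -- invariance of `e` under this one cycle makes its value rational.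
      symmetric : ∀ (e : (a b c d : Carrier) → Carrier) →
        (∀ {a a′ b b′ c c′ d d′} → a ≈ a′ → b ≈ b′ → c ≈ c′ → d ≈ d′ → e a b c d ≈ e a′ b′ c′ d′) →
        (∀ k a b c d → σᴿ k (e a b c d) ≈ e (σᴿ k a) (σᴿ k b) (σᴿ k c) (σᴿ k d)) →
        (∀ a b c d → e b d a c ≈ e a b c d) → ∀ x → x ⇝ e a₀ b₀ c₀ d₀ → Value (const x) (e a₀ b₀ c₀ d₀)
      symmetric e e-cong e-σ e-cycle x x⇝ = value-const x x⇝
        (trans (e-σ 1F a₀ b₀ c₀ d₀) (trans (e-cong refl σ₃b σ₃c σ₃d) (e-cycle a₀ b₀ c₀ d₀)))
        (trans (e-σ 7F a₀ b₀ c₀ d₀) (e-cong conj-orbit₀ (conj-σ 1F) (conj-σ 2F) (conj-σ 3F)))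

      e₁-cong : ∀ {a a′ b b′ c c′ d d′} → a ≈ a′ → b ≈ b′ → c ≈ c′ → d ≈ d′ → e₁ a b c d ≈ e₁ a′ b′ c′ d′
      e₁-cong a b c d = +-cong (+-cong (+-cong a b) c) d
      e₂-cong : ∀ {a a′ b b′ c c′ d d′} → a ≈ a′ → b ≈ b′ → c ≈ c′ → d ≈ d′ → e₂ a b c d ≈ e₂ a′ b′ c′ d′
      e₂-cong a b c d = +-cong (+-cong (+-cong (+-cong (*-cong a b) (*-cong a c)) (*-cong a d)) (*-cong b c)) (+-cong (*-cong b d) (*-cong c d))
      e₃-cong : ∀ {a a′ b b′ c c′ d d′} → a ≈ a′ → b ≈ b′ → c ≈ c′ → d ≈ d′ → e₃ a b c d ≈ e₃ a′ b′ c′ d′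
      e₃-cong a b c d = +-cong (+-cong (*-cong (*-cong a b) c) (*-cong (*-cong a b) d)) (+-cong (*-cong (*-cong a c) d) (*-cong (*-cong b c) d))
      e₄-cong : ∀ {a a′ b b′ c c′ d d′} → a ≈ a′ → b ≈ b′ → c ≈ c′ → d ≈ d′ → e₄ a b c d ≈ e₄ a′ b′ c′ d′
      e₄-cong a b c d = *-cong (*-cong (*-cong a b) c) d

      e₁-σ : ∀ k a b c d → σᴿ k (e₁ a b c d) ≈ e₁ (σᴿ k a) (σᴿ k b) (σᴿ k c) (σᴿ k d)
      e₁-σ k a b c d = trans (σ-+ k _ d) (+-congʳ (trans (σ-+ k _ c) (+-congʳ (σ-+ k a b))))
      e₂-σ : ∀ k a b c d → σᴿ k (e₂ a b c d) ≈ e₂ (σᴿ k a) (σᴿ k b) (σᴿ k c) (σᴿ k d)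
      e₂-σ k a b c d = trans (σ-+ k _ _) (+-cong
        (trans (σ-+ k _ _) (+-cong (trans (σ-+ k _ _) (+-cong (trans (σ-+ k _ _) (+-cong (σ-* k a b) (σ-* k a c))) (σ-* k a d))) (σ-* k b c)))
        (trans (σ-+ k _ _) (+-cong (σ-* k b d) (σ-* k c d))))
      σ-*³ : ∀ k a b c → σᴿ k ((a * b) * c) ≈ (σᴿ k a * σᴿ k b) * σᴿ k c
      σ-*³ k a b c = trans (σ-* k _ c) (*-congʳ (σ-* k a b))
      e₃-σ : ∀ k a b c d → σᴿ k (e₃ a b c d) ≈ e₃ (σᴿ k a) (σᴿ k b) (σᴿ k c) (σᴿ k d)
      e₃-σ k a b c d = trans (σ-+ k _ _) (+-cong (trans (σ-+ k _ _) (+-cong (σ-*³ k a b c) (σ-*³ k a b d)))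
        (trans (σ-+ k _ _) (+-cong (σ-*³ k a c d) (σ-*³ k b c d))))
      e₄-σ : ∀ k a b c d → σᴿ k (e₄ a b c d) ≈ e₄ (σᴿ k a) (σᴿ k b) (σᴿ k c) (σᴿ k d)
      e₄-σ k a b c d = trans (σ-* k _ d) (*-congʳ (σ-*³ k a b c))

      X₀⇝ : (((η h ⊕ σ 3 (η h)) ⊕ σ 5 (η h)) ⊕ σ 7 (η h)) ⇝ e₁ a₀ b₀ c₀ d₀
      X₀⇝ = ⇝-⊕ ((η h ⊕ σ 3 (η h)) ⊕ σ 5 (η h)) (σ 7 (η h)) (⇝-⊕ (η h ⊕ σ 3 (η h)) (σ 5 (η h)) (⇝-⊕ (η h) (σ 3 (η h)) a⇝ b⇝) c⇝) d⇝

      X₀-const : Value (const (((η h ⊕ σ 3 (η h)) ⊕ σ 5 (η h)) ⊕ σ 7 (η h))) (e₁ a₀ b₀ c₀ d₀)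
      X₀-const = symmetric e₁ e₁-cong e₁-σ e₁-cycle (((η h ⊕ σ 3 (η h)) ⊕ σ 5 (η h)) ⊕ σ 7 (η h)) X₀⇝

      X₀-value′ : Value (Q4.x (e4 (η h))) (e₁ a₀ b₀ c₀ d₀)
      X₀-value′ = ≡.subst (λ q → Value q (e₁ a₀ b₀ c₀ d₀)) (≡.sym (e4-x (η h))) X₀-const

      X₀-value : Value (X h 0) (e₁ a₀ b₀ c₀ d₀)
      X₀-value = X₀-value′

    XYZW-Value : ℕ → Set
    XYZW-Value k = let a = ηᴿ k; b = σᴿ 1F (ηᴿ k); c = σᴿ 2F (ηᴿ k); d = σᴿ 3F (ηᴿ k) in
      Value (X h k) (e₁ a b c d) ∧ Value (Y h k) (e₂ a b c d) ∧ Value (Z h k) (e₃ a b c d) ∧ Value (W h k) (e₄ a b c d)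

    private
      Y₀-value : Value (Y h 0) (e₂ a₀ b₀ c₀ d₀)
      Y₀-value = ≡.subst (λ q → Value q (e₂ a₀ b₀ c₀ d₀)) (≡.sym (e4-y (η h)))
        (symmetric e₂ e₂-cong e₂-σ e₂-cycle
          (((((η h ⊗ σ 3 (η h)) ⊕ (η h ⊗ σ 5 (η h))) ⊕ (η h ⊗ σ 7 (η h))) ⊕ (σ 3 (η h) ⊗ σ 5 (η h))) ⊕ ((σ 3 (η h) ⊗ σ 7 (η h)) ⊕ (σ 5 (η h) ⊗ σ 7 (η h))))
          (⇝-⊕ ((((η h ⊗ σ 3 (η h)) ⊕ (η h ⊗ σ 5 (η h))) ⊕ (η h ⊗ σ 7 (η h))) ⊕ (σ 3 (η h) ⊗ σ 5 (η h))) ((σ 3 (η h) ⊗ σ 7 (η h)) ⊕ (σ 5 (η h) ⊗ σ 7 (η h)))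
            (⇝-⊕ (((η h ⊗ σ 3 (η h)) ⊕ (η h ⊗ σ 5 (η h))) ⊕ (η h ⊗ σ 7 (η h))) (σ 3 (η h) ⊗ σ 5 (η h))
              (⇝-⊕ ((η h ⊗ σ 3 (η h)) ⊕ (η h ⊗ σ 5 (η h))) (η h ⊗ σ 7 (η h))
                (⇝-⊕ (η h ⊗ σ 3 (η h)) (η h ⊗ σ 5 (η h)) (⇝-⊗ (η h) (σ 3 (η h)) a⇝ b⇝) (⇝-⊗ (η h) (σ 5 (η h)) a⇝ c⇝))
                (⇝-⊗ (η h) (σ 7 (η h)) a⇝ d⇝))
              (⇝-⊗ (σ 3 (η h)) (σ 5 (η h)) b⇝ c⇝))
            (⇝-⊕ (σ 3 (η h) ⊗ σ 7 (η h)) (σ 5 (η h) ⊗ σ 7 (η h)) (⇝-⊗ (σ 3 (η h)) (σ 7 (η h)) b⇝ d⇝) (⇝-⊗ (σ 5 (η h)) (σ 7 (η h)) c⇝ d⇝))))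

      triple : ∀ x y z {s t u} → x ⇝ s → y ⇝ t → z ⇝ u → ((x ⊗ y) ⊗ z) ⇝ ((s * t) * u)
      triple x y z xs yt zu = ⇝-⊗ (x ⊗ y) z (⇝-⊗ x y xs yt) zu

      Z₀-value : Value (Z h 0) (e₃ a₀ b₀ c₀ d₀)
      Z₀-value = ≡.subst (λ q → Value q (e₃ a₀ b₀ c₀ d₀)) (≡.sym (e4-z (η h)))
        (symmetric e₃ e₃-cong e₃-σ e₃-cycle
          ((((η h ⊗ σ 3 (η h)) ⊗ σ 5 (η h)) ⊕ ((η h ⊗ σ 3 (η h)) ⊗ σ 7 (η h))) ⊕ (((η h ⊗ σ 5 (η h)) ⊗ σ 7 (η h)) ⊕ ((σ 3 (η h) ⊗ σ 5 (η h)) ⊗ σ 7 (η h))))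
          (⇝-⊕ (((η h ⊗ σ 3 (η h)) ⊗ σ 5 (η h)) ⊕ ((η h ⊗ σ 3 (η h)) ⊗ σ 7 (η h))) (((η h ⊗ σ 5 (η h)) ⊗ σ 7 (η h)) ⊕ ((σ 3 (η h) ⊗ σ 5 (η h)) ⊗ σ 7 (η h)))
            (⇝-⊕ ((η h ⊗ σ 3 (η h)) ⊗ σ 5 (η h)) ((η h ⊗ σ 3 (η h)) ⊗ σ 7 (η h))
              (triple (η h) (σ 3 (η h)) (σ 5 (η h)) a⇝ b⇝ c⇝) (triple (η h) (σ 3 (η h)) (σ 7 (η h)) a⇝ b⇝ d⇝))
            (⇝-⊕ ((η h ⊗ σ 5 (η h)) ⊗ σ 7 (η h)) ((σ 3 (η h) ⊗ σ 5 (η h)) ⊗ σ 7 (η h))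
              (triple (η h) (σ 5 (η h)) (σ 7 (η h)) a⇝ c⇝ d⇝) (triple (σ 3 (η h)) (σ 5 (η h)) (σ 7 (η h)) b⇝ c⇝ d⇝))))

      W₀-value : Value (W h 0) (e₄ a₀ b₀ c₀ d₀)
      W₀-value = ≡.subst (λ q → Value q (e₄ a₀ b₀ c₀ d₀)) (≡.sym (e4-w (η h)))
        (symmetric e₄ e₄-cong e₄-σ e₄-cycle (((η h ⊗ σ 3 (η h)) ⊗ σ 5 (η h)) ⊗ σ 7 (η h))
          (⇝-⊗ ((η h ⊗ σ 3 (η h)) ⊗ σ 5 (η h)) (σ 7 (η h)) (triple (η h) (σ 3 (η h)) (σ 5 (η h)) a⇝ b⇝ c⇝) d⇝))

    private
      base : XYZW-Value 0
      base = value-cong (e₁-cong orbit₀ (σ-cong 1F orbit₀) (σ-cong 2F orbit₀) (σ-cong 3F orbit₀)) X₀-value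
           , value-cong (e₂-cong orbit₀ (σ-cong 1F orbit₀) (σ-cong 2F orbit₀) (σ-cong 3F orbit₀)) Y₀-value
           , value-cong (e₃-cong orbit₀ (σ-cong 1F orbit₀) (σ-cong 2F orbit₀) (σ-cong 3F orbit₀)) Z₀-value
           , value-cong (e₄-cong orbit₀ (σ-cong 1F orbit₀) (σ-cong 2F orbit₀) (σ-cong 3F orbit₀)) W₀-value

      via : ∀ {q r x y} → q ≡ r → y ≈ x → Value r y → Value q x
      via ≡.refl e v = value-cong e v

      step : ∀ k → XYZW-Value k → XYZW-Value (suc k)
      step k (x , y , z , w) =
        via (X-suc h k) (trans (sym (e₁-double a b c d)) (sym (e₁-cong a′ b′ c′ d′)))
          (value-- (value-- (value-* x x) (value-* (value-ι (+ 2)) y)) (value-ι (+ 8))) ,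
        via (Y-suc h k) (trans (sym (e₂-double a b c d)) (sym (e₂-cong a′ b′ c′ d′)))
          (value-+ (value-+ (value-- (value-+ (value-- (value-* y y) (value-* (value-ι (+ 2)) (value-* x z))) (value-* (value-ι (+ 2)) w))
            (value-* (value-ι (+ 6)) (value-* x x))) (value-* (value-ι (+ 12)) y)) (value-ι (+ 24))) ,
        via (Z-suc h k) (trans (sym (e₃-double a b c d)) (sym (e₃-cong a′ b′ c′ d′)))
          (value-- (value-- (value-+ (value-- (value-+ (value-- (value-- (value-* z z) (value-* (value-ι (+ 2)) (value-* w y)))
            (value-* (value-ι (+ 4)) (value-* y y))) (value-* (value-ι (+ 8)) (value-* x z))) (value-* (value-ι (+ 8)) w))
            (value-* (value-ι (+ 12)) (value-* x x))) (value-* (value-ι (+ 24)) y)) (value-ι (+ 32))) ,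
        via (W-suc h k) (trans (sym (e₄-double a b c d)) (sym (e₄-cong a′ b′ c′ d′)))
          (value-+ (value-+ (value-- (value-+ (value-- (value-+ (value-+ (value-- (value-* w w) (value-* (value-ι (+ 2)) (value-* z z)))
            (value-* (value-ι (+ 4)) (value-* w y))) (value-* (value-ι (+ 4)) (value-* y y))) (value-* (value-ι (+ 8)) (value-* x z)))
            (value-* (value-ι (+ 8)) w)) (value-* (value-ι (+ 8)) (value-* x x))) (value-* (value-ι (+ 16)) y)) (value-ι (+ 16)))
        where
        a = ηᴿ k
        b = σᴿ 1F (ηᴿ k)
        c = σᴿ 2F (ηᴿ k)
        d = σᴿ 3F (ηᴿ k)
        a′ = orbit-suc k
        b′ = orbit-σ-suc 1F k
        c′ = orbit-σ-suc 2F k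
        d′ = orbit-σ-suc 3F k

    XYZW-value : ∀ k → XYZW-Value k
    XYZW-value zero = base
    XYZW-value (suc k) = step k (XYZW-value k)

-- Gauss sums

-- Logarithms to the base 3, a primitive root modulo 17. The entry at 0 is a default, as characters
-- are set to 0 there.
discreteLog : Fin 17 → ℕ
discreteLog = lookup (0 ∷ 0 ∷ 14 ∷ 1 ∷ 12 ∷ 5 ∷ 15 ∷ 11 ∷ 10 ∷ 2 ∷ 3 ∷ 7 ∷ 13 ∷ 4 ∷ 9 ∷ 6 ∷ 8 ∷ [])

cases₁₇ : {P : Fin 17 → Set} → P 0F → P 1F → P 2F → P 3F → P 4F → P 5F → P 6F → P 7F → P 8F → P 9F →
  P (Fin.# 10) → P (Fin.# 11) → P (Fin.# 12) →
  P (Fin.# 13) → P (Fin.# 14) → P (Fin.# 15) →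
  P (Fin.# 16) → ∀ u → P u
cases₁₇ a b c d e f g h i j k l m n o p q = λ
  { 0F → a ; 1F → b ; 2F → c ; 3F → d ; 4F → e ; 5F → f ; 6F → g ; 7F → h ; 8F → i ; 9F → j
  ; (Fin.suc 9F) → k ; (Fin.suc (Fin.suc 9F)) → l ; (Fin.suc (Fin.suc (Fin.suc 9F))) → m
  ; (Fin.suc (Fin.suc (Fin.suc (Fin.suc 9F)))) → n ; (Fin.suc (Fin.suc (Fin.suc (Fin.suc (Fin.suc 9F))))) → o
  ; (Fin.suc (Fin.suc (Fin.suc (Fin.suc (Fin.suc (Fin.suc 9F)))))) → p
  ; (Fin.suc (Fin.suc (Fin.suc (Fin.suc (Fin.suc (Fin.suc (Fin.suc 9F))))))) → q }

module GaussSums (m : ℕ) where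
  open Cyclotomic m
  open CommutativeRing R
  open PowerLemmas R
  open GroupRing R 16 public

  -- The e-th power of the character χ with χ(3) = ζ, extended by 0. Thus e = 1 has order 16, e = 10
  -- has order 8, and e = 8 is the quadratic character.
  character : ℕ → Fin 17 → Carrier
  character e Fin.zero = 0#
  character e t@(Fin.suc _) = toR (ζ-coefficient ((e ℕ.* discreteLog t) ℕ.% 16))

  character-suc : ∀ e t → character e (Fin.suc t) ≈ ζ ^ (e ℕ.* discreteLog (Fin.suc t))
  character-suc e t = sym (ζ-power (e ℕ.* discreteLog (Fin.suc t)))

  -- The exponent is written with `suc s` so that it is positive and the value 0 at 0 is preserved.
  character-^ : ∀ e s k t → character e t ^ (suc s ℕ.+ k ℕ.* 16) ≈ character (suc s ℕ.* e) t
  character-^ e s k Fin.zero = zeroˡ _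
  character-^ e s k (Fin.suc t) = begin
    character e (Fin.suc t) ^ q          ≈⟨ ^-congˡ q (character-suc e t) ⟩
    (ζ ^ n) ^ q                          ≈⟨ ^-comm ζ n q ⟩
    (ζ ^ q) ^ n                          ≈⟨ ^-congˡ n (^-periodic ζ 16 (suc s) k ζ¹⁶) ⟩
    (ζ ^ suc s) ^ n                      ≈⟨ ^-assocʳ ζ (suc s) n ⟩
    ζ ^ (suc s ℕ.* n)                    ≡⟨ ≡.cong (ζ ^_) (≡.sym (ℕP.*-assoc (suc s) e (discreteLog (Fin.suc t)))) ⟩
    ζ ^ (suc s ℕ.* e ℕ.* discreteLog (Fin.suc t)) ≈⟨ character-suc (suc s ℕ.* e) t ⟨
    character (suc s ℕ.* e) (Fin.suc t)  ∎
    where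
    open import Relation.Binary.Reasoning.Setoid setoid
    q = suc s ℕ.+ k ℕ.* 16
    n = e ℕ.* discreteLog (Fin.suc t)

  gauss : ℕ → Group-algebra
  gauss e t = character e t

  -- 17 − Σₜ xᵗ
  E : Group-algebra
  E Fin.zero = emb (+ 16)
  E (Fin.suc _) = emb -[1+ 0 ]

  -- The Jacobi sums J(χᵉ, χᵉ) = Σ χᵉ(s) χᵉ(1 - s) for e = 1, 2, 4, 10 in coordinates; each has
  -- absolute value √17.
  J₁ J₂ J₄ J₁₀ : Carrier
  J₁  = toR (lookup (+ 0 ∷ -[1+ 1 ] ∷ + 2 ∷ + 0 ∷ -[1+ 0 ] ∷ + 0 ∷ + 2 ∷ + 2 ∷ []))
  J₂  = toR (lookup (-[1+ 2 ] ∷ + 0 ∷ -[1+ 1 ] ∷ + 0 ∷ + 0 ∷ + 0 ∷ -[1+ 1 ] ∷ + 0 ∷ []))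
  J₄  = toR (lookup (-[1+ 0 ] ∷ + 0 ∷ + 0 ∷ + 0 ∷ + 4 ∷ + 0 ∷ + 0 ∷ + 0 ∷ []))
  J₁₀ = toR (lookup (-[1+ 2 ] ∷ + 0 ∷ + 2 ∷ + 0 ∷ + 0 ∷ + 0 ∷ + 2 ∷ + 0 ∷ []))

  private opaque
    unfolding Quadratic._+₂_ GroupRing._+ᵍ_

    -- g(ψ)² = J(ψ, ψ) g(ψ²) holds in the group ring because ψ² is nontrivial, so the coefficient of
    -- x⁰ vanishes. For ψ = χ¹⁰ the square χ²⁰ is χ⁴.
    jacobi₁-at : ∀ u → (gauss 1 *ᵍ gauss 1) u ≈ J₁ * gauss 2 u
    jacobi₁-at = cases₁₇ refl refl refl refl refl refl refl refl refl refl refl refl refl refl refl refl refl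

    jacobi₂-at : ∀ u → (gauss 2 *ᵍ gauss 2) u ≈ J₂ * gauss 4 u
    jacobi₂-at = cases₁₇ refl refl refl refl refl refl refl refl refl refl refl refl refl refl refl refl refl

    jacobi₄-at : ∀ u → (gauss 4 *ᵍ gauss 4) u ≈ J₄ * gauss 8 u
    jacobi₄-at = cases₁₇ refl refl refl refl refl refl refl refl refl refl refl refl refl refl refl refl refl

    jacobi₁₀-at : ∀ u → (gauss 10 *ᵍ gauss 10) u ≈ J₁₀ * gauss 4 u
    jacobi₁₀-at = cases₁₇ refl refl refl refl refl refl refl refl refl refl refl refl refl refl refl refl refl

    -- The square of the quadratic character is trivial, so the chain of Jacobi sums ends here: the
    -- coefficient at 0 is 16, every other one is -1.
    gauss₈-square : ∀ u → (gauss 8 *ᵍ gauss 8) u ≈ E u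
    gauss₈-square = cases₁₇ refl refl refl refl refl refl refl refl refl refl refl refl refl refl refl refl refl

    -- Multiplying by Σ xᵗ gives the sum of all values of the character times Σ xᵗ, which is 0 for a
    -- nontrivial character.
    E-gauss₁-at : ∀ u → (E *ᵍ gauss 1) u ≈ emb (+ 17) * gauss 1 u
    E-gauss₁-at = cases₁₇ refl refl refl refl refl refl refl refl refl refl refl refl refl refl refl refl refl

    E-gauss₁₀-at : ∀ u → (E *ᵍ gauss 10) u ≈ emb (+ 17) * gauss 10 u
    E-gauss₁₀-at = cases₁₇ refl refl refl refl refl refl refl refl refl refl refl refl refl refl refl refl refl

    E-gauss₈-at : ∀ u → (E *ᵍ gauss 8) u ≈ emb (+ 17) * gauss 8 u
    E-gauss₈-at = cases₁₇ refl refl refl refl refl refl refl refl refl refl refl refl refl refl refl refl refl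

    E-E-at : ∀ u → (E *ᵍ E) u ≈ emb (+ 17) * E u
    E-E-at = cases₁₇ refl refl refl refl refl refl refl refl refl refl refl refl refl refl refl refl refl

  module G-powers = PowerLemmas R[C]
  open G-powers using () renaming (_^_ to _^ᵍ_)

  [_] : Carrier → Group-algebra
  [ c ] = monomial c Fin.zero

  private
    pointwise-* : ∀ {f c g} → (∀ u → f u ≈ c * g u) → f ≈ᵍ [ c ] *ᵍ g
    pointwise-* {f} {c} {g} e = pointwise λ u → trans (e u) (sym (constants-* c g u))

    []-* : ∀ c d → [ c * d ] ≈ᵍ [ c ] *ᵍ [ d ]
    []-* = Hom.*-homo constants

    []-^ : ∀ c n → [ c ^ n ] ≈ᵍ [ c ] ^ᵍ n
    []-^ = Hom.^-homo constants

    []-cong : ∀ {c d} → c ≈ d → [ c ] ≈ᵍ [ d ]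
    []-cong = Hom.⟦⟧-cong constants

    square-step : ∀ {x y c} n → x *ᵍ x ≈ᵍ [ c ] *ᵍ y → x ^ᵍ (2 ℕ.* n) ≈ᵍ [ c ^ n ] *ᵍ y ^ᵍ n
    square-step {x} {y} {c} n e = begin
      x ^ᵍ (2 ℕ.* n)          ≈⟨ G-powers.^-assocʳ x 2 n ⟨
      (x ^ᵍ 2) ^ᵍ n           ≈⟨ G-powers.^-congˡ n (G.trans (G.*-congˡ (G-powers.^-one x)) e) ⟩
      ([ c ] *ᵍ y) ^ᵍ n       ≈⟨ G-powers.^-distrib-* [ c ] y n ⟩
      [ c ] ^ᵍ n *ᵍ y ^ᵍ n    ≈⟨ G.*-congʳ ([]-^ c n) ⟨
      [ c ^ n ] *ᵍ y ^ᵍ n     ∎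
      where open import Relation.Binary.Reasoning.Setoid G.setoid

    [1]* : ∀ g → [ 1# ] *ᵍ g ≈ᵍ g
    [1]* = G.*-identityˡ

    chain : ∀ {x y z c d} → x ≈ᵍ [ c ] *ᵍ y → y ≈ᵍ [ d ] *ᵍ z → x ≈ᵍ [ c * d ] *ᵍ z
    chain {x} {y} {z} {c} {d} e f = G.trans e (G.trans (G.*-congˡ f) (G.trans (G.sym (G.*-assoc [ c ] [ d ] z)) (G.*-congʳ (G.sym ([]-* c d)))))

  -- Repeated squaring: g₁¹⁶ = J₁⁸ g₂⁸ = J₁⁸ J₂⁴ g₄⁴ = J₁⁸ J₂⁴ J₄² g₈², and likewise g₁₀⁸ = J₁₀⁴
  -- g₄⁴.
  C₁ C₂ : Carrier
  C₁ = J₁₀ ^ 4 * J₄ ^ 2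
  C₂ = J₁ ^ 8 * (J₂ ^ 4 * J₄ ^ 2)

  gauss₈-power : gauss 8 ^ᵍ 2 ≈ᵍ [ 1# ] *ᵍ E
  gauss₈-power = G.trans (G.*-congˡ (G-powers.^-one (gauss 8))) (G.trans (pointwise gauss₈-square) (G.sym ([1]* E)))

  private
    gauss₄-power : gauss 4 ^ᵍ 4 ≈ᵍ [ J₄ ^ 2 ] *ᵍ E
    gauss₄-power = G.trans (square-step 2 (pointwise-* jacobi₄-at)) (G.*-congˡ (G.trans gauss₈-power ([1]* E)))

  gauss₁₀-power : gauss 10 ^ᵍ 8 ≈ᵍ [ C₁ ] *ᵍ E
  gauss₁₀-power = chain (square-step 4 (pointwise-* jacobi₁₀-at)) gauss₄-power

  gauss₁-power : gauss 1 ^ᵍ 16 ≈ᵍ [ C₂ ] *ᵍ E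
  gauss₁-power = chain (square-step 8 (pointwise-* jacobi₁-at)) (chain (square-step 4 (pointwise-* jacobi₂-at)) gauss₄-power)

  E-gauss₁ : E *ᵍ gauss 1 ≈ᵍ [ emb (+ 17) ] *ᵍ gauss 1
  E-gauss₁ = pointwise-* E-gauss₁-at

  E-gauss₁₀ : E *ᵍ gauss 10 ≈ᵍ [ emb (+ 17) ] *ᵍ gauss 10
  E-gauss₁₀ = pointwise-* E-gauss₁₀-at

  E-gauss₈ : E *ᵍ gauss 8 ≈ᵍ [ emb (+ 17) ] *ᵍ gauss 8
  E-gauss₈ = pointwise-* E-gauss₈-at

  module Powers (g : Group-algebra) (n : ℕ) (c : Carrier) (g^n : g ^ᵍ n ≈ᵍ [ c ] *ᵍ E) where
    private
      D = emb (+ 17) * c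

      E-E : E *ᵍ E ≈ᵍ [ emb (+ 17) ] *ᵍ E
      E-E = pointwise-* E-E-at

    -- Where E acts as 17, each factor gⁿ = cE acts as the scalar D = 17c.
    absorb : ∀ x → E *ᵍ x ≈ᵍ [ emb (+ 17) ] *ᵍ x → ∀ k → g ^ᵍ (k ℕ.* n) *ᵍ x ≈ᵍ [ D ^ k ] *ᵍ x
    absorb x e zero = G.refl
    absorb x e (suc k) = begin
      g ^ᵍ (n ℕ.+ k ℕ.* n) *ᵍ x            ≈⟨ G.*-congʳ (G-powers.^-homo-* g n (k ℕ.* n)) ⟩
      (g ^ᵍ n *ᵍ g ^ᵍ (k ℕ.* n)) *ᵍ x      ≈⟨ G.*-assoc _ _ _ ⟩
      g ^ᵍ n *ᵍ (g ^ᵍ (k ℕ.* n) *ᵍ x)      ≈⟨ G.*-cong g^n (absorb x e k) ⟩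
      ([ c ] *ᵍ E) *ᵍ ([ D ^ k ] *ᵍ x)     ≈⟨ interchange [ c ] E [ D ^ k ] x ⟩
      ([ c ] *ᵍ [ D ^ k ]) *ᵍ (E *ᵍ x)     ≈⟨ G.*-cong (G.sym ([]-* c (D ^ k))) e ⟩
      [ c * D ^ k ] *ᵍ ([ emb (+ 17) ] *ᵍ x) ≈⟨ G.*-assoc _ _ _ ⟨
      ([ c * D ^ k ] *ᵍ [ emb (+ 17) ]) *ᵍ x ≈⟨ G.*-congʳ (G.trans (G.sym ([]-* (c * D ^ k) (emb (+ 17)))) ([]-cong (rearrange c (D ^ k) (emb (+ 17))))) ⟩
      [ D ^ suc k ] *ᵍ x                   ∎
      where
      open import Relation.Binary.Reasoning.Setoid G.setoid
      open import Algebra.Properties.CommutativeSemigroup G.*-commutativeSemigroup using (interchange)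
      rearrange : ∀ a b d → (a * b) * d ≈ (d * a) * b
      rearrange a b d = trans (*-comm (a * b) d) (sym (*-assoc d a b))

    power-suc : E *ᵍ g ≈ᵍ [ emb (+ 17) ] *ᵍ g → ∀ k → g ^ᵍ suc (k ℕ.* n) ≈ᵍ [ D ^ k ] *ᵍ g
    power-suc e k = G.trans (G.*-comm g _) (absorb g e k)

    -- Used for p ≡ -1, where n divides p + 1. No factor g is left over, and the coefficient of E is
    -- one factor 17 short of Dᵏ⁺¹.
    power : ∀ k → g ^ᵍ (suc k ℕ.* n) ≈ᵍ [ c * D ^ k ] *ᵍ E
    power k = begin
      g ^ᵍ (n ℕ.+ k ℕ.* n)                ≈⟨ G-powers.^-homo-* g n (k ℕ.* n) ⟩
      g ^ᵍ n *ᵍ g ^ᵍ (k ℕ.* n)            ≈⟨ G.*-congʳ g^n ⟩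
      ([ c ] *ᵍ E) *ᵍ g ^ᵍ (k ℕ.* n)      ≈⟨ G.*-assoc _ _ _ ⟩
      [ c ] *ᵍ (E *ᵍ g ^ᵍ (k ℕ.* n))      ≈⟨ G.*-congˡ (G.trans (G.*-comm E _) (absorb E E-E k)) ⟩
      [ c ] *ᵍ ([ D ^ k ] *ᵍ E)           ≈⟨ G.*-assoc _ _ _ ⟨
      ([ c ] *ᵍ [ D ^ k ]) *ᵍ E           ≈⟨ G.*-congʳ ([]-* c (D ^ k)) ⟨
      [ c * D ^ k ] *ᵍ E                  ∎
      where open import Relation.Binary.Reasoning.Setoid G.setoid

  open import Algebra.Properties.Semiring.Sum semiring using (sum; sum-cong-≋)
  open Cyclic 16 using (_•_; •-mod)

  -- Σₜ χᵉ(t) x^(r t)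
  twist : ℕ → Fin 17 → Group-algebra
  twist e r u = sum (λ t → monomial (character e t) (toℕ r • t) u)

  open import Algebra.Properties.Semiring.Sum G.semiring using () renaming (sum to sumᵍ; *-distribʳ-sum to *ᵍ-distribʳ-sumᵍ)
  open Cyclic 16 using (_⊟_)

  twist-* : ∀ e r g u → (twist e r *ᵍ g) u ≈ sum (λ t → character e t * g (u ⊟ toℕ r • t))
  twist-* e r g u = begin
    (twist e r *ᵍ g) u                                     ≈⟨ at (G.*-congʳ {g} (pointwise {twist e r} (λ u → sym (sumᵍ-at F u)))) u ⟩
    (sumᵍ F *ᵍ g) u                                        ≈⟨ at (*ᵍ-distribʳ-sumᵍ g F) u ⟩
    sumᵍ (λ t → F t *ᵍ g) u                                ≈⟨ sumᵍ-at (λ t → F t *ᵍ g) u ⟩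
    sum (λ t → (F t *ᵍ g) u)                               ≈⟨ sum-cong-≋ {17} (λ t → monomial-* (character e t) (toℕ r • t) g u) ⟩
    sum (λ t → character e t * g (u ⊟ toℕ r • t))          ∎
    where
    open import Relation.Binary.Reasoning.Setoid setoid
    F : Fin 17 → Group-algebra
    F t = monomial (character e t) (toℕ r • t)

-- The Frobenius map on Gauss sums and the resulting powers of α₁ and α₂

module GaussFrobenius (p : ℕ) (pp : Prime p) where
  open GaussSums p
  open Cyclotomic p
  open CommutativeRing R
  open PowerLemmas R
  open Frobenius R[C] p pp (annihilated p (Q₃.annihilated p (Q₂.annihilated p (Q₁.annihilated p ℤ/-annihilated))))
  open G-powers using () renaming (_^_ to _^ᵍ_)
  open import Algebra.Properties.Semiring.Sum semiring using (sum; sum-cong-≋)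
  open import Algebra.Properties.Semiring.Sum G.semiring using () renaming (sum to sumᵍ; sum-cong-≋ to sumᵍ-cong)
  open Cyclic 16 using (_•_; _⊟_; •-mod)

  -- p ≡ s + 1 mod 16 governs the values of the character, r = p mod 17 the exponents of x.
  gauss-frobenius : ∀ e s k (r : Fin 17) → p ≡ suc s ℕ.+ k ℕ.* 16 → p ℕ.% 17 ≡ toℕ r → gauss e ^ᵍ p ≈ᵍ twist (suc s ℕ.* e) r
  gauss-frobenius e s k r p≡ p%17 = begin
    gauss e ^ᵍ p                                              ≈⟨ G-powers.^-congˡ p (sum-of-monomials (gauss e)) ⟩
    sumᵍ (λ t → monomial (gauss e t) t) ^ᵍ p                   ≈⟨ frobenius-sum (λ t → monomial (gauss e t) t) ⟩
    sumᵍ (λ t → monomial (gauss e t) t ^ᵍ p)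
      ≈⟨ sumᵍ-cong {17} (λ t → G.trans (monomial-^ (gauss e t) t p) (monomial-cong (power t) (residue t))) ⟩
    sumᵍ (λ t → monomial (character (suc s ℕ.* e) t) (toℕ r • t)) ≈⟨ pointwise (sumᵍ-at (λ t → monomial (character (suc s ℕ.* e) t) (toℕ r • t))) ⟩
    twist (suc s ℕ.* e) r                                     ∎
    where
    open import Relation.Binary.Reasoning.Setoid G.setoid
    power : ∀ t → gauss e t ^ p ≈ character (suc s ℕ.* e) t
    power t = trans (^-congʳ (gauss e t) p≡) (character-^ e s k t)
    residue : ∀ t → p • t ≡ toℕ r • t
    residue t = ≡.trans (•-mod p t) (≡.cong (_• t) p%17)

  module _ (e n : ℕ) (c : Carrier) (g^n : gauss e ^ᵍ n ≈ᵍ [ c ] *ᵍ E) (k s : ℕ) (r : Fin 17) (p%17 : p ℕ.% 17 ≡ toℕ r) where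
    open Powers (gauss e) n c g^n

    gauss-plus : E *ᵍ gauss e ≈ᵍ [ emb (+ 17) ] *ᵍ gauss e → p ≡ suc (k ℕ.* n) → p ≡ 1 ℕ.+ s ℕ.* 16 →
                 ∀ u → (emb (+ 17) * c) ^ k * gauss e u ≈ twist (1 ℕ.* e) r u
    gauss-plus eg p≡ p≡′ u = trans (sym (constants-* _ (gauss e) u)) (at (G.trans (G.sym (power-suc eg k))
      (G.trans (G-powers.^-congʳ (gauss e) (≡.sym p≡)) (gauss-frobenius e 0 s r p≡′ p%17))) u)

    -- For p ≡ -1 mod 16 Frobenius inverts the character (15e ≡ -e), so gᵖ is no multiple of g; one
    -- more factor g makes it a multiple of E.
    gauss-minus : suc p ≡ suc k ℕ.* n → p ≡ 15 ℕ.+ s ℕ.* 16 →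
                  ∀ u → (c * (emb (+ 17) * c) ^ k) * E u ≈ sum (λ t → character (15 ℕ.* e) t * gauss e (u ⊟ toℕ r • t))
    gauss-minus p≡ p≡′ u = trans (sym (constants-* _ E u)) (at (G.trans (G.sym (power k))
      (G.trans (G-powers.^-congʳ (gauss e) (≡.sym p≡)) (G.trans (G.*-congˡ (gauss-frobenius e 14 s r p≡′ p%17)) (G.trans (G.*-comm (gauss e) (twist (15 ℕ.* e) r)) (pointwise (twist-* (15 ℕ.* e) r (gauss e))))))) u)

-- Restricts a statement to r ≠ 0 while keeping it a predicate on all of `Fin 17`, as `cases₁₇`
-- expects.
Nonzero : (Fin 17 → Set) → Fin 17 → Set
Nonzero P Fin.zero = ⊤
Nonzero P r@(Fin.suc _) = P r

module Reciprocity (p : ℕ) (pp : Prime p) (i₁₇ : ℤ) (inverts₁₇ : (+ 17 ℤ.* i₁₇) ≡ₘ + 1 [ p ]) where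
  open GaussSums p
  open GaussFrobenius p pp
  open Cyclotomic p
  open Pi (Localisation.localisation p pp) using (π₁ᴿ; π₂ᴿ)
  open GaloisAction p
  open Alpha p pp i₁₇ inverts₁₇
  open CommutativeRing R
  open PowerLemmas R
  open import Algebra.Properties.Semiring.Sum semiring using (sum)
  open Cyclic 16 using (_•_; _⊟_)
  open import Relation.Binary.Reasoning.Setoid setoid

  private
    q : Carrier
    q = emb (+ 17)

    unit-q : Unit q
    unit-q = emb i₁₇ , trans (sym (emb-* (+ 17) i₁₇)) (emb-cong {+ 17 ℤ.* i₁₇} {+ 1} inverts₁₇)

  -- coefficient of x in g^p (p ≡ 1 mod 16), respectively in g^(p+1) (p ≡ −1 mod 16)
  plus-coefficient minus-coefficient : ℕ → Fin 17 → Carrier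
  plus-coefficient e r = twist (1 ℕ.* e) r 1F
  minus-coefficient e r = sum (λ t → character (15 ℕ.* e) t * gauss e (1F ⊟ toℕ r • t))

  root : ℕ → Carrier
  root j = toR (ζ-coefficient (j ℕ.% 16))

  private opaque
    unfolding Quadratic._+₂_ σᴿ

    -- 17 C₁ = 17⁴ α₁ cleared of denominators and of one factor 17: an identity in ℤ[ζ] that can be
    -- evaluated.
    factor₁ : C₁ * conjᴿ N₁ ≈ q ^ 3 * N₁
    factor₁ = refl

    factor₂ : C₂ * conjᴿ N₂ ≈ q ^ 7 * N₂
    factor₂ = refl

    gauss-at-1F : (gauss 1 1F ≈ 1#) ∧ (gauss 8 1F ≈ 1#) ∧ (gauss 10 1F ≈ 1#)
    gauss-at-1F = refl , refl , refl

  private opaque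
    unfolding Quadratic._+₂_ GroupRing._+ᵍ_

    -- x arises from t = r⁻¹, so the coefficient is χᵉ(r⁻¹) = ζ^(15 e log r); here 15 · 8 = 120, and
    -- 15 · 10 = 150 for the next table.
    plus₈ : ∀ r → Nonzero (λ r → plus-coefficient 8 r ≈ root (120 ℕ.* discreteLog r)) r
    plus₈ = cases₁₇ tt refl refl refl refl refl refl refl refl refl refl refl refl refl refl refl refl

    plus₁₀ : ∀ r → Nonzero (λ r → plus-coefficient 10 r ≈ root (150 ℕ.* discreteLog r)) r
    plus₁₀ = cases₁₇ tt refl refl refl refl refl refl refl refl refl refl refl refl refl refl refl refl

    -- Substituting t/r for t turns the sum into χᵉ(r) J(χ⁻ᵉ, χᵉ) = -χᵉ(-r). Adding 8 to the
    -- logarithm accounts for -r, adding 8 to the exponent of ζ for the sign.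
    minus₈ : ∀ r → Nonzero (λ r → minus-coefficient 8 r ≈ root (8 ℕ.* (discreteLog r ℕ.+ 8) ℕ.+ 8)) r
    minus₈ = cases₁₇ tt refl refl refl refl refl refl refl refl refl refl refl refl refl refl refl refl

    minus₁₀ : ∀ r → Nonzero (λ r → minus-coefficient 10 r ≈ root (10 ℕ.* (discreteLog r ℕ.+ 8) ℕ.+ 8)) r
    minus₁₀ = cases₁₇ tt refl refl refl refl refl refl refl refl refl refl refl refl refl refl refl refl

    -- At r = -1 the quadratic character is 1 while χ is -1.
    plus-root₂ : plus-coefficient 8 (Fin.fromℕ 16) * plus-coefficient 1 (Fin.fromℕ 16) ≈ emb -[1+ 0 ]
    plus-root₂ = refl

    minus-root₂ : minus-coefficient 8 1F * minus-coefficient 1 1F ≈ emb -[1+ 0 ]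
    minus-root₂ = refl

  private
    root-* : ∀ {x y} a b c t → a ℕ.+ b ≡ c ℕ.+ t ℕ.* 16 → x ≈ root a → y ≈ root b → x * y ≈ root c
    root-* {x} {y} a b c t e ex ey = begin
      x * y                  ≈⟨ *-cong (trans ex (sym (ζ-power a))) (trans ey (sym (ζ-power b))) ⟩
      ζ ^ a * ζ ^ b          ≈⟨ ^-homo-* ζ a b ⟨
      ζ ^ (a ℕ.+ b)          ≡⟨ ≡.cong (ζ ^_) e ⟩
      ζ ^ (c ℕ.+ t ℕ.* 16)   ≈⟨ ^-periodic ζ 16 c t ζ¹⁶ ⟩
      ζ ^ c                  ≈⟨ ζ-power c ⟩
      root c                 ∎

    plus-sign : ∀ r → plus-coefficient 8 (Fin.suc r) * plus-coefficient 8 (Fin.suc r) ≈ 1#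
    plus-sign r = trans (root-* (120 ℕ.* l) (120 ℕ.* l) 0 (15 ℕ.* l)
        (solve 1 (λ l → con 120 :* l :+ con 120 :* l := con 15 :* l :* con 16) ≡.refl l) (plus₈ (Fin.suc r)) (plus₈ (Fin.suc r))) (sym (ζ-power 0))
      where
      open +-*-Solver
      l = discreteLog (Fin.suc r)

    minus-sign : ∀ r → minus-coefficient 8 (Fin.suc r) * minus-coefficient 8 (Fin.suc r) ≈ 1#
    minus-sign r = trans (root-* (8 ℕ.* l ℕ.+ 8) (8 ℕ.* l ℕ.+ 8) 0 (l ℕ.+ 1)
        (solve 1 (λ l → con 8 :* l :+ con 8 :+ (con 8 :* l :+ con 8) := (l :+ con 1) :* con 16) ≡.refl l) (minus₈ (Fin.suc r)) (minus₈ (Fin.suc r))) (sym (ζ-power 0))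
      where
      open +-*-Solver
      l = discreteLog (Fin.suc r) ℕ.+ 8

    plus-root₁ : ∀ r → plus-coefficient 8 (Fin.suc r) * plus-coefficient 10 (Fin.suc r) ≈ root (14 ℕ.* discreteLog (Fin.suc r))
    plus-root₁ r = root-* (120 ℕ.* l) (150 ℕ.* l) (14 ℕ.* l) (16 ℕ.* l)
        (solve 1 (λ l → con 120 :* l :+ con 150 :* l := con 14 :* l :+ con 16 :* l :* con 16) ≡.refl l) (plus₈ (Fin.suc r)) (plus₁₀ (Fin.suc r))
      where
      open +-*-Solver
      l = discreteLog (Fin.suc r)

    minus-root₁ : ∀ r → minus-coefficient 8 (Fin.suc r) * minus-coefficient 10 (Fin.suc r) ≈ root (2 ℕ.* (discreteLog (Fin.suc r) ℕ.+ 8))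
    minus-root₁ r = root-* (8 ℕ.* l ℕ.+ 8) (10 ℕ.* l ℕ.+ 8) (2 ℕ.* l) (l ℕ.+ 1)
        (solve 1 (λ l → con 8 :* l :+ con 8 :+ (con 10 :* l :+ con 8) := con 2 :* l :+ (l :+ con 1) :* con 16) ≡.refl l) (minus₈ (Fin.suc r)) (minus₁₀ (Fin.suc r))
      where
      open +-*-Solver
      l = discreteLog (Fin.suc r) ℕ.+ 8

    C≈q^A : ∀ c A N d → A isFractionOf N → Unit (conjᴿ N) → c * conjᴿ N ≈ q ^ d * N → q * c ≈ q ^ suc d * A
    C≈q^A c A N d frac unit e = trans (*-congˡ (unit-cancelʳ unit (begin
      c * conjᴿ N              ≈⟨ e ⟩
      q ^ d * N                ≈⟨ *-congˡ frac ⟨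
      q ^ d * (A * conjᴿ N)    ≈⟨ *-assoc _ _ _ ⟨
      (q ^ d * A) * conjᴿ N    ∎))) (sym (*-assoc q (q ^ d) A))

    qC₁ : q * C₁ ≈ q ^ 4 * A₁
    qC₁ = C≈q^A C₁ A₁ N₁ 3 fraction-A₁ unit-conj-N₁ factor₁

    qC₂ : q * C₂ ≈ q ^ 8 * A₂
    qC₂ = C≈q^A C₂ A₂ N₂ 7 fraction-A₂ unit-conj-N₂ factor₂

    qC-power : ∀ c A d k → q * c ≈ q ^ d * A → (q * c) ^ k ≈ (q * 1#) ^ (k ℕ.* d) * A ^ k
    qC-power c A d k e = begin
      (q * c) ^ k                 ≈⟨ ^-congˡ k e ⟩
      (q ^ d * A) ^ k             ≈⟨ ^-distrib-* (q ^ d) A k ⟩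
      (q ^ d) ^ k * A ^ k         ≈⟨ *-congʳ (trans (^-assocʳ q d k) (^-congʳ q (ℕP.*-comm d k))) ⟩
      q ^ (k ℕ.* d) * A ^ k       ≈⟨ *-congʳ (^-congˡ (k ℕ.* d) (*-identityʳ q)) ⟨
      (q * 1#) ^ (k ℕ.* d) * A ^ k ∎

    solve-sign : ∀ s x y → s * s ≈ 1# → s * x ≈ y → x ≈ s * y
    solve-sign s x y ss e = trans (sym (*-identityˡ x)) (trans (*-congʳ (sym ss)) (trans (*-assoc s s x) (*-congˡ e)))

  module _ (e n d : ℕ) (n≡2d : n ≡ d ℕ.* 2) (c A : Carrier) (g^n : G-powers._^_ (gauss e) n ≈ᵍ [ c ] *ᵍ E)
           (gauss-at : gauss e 1F ≈ 1#) (qc : q * c ≈ q ^ d * A) (s : ℕ) (r : Fin 17) (p%17 : p ℕ.% 17 ≡ toℕ r) where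

    -- Both Gauss sums are raised to the power p, where p - 1 = kn = 2kd. The quadratic one yields
    -- 17^(kd), the other (17c)ᵏ = 17^(kd) Aᵏ; comparing them isolates Aᵏ.
    plus-power : E *ᵍ gauss e ≈ᵍ [ q ] *ᵍ gauss e → ∀ k → p ≡ suc (k ℕ.* n) → p ≡ 1 ℕ.+ s ℕ.* 16 →
                 plus-coefficient 8 r * A ^ k ≈ plus-coefficient e r
    plus-power eg k p≡ p≡′ = begin
      plus-coefficient 8 r * A ^ k               ≈⟨ *-congʳ (gauss-plus 8 2 1# gauss₈-power (k ℕ.* d) s r p%17 E-gauss₈ p≡₂ p≡′ 1F) ⟨
      (q * 1#) ^ (k ℕ.* d) * gauss 8 1F * A ^ k  ≈⟨ *-congʳ (trans (*-congˡ (proj₁ (proj₂ gauss-at-1F))) (*-identityʳ _)) ⟩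
      (q * 1#) ^ (k ℕ.* d) * A ^ k               ≈⟨ qC-power c A d k qc ⟨
      (q * c) ^ k                                ≈⟨ *-identityʳ _ ⟨
      (q * c) ^ k * 1#                           ≈⟨ *-congˡ gauss-at ⟨
      (q * c) ^ k * gauss e 1F                   ≈⟨ gauss-plus e n c g^n k s r p%17 eg p≡ p≡′ 1F ⟩
      plus-coefficient e r                       ∎
      where
      p≡₂ : p ≡ suc (k ℕ.* d ℕ.* 2)
      p≡₂ = ≡.trans p≡ (≡.cong suc (≡.trans (≡.cong (k ℕ.*_) n≡2d) (≡.sym (ℕP.*-assoc k d 2))))

    minus-power : ∀ k → suc p ≡ suc k ℕ.* n → p ≡ 15 ℕ.+ s ℕ.* 16 →
                  ∀ j → suc j ≡ suc k ℕ.* d → minus-coefficient 8 r * A ^ suc k ≈ minus-coefficient e r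
    -- Each power p + 1 lacks one factor 17, so both sides are multiplied by the unit 17. The common
    -- factor -1 is the coefficient of x in E.
    minus-power k p≡ p≡′ j j≡ = unit-cancelʳ unit-q (begin
      (minus-coefficient 8 r * A ^ suc k) * q                    ≈⟨ *-congʳ (*-congʳ (gauss-minus 8 2 1# gauss₈-power j s r p%17 p≡₂ p≡′ 1F)) ⟨
      (((1# * (q * 1#) ^ j) * ε) * A ^ suc k) * q                ≈⟨ rearrange 1# ((q * 1#) ^ j) (A ^ suc k) ⟩
      ε * ((q * 1#) ^ suc j * A ^ suc k)                         ≈⟨ *-congˡ (*-congʳ (^-congʳ (q * 1#) j≡)) ⟩
      ε * ((q * 1#) ^ (suc k ℕ.* d) * A ^ suc k)                 ≈⟨ *-congˡ (qC-power c A d (suc k) qc) ⟨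
      ε * ((q * c) ^ suc k)                                      ≈⟨ *-congˡ (*-identityʳ _) ⟨
      ε * ((q * c) ^ suc k * 1#)                                 ≈⟨ rearrange c ((q * c) ^ k) 1# ⟨
      (((c * (q * c) ^ k) * ε) * 1#) * q                         ≈⟨ *-congʳ (*-identityʳ _) ⟩
      ((c * (q * c) ^ k) * ε) * q                                ≈⟨ *-congʳ (gauss-minus e n c g^n k s r p%17 p≡ p≡′ 1F) ⟩
      minus-coefficient e r * q                                  ∎)
      where
      ε = emb -[1+ 0 ]
      p≡₂ : suc p ≡ suc j ℕ.* 2
      p≡₂ = ≡.trans p≡ (≡.trans (≡.cong (suc k ℕ.*_) n≡2d) (≡.trans (≡.sym (ℕP.*-assoc (suc k) d 2)) (≡.cong (ℕ._* 2) (≡.sym j≡))))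
      rearrange : ∀ a b x → (((a * b) * ε) * x) * q ≈ ε * (((q * a) * b) * x)
      rearrange a b x = begin
        (((a * b) * ε) * x) * q   ≈⟨ *-congʳ (*-congʳ (*-comm (a * b) ε)) ⟩
        ((ε * (a * b)) * x) * q   ≈⟨ *-congʳ (*-assoc ε (a * b) x) ⟩
        (ε * ((a * b) * x)) * q   ≈⟨ *-assoc ε _ q ⟩
        ε * (((a * b) * x) * q)   ≈⟨ *-congˡ (*-comm _ q) ⟩
        ε * (q * ((a * b) * x))   ≈⟨ *-congˡ (*-assoc q (a * b) x) ⟨
        ε * ((q * (a * b)) * x)   ≈⟨ *-congˡ (*-congʳ (*-assoc q a b)) ⟨
        ε * (((q * a) * b) * x)   ∎

  module _ (s : ℕ) (r : Fin 16) (p%17 : p ℕ.% 17 ≡ suc (toℕ r)) where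
    A₁-plus : ∀ k → p ≡ suc (k ℕ.* 8) → p ≡ 1 ℕ.+ s ℕ.* 16 → A₁ ^ k ≈ root (14 ℕ.* discreteLog (Fin.suc r))
    A₁-plus k p≡ p≡′ = trans (solve-sign _ _ _ (plus-sign r)
        (plus-power 10 8 4 ≡.refl C₁ A₁ gauss₁₀-power (proj₂ (proj₂ gauss-at-1F)) qC₁ s (Fin.suc r) p%17 E-gauss₁₀ k p≡ p≡′))
      (plus-root₁ r)

    A₁-minus : ∀ k → suc p ≡ suc k ℕ.* 8 → p ≡ 15 ℕ.+ s ℕ.* 16 → A₁ ^ suc k ≈ root (2 ℕ.* (discreteLog (Fin.suc r) ℕ.+ 8))
    A₁-minus k p≡ p≡′ = trans (solve-sign _ _ _ (minus-sign r)
        (minus-power 10 8 4 ≡.refl C₁ A₁ gauss₁₀-power (proj₂ (proj₂ gauss-at-1F)) qC₁ s (Fin.suc r) p%17 k p≡ p≡′ (3 ℕ.+ k ℕ.* 4) ≡.refl))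
      (minus-root₁ r)

  A₂-plus : ∀ s → p ℕ.% 17 ≡ 16 → p ≡ suc (s ℕ.* 16) → A₂ ^ s ≈ emb -[1+ 0 ]
  A₂-plus s p%17 p≡ = trans (solve-sign _ _ _ (plus-sign (Fin.fromℕ 15))
      (plus-power 1 16 8 ≡.refl C₂ A₂ gauss₁-power (proj₁ gauss-at-1F) qC₂ s r p%17 E-gauss₁ s p≡ p≡))
    plus-root₂
    where
    r : Fin 17
    r = Fin.fromℕ 16

  A₂-minus : ∀ s k → p ℕ.% 17 ≡ 1 → suc p ≡ suc k ℕ.* 16 → p ≡ 15 ℕ.+ s ℕ.* 16 → A₂ ^ suc k ≈ emb -[1+ 0 ]
  A₂-minus s k p%17 p≡ p≡′ = trans (solve-sign _ _ _ (minus-sign 0F)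
      (minus-power 1 16 8 ≡.refl C₂ A₂ gauss₁-power (proj₁ gauss-at-1F) qC₂ s 1F p%17 k p≡ p≡′ (7 ℕ.+ k ℕ.* 8) ≡.refl))
    minus-root₂

-- Prime divisors of M

parity : ∀ n → (∃ λ m → n ≡ 2 ℕ.* m) ⊎ (∃ λ m → n ≡ suc (2 ℕ.* m))
parity zero = inj₁ (0 , ≡.refl)
parity (suc n) with parity n
... | inj₁ (m , e) = inj₂ (m , ≡.cong suc e)
... | inj₂ (m , e) = inj₁ (suc m , ≡.trans (≡.cong suc e) (≡.cong suc (≡.sym (ℕP.+-suc m (m ℕ.+ 0)))))

module Orders (S : CommutativeRing 0ℓ 0ℓ) (ε : CommutativeRing.Carrier S)
              (ε² : CommutativeRing._≈_ S (CommutativeRing._*_ S ε ε) (CommutativeRing.1# S))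
              (ε≉1 : ¬ CommutativeRing._≈_ S ε (CommutativeRing.1# S)) where
  open CommutativeRing S
  open PowerLemmas S

  -- Induction on K by halving d. An odd d is impossible, since it would give ε = ε^d = (x^d)^(2^K)
  -- = 1.
  2^∣order : ∀ K x d → x ^ (2 ℕ.^ K) ≈ ε → x ^ d ≈ 1# → 2 ℕ.^ suc K ℕD.∣ d
  2^∣order K x d e f with parity d
  2^∣order K x d e f | inj₂ (m , ≡.refl) = contradiction odd ε≉1
    where
    open import Relation.Binary.Reasoning.Setoid setoid
    odd : ε ≈ 1#
    odd = begin
      ε                        ≈⟨ *-identityʳ ε ⟨
      ε * 1#                   ≈⟨ *-congˡ (trans (^-congˡ m (trans (*-congˡ (^-one ε)) ε²)) (1^ m)) ⟨
      ε * (ε ^ 2) ^ m          ≈⟨ *-congˡ (^-assocʳ ε 2 m) ⟩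
      ε ^ suc (2 ℕ.* m)        ≈⟨ ^-congˡ (suc (2 ℕ.* m)) e ⟨
      (x ^ (2 ℕ.^ K)) ^ suc (2 ℕ.* m) ≈⟨ ^-comm x (2 ℕ.^ K) (suc (2 ℕ.* m)) ⟩
      (x ^ suc (2 ℕ.* m)) ^ (2 ℕ.^ K) ≈⟨ ^-congˡ (2 ℕ.^ K) f ⟩
      1# ^ (2 ℕ.^ K)           ≈⟨ 1^ (2 ℕ.^ K) ⟩
      1#                       ∎
  2^∣order zero x d e f | inj₁ (m , ≡.refl) = ℕD.divides m (ℕP.*-comm 2 m)
  2^∣order (suc K) x d e f | inj₁ (m , ≡.refl) =
    ℕD.*-monoʳ-∣ 2 (2^∣order K (x ^ 2) m (trans (^-assocʳ x 2 (2 ℕ.^ K)) e) (trans (^-assocʳ x 2 m) f))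

  nilpotent-free : ∀ N → 2 ℕ.≤ N → (∀ x → x ^ N ≈ x) → ∀ x → x * x ≈ 0# → x ≈ 0#
  nilpotent-free (suc (suc N)) (s≤s (s≤s z≤n)) fixed x e =
    trans (sym (fixed x)) (trans (sym (*-assoc x x (x ^ N))) (trans (*-congʳ e) (zeroˡ _)))

-- 4 is the exponent of the group (ℤ/16)*. The witnesses are (p⁴ - 1)/16 expanded for p = 4a + 1 and
-- p = 4a + 3.
odd-fourth-power : ∀ p m → p ≡ suc (2 ℕ.* m) → ∃ λ t → p ℕ.^ 4 ≡ 1 ℕ.+ t ℕ.* 16
odd-fourth-power p m ≡.refl with parity m
... | inj₁ (a , ≡.refl) = (16 ℕ.* a ℕ.* a ℕ.* a ℕ.* a ℕ.+ 16 ℕ.* a ℕ.* a ℕ.* a ℕ.+ 6 ℕ.* a ℕ.* a ℕ.+ a) , even a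
  where
  open +-*-Solver
  even : ∀ a → suc (2 ℕ.* (2 ℕ.* a)) ℕ.^ 4 ≡ 1 ℕ.+ (16 ℕ.* a ℕ.* a ℕ.* a ℕ.* a ℕ.+ 16 ℕ.* a ℕ.* a ℕ.* a ℕ.+ 6 ℕ.* a ℕ.* a ℕ.+ a) ℕ.* 16
  even = solve 1 (λ a → let p = con 1 :+ con 2 :* (con 2 :* a) in p :* (p :* (p :* (p :* con 1))) :=
        con 1 :+ (con 16 :* a :* a :* a :* a :+ con 16 :* a :* a :* a :+ con 6 :* a :* a :+ a) :* con 16) ≡.refl
... | inj₂ (a , ≡.refl) = (16 ℕ.* a ℕ.* a ℕ.* a ℕ.* a ℕ.+ 48 ℕ.* a ℕ.* a ℕ.* a ℕ.+ 54 ℕ.* a ℕ.* a ℕ.+ 27 ℕ.* a ℕ.+ 5) , odd a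
  where
  open +-*-Solver
  odd : ∀ a → suc (2 ℕ.* suc (2 ℕ.* a)) ℕ.^ 4 ≡
    1 ℕ.+ (16 ℕ.* a ℕ.* a ℕ.* a ℕ.* a ℕ.+ 48 ℕ.* a ℕ.* a ℕ.* a ℕ.+ 54 ℕ.* a ℕ.* a ℕ.+ 27 ℕ.* a ℕ.+ 5) ℕ.* 16
  odd = solve 1 (λ a → let p = con 1 :+ con 2 :* (con 1 :+ con 2 :* a) in p :* (p :* (p :* (p :* con 1))) :=
        con 1 :+ (con 16 :* a :* a :* a :* a :+ con 48 :* a :* a :* a :+ con 54 :* a :* a :+ con 27 :* a :+ con 5) :* con 16) ≡.refl

module PrimeDivisor (p : ℕ) (pp : Prime p) (i₁₇ : ℤ) (inverts₁₇ : (+ 17 ℤ.* i₁₇) ≡ₘ + 1 [ p ])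
                    (i₂ : ℤ) (inverts₂ : (+ 2 ℤ.* i₂) ≡ₘ + 1 [ p ]) (odd : ∃ λ m → p ≡ suc (2 ℕ.* m)) where
  open Localisation p pp
  open Cyclotomic p
  open GaloisAction p
  open CommutativeRing R
  open PowerLemmas R
  open Alpha p pp i₁₇ inverts₁₇
  open Sequences p pp i₁₇ inverts₁₇ i₂ inverts₂
  open IntegerPolynomials embedding hiding (#)
  open import Algebra.Properties.Group +-group using (x∙y⁻¹≈ε⇒x≈y; x≈y⇒x∙y⁻¹≈ε)

  infix 4 _≡ᵖ_
  _≡ᵖ_ : ℚ → ℤ → Set
  q ≡ᵖ z = (+ p) ℤD.∣ ↥ (q ℚ.- ι z)

  value⇒≈ : ∀ {q x} z → Value q x → q ≡ᵖ z → x ≈ emb z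
  value⇒≈ {q} {x} z v d = x∙y⁻¹≈ε⇒x≈y x (emb z)
    (trans (sym (embeds w)) (emb-cong {residue w} {+ 0} (∣⇒↦0 (reduces w) d)))
    where w = value-- v (value-ι z)

  ≈⇒≡ᵖ : ∀ {q x} z → Value q x → x ≈ emb z → q ≡ᵖ z
  ≈⇒≡ᵖ {q} {x} z v e = ↦0⇒∣ (reduces w) (emb-injective {residue w} {+ 0} (trans (embeds w) (x≈y⇒x∙y⁻¹≈ε e)))
    where w = value-- v (value-ι z)

  private
    ε : Carrier
    ε = emb -[1+ 0 ]

    ε² : ε * ε ≈ 1#
    ε² = sym (emb-* -[1+ 0 ] -[1+ 0 ])

    -- -1 = 1 would make 2 vanish, although it is invertible modulo p.
    ε≉1 : ¬ ε ≈ 1#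
    ε≉1 e = contradiction (ℕD.∣1⇒≡1 (ℤD.∣⇒∣ᵤ (≡ₘ0⁻¹ 1≡0))) (ℕ.nonTrivial⇒≢1 {{prime⇒nonTrivial pp}})
      where
      1≡0 : + 1 F.≈ + 0
      1≡0 = F.trans (F.sym inverts₂) (F.trans (F.*-congʳ {i₂} {+ 2} {+ 0} (F.+-congˡ {+ 1} (F.sym (emb-injective e)))) (F.reflexive (ℤP.*-zeroˡ i₂)))

    open Orders R ε ε² ε≉1

    fixed : ∀ x → x ^ (p ℕ.^ 4) ≈ x
    fixed = FrobeniusFixed.frobenius-fixed p pp 4 (proj₁ t) (proj₂ t)
      where t = odd-fourth-power p (proj₁ odd) (proj₂ odd)

    p≥2 : 2 ℕ.≤ p
    p≥2 = ℕ.nonTrivial⇒n>1 p {{prime⇒nonTrivial pp}}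

    p⁴≥2 : 2 ℕ.≤ p ℕ.^ 4
    p⁴≥2 = ℕP.≤-trans p≥2 (ℕP.m≤m*n p (p ℕ.^ 3) {{ℕP.m^n≢0 p 3 {{prime⇒nonZero pp}}}})

    reduced : ∀ {x} → x * x ≈ 0# → x ≈ 0#
    reduced {x} = nilpotent-free (p ℕ.^ 4) p⁴≥2 fixed x

    -- The inverse y cancels one factor of x^(p⁴) = x, leaving x^(p⁴ - 1) = 1.
    order : ∀ K x y → x * y ≈ 1# → x ^ (2 ℕ.^ K) ≈ ε → 2 ℕ.^ suc K ℕD.∣ (p ℕ.^ 4 ℕ.∸ 1)
    order K x y xy e = 2^∣order K x (p ℕ.^ 4 ℕ.∸ 1) e (begin
      x ^ d               ≈⟨ *-identityˡ _ ⟨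
      1# * x ^ d          ≈⟨ *-congʳ (trans (*-comm y x) xy) ⟨
      (y * x) * x ^ d     ≈⟨ *-assoc y x (x ^ d) ⟩
      y * x ^ suc d       ≈⟨ *-congˡ (trans (^-congʳ x (ℕP.m+[n∸m]≡n {1} (ℕP.≤-trans (s≤s z≤n) p⁴≥2))) (fixed x)) ⟩
      y * x               ≈⟨ trans (*-comm y x) xy ⟩
      1#                  ∎)
      where
      open import Relation.Binary.Reasoning.Setoid setoid
      d = p ℕ.^ 4 ℕ.∸ 1

  module Converse₁ (h k : ℕ) where
    open Orbit A₁ normOne-A₁ h renaming (orbit to θᴿ)
    open TN-values h

    private
      x y a b : Carrier
      x = β ^ (2 ℕ.^ k)
      y = β̄ ^ (2 ℕ.^ k)
      a = θᴿ k
      b = σᴿ 1F a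

      xy : x * y ≈ 1#
      xy = ββ̄ (2 ℕ.^ k)

      β-unit : β * β̄ ≈ 1#
      β-unit = trans (*-cong (sym (^-one β)) (sym (^-one β̄))) (ββ̄ 1)

      quadratic : ∀ t n → T h k ≡ᵖ t → N h k ≡ᵖ n → a * a ≈ emb t * a - emb n
      quadratic t n et en = trans (quadratic-root a b)
        (+-cong (*-congʳ (value⇒≈ t (proj₁ (TN-value k)) et)) (-‿cong (value⇒≈ n (proj₂ (TN-value k)) en)))

    -- (a + 2)² = 0 forces a = -2 in the reduced ring; then (x + 1)² = x(a + 2) = 0, so x = -1.
    converse-i : T h k ≡ᵖ -[1+ 3 ] → N h k ≡ᵖ + 4 → 2 ℕ.^ suc k ℕD.∣ (p ℕ.^ 4 ℕ.∸ 1)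
    converse-i et en = order k β β̄ β-unit (trans (x∙y⁻¹≈ε⇒x≈y x ε (trans (+-congˡ (sym (emb-neg -[1+ 0 ]))) x+1≈0)) refl)
      where
      a+2≈0 : a + emb (+ 2) ≈ 0#
      a+2≈0 = reduced (trans (square-+2 a) (x≈y⇒x∙y⁻¹≈ε (quadratic -[1+ 3 ] (+ 4) et en)))
      x+1≈0 : x + 1# ≈ 0#
      x+1≈0 = reduced (trans (reciprocal-square-+1 x y xy) (trans (*-congˡ a+2≈0) (zeroʳ x)))

    private
      square : ∀ z j → z ^ (2 ℕ.^ suc j) ≈ z ^ (2 ℕ.^ j) * z ^ (2 ℕ.^ j)
      square z j = trans (^-congʳ z (≡.cong (2 ℕ.^ j ℕ.+_) (ℕP.+-identityʳ (2 ℕ.^ j)))) (^-homo-* z (2 ℕ.^ j) (2 ℕ.^ j))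

      minus-one : ∀ u v → u * v ≈ 1# → u + v ≈ 0# → u * u ≈ ε
      minus-one u v uv e = trans (reciprocal-square u v uv) (trans (+-congʳ (trans (*-congˡ e) (zeroʳ u))) (+-identityˡ ε))

    -- a² = 0 gives a = 0, hence x² = -1: the value -1 is reached one squaring after stage k.
    converse-ii : T h k ≡ᵖ + 0 → N h k ≡ᵖ + 0 → 2 ℕ.^ suc (suc k) ℕD.∣ (p ℕ.^ 4 ℕ.∸ 1)
    converse-ii et en = order (suc k) β β̄ β-unit (trans (square β k) (minus-one x y xy a≈0))
      where
      a≈0 : a ≈ 0#
      a≈0 = reduced (trans (quadratic (+ 0) (+ 0) et en) (trans (+-cong (zeroˡ a) (sym (emb-neg (+ 0)))) (+-identityˡ 0#)))

    -- a² = 2, so the next orbit value a² - 2 is 0 and -1 is reached two squarings after stage k.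
    converse-iii : T h k ≡ᵖ + 0 → N h k ≡ᵖ -[1+ 1 ] → 2 ℕ.^ suc (suc (suc k)) ℕD.∣ (p ℕ.^ 4 ℕ.∸ 1)
    converse-iii et en = order (suc (suc k)) β β̄ β-unit
      (trans (square β (suc k)) (minus-one (β ^ (2 ℕ.^ suc k)) (β̄ ^ (2 ℕ.^ suc k)) (ββ̄ (2 ℕ.^ suc k)) next≈0))
      where
      a²≈2 : a * a ≈ emb (+ 2)
      a²≈2 = trans (quadratic (+ 0) -[1+ 1 ] et en) (trans (+-cong (zeroˡ a) (sym (emb-neg -[1+ 1 ]))) (+-identityˡ (emb (+ 2))))
      next≈0 : θᴿ (suc k) ≈ 0#
      next≈0 = trans (orbit-suc k) (x≈y⇒x∙y⁻¹≈ε a²≈2)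

  module Converse₂ (h k : ℕ) where
    open Orbit A₂ normOne-A₂ h renaming (orbit to ηᴿ)
    open XYZW-values h

    -- All four conjugates are roots of (X + 2)⁴, so a = -2 after using reducedness twice, and then
    -- x = -1 as for the quadratic polynomial.
    converse-iv : X h k ≡ᵖ -[1+ 7 ] → Y h k ≡ᵖ + 24 → Z h k ≡ᵖ -[1+ 31 ] → W h k ≡ᵖ + 16 → 2 ℕ.^ suc k ℕD.∣ (p ℕ.^ 4 ℕ.∸ 1)
    converse-iv ex ey ez ew = order k β β̄ (trans (*-cong (sym (^-one β)) (sym (^-one β̄))) (ββ̄ 1))
      (x∙y⁻¹≈ε⇒x≈y x ε (trans (+-congˡ (sym (emb-neg -[1+ 0 ]))) x+1≈0))
      where
      x y a b c d : Carrier
      x = β ^ (2 ℕ.^ k)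
      y = β̄ ^ (2 ℕ.^ k)
      a = ηᴿ k
      b = σᴿ 1F a
      c = σᴿ 2F a
      d = σᴿ 3F a
      v = XYZW-value k
      quartic : (a * a) * (a * a) ≈ emb -[1+ 7 ] * (a * (a * a)) - emb (+ 24) * (a * a) + emb -[1+ 31 ] * a - emb (+ 16)
      quartic = trans (quartic-root a b c d) (+-cong (+-cong (+-cong
        (*-congʳ (value⇒≈ -[1+ 7 ] (proj₁ v) ex)) (-‿cong (*-congʳ (value⇒≈ (+ 24) (proj₁ (proj₂ v)) ey))))
        (*-congʳ (value⇒≈ -[1+ 31 ] (proj₁ (proj₂ (proj₂ v))) ez))) (-‿cong (value⇒≈ (+ 16) (proj₂ (proj₂ (proj₂ v))) ew)))
      a+2≈0 : a + emb (+ 2) ≈ 0#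
      a+2≈0 = reduced (reduced (trans (fourth-+2 a) (x≈y⇒x∙y⁻¹≈ε quartic)))
      x+1≈0 : x + 1# ≈ 0#
      x+1≈0 = reduced (trans (reciprocal-square-+1 x y (ββ̄ (2 ℕ.^ k))) (trans (*-congˡ a+2≈0) (zeroʳ x)))

-- Congruences that hold when M is prime

module PrimeModulus (p : ℕ) (pp : Prime p) (i₁₇ : ℤ) (inverts₁₇ : (+ 17 ℤ.* i₁₇) ≡ₘ + 1 [ p ])
                    (i₂ : ℤ) (inverts₂ : (+ 2 ℤ.* i₂) ≡ₘ + 1 [ p ]) (odd : ∃ λ m → p ≡ suc (2 ℕ.* m)) where
  open Cyclotomic p
  open GaloisAction p
  open CommutativeRing R
  open PowerLemmas R
  open Alpha p pp i₁₇ inverts₁₇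
  open Sequences p pp i₁₇ inverts₁₇ i₂ inverts₂
  open PrimeDivisor p pp i₁₇ inverts₁₇ i₂ inverts₂ odd using (_≡ᵖ_; ≈⇒≡ᵖ)
  open IntegerPolynomials embedding using (e₁; e₂; e₃; e₄)
  open Reciprocity p pp i₁₇ inverts₁₇

  -- The values that T and N take when the power of α₁ is ζʲ with j even: trace and norm from K₁ of
  -- ζʲ + ζ⁻ʲ.
  TN-residues : ℕ → ℤ → ℤ → Set
  TN-residues j t n = let ρ = root j + conjᴿ (root j) in (ρ + σᴿ 1F ρ ≈ emb t) ∧ (ρ * σᴿ 1F ρ ≈ emb n)

  opaque
    unfolding Quadratic._+₂_ σᴿ

    residues-2 : TN-residues 2 (+ 0) -[1+ 1 ]
    residues-2 = refl , refl
    residues-4 : TN-residues 4 (+ 0) (+ 0)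
    residues-4 = refl , refl
    residues-6 : TN-residues 6 (+ 0) -[1+ 1 ]
    residues-6 = refl , refl
    residues-8 : TN-residues 8 -[1+ 3 ] (+ 4)
    residues-8 = refl , refl
    residues-10 : TN-residues 10 (+ 0) -[1+ 1 ]
    residues-10 = refl , refl
    residues-12 : TN-residues 12 (+ 0) (+ 0)
    residues-12 = refl , refl
    residues-14 : TN-residues 14 (+ 0) -[1+ 1 ]
    residues-14 = refl , refl

    private
      -2+ : emb -[1+ 0 ] + emb -[1+ 0 ] ≈ emb -[1+ 1 ]
      -2+ = refl
      symmetric-e₁ : let z = emb -[1+ 1 ] in e₁ z z z z ≈ emb -[1+ 7 ]
      symmetric-e₁ = refl
      symmetric-e₂ : let z = emb -[1+ 1 ] in e₂ z z z z ≈ emb (+ 24)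
      symmetric-e₂ = refl
      symmetric-e₃ : let z = emb -[1+ 1 ] in e₃ z z z z ≈ emb -[1+ 31 ]
      symmetric-e₃ = refl
      symmetric-e₄ : let z = emb -[1+ 1 ] in e₄ z z z z ≈ emb (+ 16)
      symmetric-e₄ = refl

  module _ (h k : ℕ) where
    private
      orbit≈ : ∀ A γ → A ^ (h ℕ.* 2 ℕ.^ k) ≈ γ → (A ^ h) ^ (2 ℕ.^ k) + (conjᴿ A ^ h) ^ (2 ℕ.^ k) ≈ γ + conjᴿ γ
      orbit≈ A γ e = +-cong (trans (^-assocʳ A h (2 ℕ.^ k)) e)
        (trans (^-assocʳ (conjᴿ A) h (2 ℕ.^ k)) (trans (sym (σ-^ 7F A (h ℕ.* 2 ℕ.^ k))) (σ-cong 7F e)))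

    TN-congruences : ∀ {j t n} → A₁ ^ (h ℕ.* 2 ℕ.^ k) ≈ root j → TN-residues j t n → (T h k ≡ᵖ t) ∧ (N h k ≡ᵖ n)
    TN-congruences {j} {t} {n} e (et , en) =
      ≈⇒≡ᵖ t (proj₁ (TN-value k)) (trans (+-cong θ≈ (σ-cong 1F θ≈)) et) ,
      ≈⇒≡ᵖ n (proj₂ (TN-value k)) (trans (*-cong θ≈ (σ-cong 1F θ≈)) en)
      where
      open TN-values h
      θ≈ = orbit≈ A₁ (root j) e

    XYZW-congruences : A₂ ^ (h ℕ.* 2 ℕ.^ k) ≈ emb -[1+ 0 ] →
      (X h k ≡ᵖ -[1+ 7 ]) ∧ (Y h k ≡ᵖ + 24) ∧ (Z h k ≡ᵖ -[1+ 31 ]) ∧ (W h k ≡ᵖ + 16)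
    XYZW-congruences e =
      ≈⇒≡ᵖ -[1+ 7 ] (proj₁ v) (trans (+-cong (+-cong (+-cong η≈ (s 1F)) (s 2F)) (s 3F)) symmetric-e₁) ,
      ≈⇒≡ᵖ (+ 24) (proj₁ (proj₂ v)) (trans (+-cong (+-cong (+-cong (+-cong (*-cong η≈ (s 1F)) (*-cong η≈ (s 2F))) (*-cong η≈ (s 3F)))
        (*-cong (s 1F) (s 2F))) (+-cong (*-cong (s 1F) (s 3F)) (*-cong (s 2F) (s 3F)))) symmetric-e₂) ,
      ≈⇒≡ᵖ -[1+ 31 ] (proj₁ (proj₂ (proj₂ v))) (trans (+-cong (+-cong (*-cong (*-cong η≈ (s 1F)) (s 2F)) (*-cong (*-cong η≈ (s 1F)) (s 3F)))
        (+-cong (*-cong (*-cong η≈ (s 2F)) (s 3F)) (*-cong (*-cong (s 1F) (s 2F)) (s 3F)))) symmetric-e₃) ,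
      ≈⇒≡ᵖ (+ 16) (proj₂ (proj₂ (proj₂ v))) (trans (*-cong (*-cong (*-cong η≈ (s 1F)) (s 2F)) (s 3F)) symmetric-e₄)
      where
      open XYZW-values h
      v = XYZW-value k
      η≈ = trans (orbit≈ A₂ (emb -[1+ 0 ]) e) (trans (+-congˡ (σ-emb 7F -[1+ 0 ])) -2+)
      s : ∀ j → σᴿ j ((A₂ ^ h) ^ (2 ℕ.^ k) + (conjᴿ A₂ ^ h) ^ (2 ℕ.^ k)) ≈ emb -[1+ 1 ]
      s j = trans (σ-cong j η≈) (σ-emb j -[1+ 1 ])

-- Fourth roots of unity modulo powers of 2

prime-divisor : ∀ d → 1 ℕ.< d → ∃ λ q → Prime q ∧ q ℕD.∣ d
prime-divisor d 1<d with factorise d {{ℕ.>-nonZero (ℕP.<-trans (s≤s z≤n) 1<d)}}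
... | record { factors = [] ; isFactorisation = e } = contradiction e (ℕP.>⇒≢ 1<d)
... | record { factors = q ∷ qs ; isFactorisation = e ; factorsPrime = pq ∷ _ } = q , pq , ℕD.divides (product qs) (≡.trans e (ℕP.*-comm q (product qs)))

opaque
  prime-17 : Prime 17
  prime-17 = from-yes (prime? 17)

inverse-of-17 : ∀ p → Prime p → ¬ 17 ℕD.∣ p → ∃ λ i → (+ 17 ℤ.* i) ≡ₘ + 1 [ p ]
inverse-of-17 p pp 17∤p with Coprimality.coprime-Bézout coprime
  where
  coprime : Coprimality.Coprime 17 p
  coprime {d} (d∣17 , d∣p) with prime⇒irreducible prime-17 d∣17
  ... | inj₁ d≡1 = d≡1
  ... | inj₂ ≡.refl = contradiction d∣p 17∤p
... | Bézout.+- x y e = + x , mod (ℤD.divides (+ y) (begin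
    + 17 ℤ.* + x ℤ.- + 1           ≡⟨ ≡.cong (ℤ._- + 1) (≡.trans (≡.sym (ℤP.pos-* 17 x)) (≡.cong +_ (≡.trans (ℕP.*-comm 17 x) (≡.sym e)))) ⟩
    + (1 ℕ.+ y ℕ.* p) ℤ.- + 1      ≡⟨⟩
    (+ 1 ℤ.+ + (y ℕ.* p)) ℤ.- + 1  ≡⟨ solve 1 (λ a → (con (+ 1) :+ a) :- con (+ 1) := a) ≡.refl (+ (y ℕ.* p)) ⟩
    + (y ℕ.* p)                    ≡⟨ ℤP.pos-* y p ⟩
    + y ℤ.* + p                    ∎))
  where
  open ≡.≡-Reasoning
  open ℤSolver.+-*-Solver
... | Bézout.-+ x y e = ℤ.- + x , mod (ℤD.divides (ℤ.- + y) (begin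
    + 17 ℤ.* (ℤ.- + x) ℤ.- + 1     ≡⟨ solve 1 (λ x → con (+ 17) :* (:- x) :- con (+ 1) := :- (con (+ 1) :+ x :* con (+ 17))) ≡.refl (+ x) ⟩
    ℤ.- (+ 1 ℤ.+ + x ℤ.* + 17)     ≡⟨ ≡.cong (λ z → ℤ.- (+ 1 ℤ.+ z)) (≡.sym (ℤP.pos-* x 17)) ⟩
    ℤ.- + (1 ℕ.+ x ℕ.* 17)         ≡⟨ ≡.cong (λ z → ℤ.- + z) e ⟩
    ℤ.- + (y ℕ.* p)                ≡⟨ ≡.cong ℤ.-_ (ℤP.pos-* y p) ⟩
    ℤ.- (+ y ℤ.* + p)              ≡⟨ ℤP.neg-distribˡ-* (+ y) (+ p) ⟩
    (ℤ.- + y) ℤ.* + p              ∎))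
  where
  open ≡.≡-Reasoning
  open ℤSolver.+-*-Solver

inverse-of-2 : ∀ p m → p ≡ suc (2 ℕ.* m) → (+ 2 ℤ.* + suc m) ≡ₘ + 1 [ p ]
inverse-of-2 p m ≡.refl = mod (ℤD.divides (+ 1) (begin
    + 2 ℤ.* (+ 1 ℤ.+ + m) ℤ.- + 1  ≡⟨ solve 1 (λ m → con (+ 2) :* (con (+ 1) :+ m) :- con (+ 1) := con (+ 1) :* (con (+ 1) :+ con (+ 2) :* m)) ≡.refl (+ m) ⟩
    + 1 ℤ.* (+ 1 ℤ.+ + 2 ℤ.* + m)  ≡⟨ ≡.cong (λ z → + 1 ℤ.* (+ 1 ℤ.+ z)) (≡.sym (ℤP.pos-* 2 m)) ⟩
    + 1 ℤ.* + suc (2 ℕ.* m)        ∎))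
  where
  open ≡.≡-Reasoning
  open ℤSolver.+-*-Solver

odd⇒2∤ : ∀ m → ¬ 2 ℕD.∣ suc (2 ℕ.* m)
odd⇒2∤ m d = contradiction (ℕD.∣1⇒≡1 (ℕD.∣m+n∣m⇒∣n (≡.subst (2 ℕD.∣_) (ℕP.+-comm 1 (2 ℕ.* m)) d) (ℕD.m∣m*n m))) (λ ())

odd-cancel : ∀ k x m → 2 ℕ.^ k ℕD.∣ x ℕ.* suc (2 ℕ.* m) → 2 ℕ.^ k ℕD.∣ x
odd-cancel zero x m _ = ℕD.1∣ x
odd-cancel (suc k) x m d with euclidsLemma x (suc (2 ℕ.* m)) prime[2] (ℕD.∣-trans (ℕD.m∣m*n (2 ℕ.^ k)) d)
... | inj₂ 2∣odd = contradiction 2∣odd (odd⇒2∤ m)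
... | inj₁ (ℕD.divides y ≡.refl) = ≡.subst (2 ℕ.* 2 ℕ.^ k ℕD.∣_) (ℕP.*-comm 2 y) (ℕD.*-monoʳ-∣ 2
    (odd-cancel k y m (ℕD.*-cancelˡ-∣ 2 (≡.subst (2 ℕ.* 2 ℕ.^ k ℕD.∣_) rearrange d))))
  where
  rearrange : y ℕ.* 2 ℕ.* suc (2 ℕ.* m) ≡ 2 ℕ.* (y ℕ.* suc (2 ℕ.* m))
  rearrange = ≡.trans (≡.cong (ℕ._* suc (2 ℕ.* m)) (ℕP.*-comm y 2)) (ℕP.*-assoc 2 y (suc (2 ℕ.* m)))

-- q⁴ − 1 = (q² − 1)(q² + 1), where q² − 1 = 4a(a+1) for q = 2a + 1 and q² + 1 is twice an odd number.
2^∣consecutive : ∀ c a → 2 ℕ.^ (4 ℕ.+ c) ℕD.∣ (suc (2 ℕ.* a) ℕ.^ 4 ℕ.∸ 1) → 2 ℕ.^ suc c ℕD.∣ a ℕ.* suc a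
2^∣consecutive c a d = odd-cancel (suc c) (a ℕ.* suc a) (a ℕ.* suc a)
  (ℕD.*-cancelˡ-∣ 8 (≡.subst₂ ℕD._∣_ (power c) (≡.cong (ℕ._∸ 1) (fourth a)) d))
  where
  open +-*-Solver
  power : ∀ c → 2 ℕ.^ (4 ℕ.+ c) ≡ 8 ℕ.* 2 ℕ.^ suc c
  power c = solve 1 (λ x → con 2 :* (con 2 :* (con 2 :* (con 2 :* x))) := con 8 :* (con 2 :* x)) ≡.refl (2 ℕ.^ c)
  fourth : ∀ a → suc (2 ℕ.* a) ℕ.^ 4 ≡ suc (8 ℕ.* (a ℕ.* suc a ℕ.* suc (2 ℕ.* (a ℕ.* suc a))))
  fourth = solve 1 (λ a → let q = con 1 :+ con 2 :* a; b = a :* (con 1 :+ a) in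
    q :* (q :* (q :* (q :* con 1))) := con 1 :+ con 8 :* (b :* (con 1 :+ con 2 :* b))) ≡.refl

-- One of a and a + 1 is odd, so 2^(c+1) divides the other one, and q = 2a + 1 is 1 or -1 modulo
-- 2^(c+2).
near-±1 : ∀ c a → 2 ℕ.^ (4 ℕ.+ c) ℕD.∣ (suc (2 ℕ.* a) ℕ.^ 4 ℕ.∸ 1) →
  (∃ λ z → suc (2 ℕ.* a) ≡ suc (z ℕ.* (4 ℕ.* 2 ℕ.^ c))) ⊎ (∃ λ z → suc (suc (2 ℕ.* a)) ≡ z ℕ.* (4 ℕ.* 2 ℕ.^ c))
near-±1 c a d = Sum.map even odd (parity a)
  where
  open +-*-Solver
  quadruple : ∀ x z → x ≡ z ℕ.* 2 ℕ.^ suc c → 2 ℕ.* x ≡ z ℕ.* (4 ℕ.* 2 ℕ.^ c)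
  quadruple x z e = ≡.trans (≡.cong (2 ℕ.*_) e) (solve 2 (λ z y → con 2 :* (z :* (con 2 :* y)) := z :* (con 4 :* y)) ≡.refl z (2 ℕ.^ c))
  even : (∃ λ b → a ≡ 2 ℕ.* b) → ∃ λ z → suc (2 ℕ.* a) ≡ suc (z ℕ.* (4 ℕ.* 2 ℕ.^ c))
  even (b , e) = ℕD.quotient 2^∣a , ≡.cong suc (quadruple a (ℕD.quotient 2^∣a) (ℕD._∣_.equality 2^∣a))
    where
    2^∣a : 2 ℕ.^ suc c ℕD.∣ a
    2^∣a = odd-cancel (suc c) a b (≡.subst (λ z → 2 ℕ.^ suc c ℕD.∣ a ℕ.* suc z) e (2^∣consecutive c a d))
  odd : (∃ λ b → a ≡ suc (2 ℕ.* b)) → ∃ λ z → suc (suc (2 ℕ.* a)) ≡ z ℕ.* (4 ℕ.* 2 ℕ.^ c)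
  odd (b , e) = ℕD.quotient 2^∣a+1 , ≡.trans (solve 1 (λ a → con 1 :+ (con 1 :+ con 2 :* a) := con 2 :* (con 1 :+ a)) ≡.refl a)
                   (quadruple (suc a) (ℕD.quotient 2^∣a+1) (ℕD._∣_.equality 2^∣a+1))
    where
    2^∣a+1 : 2 ℕ.^ suc c ℕD.∣ suc a
    2^∣a+1 = odd-cancel (suc c) (suc a) b (≡.subst (2 ℕ.^ suc c ℕD.∣_)
      (≡.trans (ℕP.*-comm a (suc a)) (≡.cong (suc a ℕ.*_) e)) (2^∣consecutive c a d))

-- With x = 2^c, (1 + 4xu)² = 1 + 4(2x)(u + 2xu²), where the last factor is again odd. This oddness
-- later makes j ↦ j u a permutation modulo 4.
5^2^ : ∀ c → ∃ λ v → 5 ℕ.^ (2 ℕ.^ c) ≡ 1 ℕ.+ 4 ℕ.* 2 ℕ.^ c ℕ.* suc (2 ℕ.* v)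
5^2^ zero = 0 , ≡.refl
5^2^ (suc c) with 5^2^ c
... | v , e = v ℕ.+ 2 ℕ.^ c ℕ.* u ℕ.* u , (begin
    5 ℕ.^ (2 ℕ.* 2 ℕ.^ c)                    ≡⟨ ≡.cong (5 ℕ.^_) (ℕP.*-comm 2 (2 ℕ.^ c)) ⟩
    5 ℕ.^ (2 ℕ.^ c ℕ.* 2)                    ≡⟨ ℕP.^-*-assoc 5 (2 ℕ.^ c) 2 ⟨
    (5 ℕ.^ (2 ℕ.^ c)) ℕ.^ 2                  ≡⟨ ≡.cong (ℕ._^ 2) e ⟩
    (1 ℕ.+ 4 ℕ.* 2 ℕ.^ c ℕ.* u) ℕ.^ 2        ≡⟨ solve 2 (λ x v → let u = con 1 :+ con 2 :* v; y = con 1 :+ con 4 :* x :* u in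
        y :* (y :* con 1) := con 1 :+ con 4 :* (con 2 :* x) :* (con 1 :+ con 2 :* (v :+ x :* u :* u))) ≡.refl (2 ℕ.^ c) v ⟩
    1 ℕ.+ 4 ℕ.* 2 ℕ.^ suc c ℕ.* suc (2 ℕ.* (v ℕ.+ 2 ℕ.^ c ℕ.* u ℕ.* u)) ∎)
  where
  open ≡.≡-Reasoning
  open +-*-Solver
  u = suc (2 ℕ.* v)

module _ where
  open ℤSolver.+-*-Solver

  private
    mod4 : ∀ z → ∃ λ a → (z ≡ + 4 ℤ.* a) ⊎ (z ≡ + 4 ℤ.* a ℤ.+ + 1) ⊎ (z ≡ + 4 ℤ.* a ℤ.+ + 2) ⊎ (z ≡ + 4 ℤ.* a ℤ.+ + 3)
    mod4 z with z ℤM.%ℕ 4 | ℤM.n%ℕd<d z 4 | ℤM.a≡a%ℕn+[a/ℕn]*n z 4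
    ... | 0 | _ | e = z ℤM./ℕ 4 , inj₁ (≡.trans e (≡.trans (ℤP.+-identityˡ _) (ℤP.*-comm (z ℤM./ℕ 4) (+ 4))))
    ... | 1 | _ | e = z ℤM./ℕ 4 , inj₂ (inj₁ (≡.trans e (solve 1 (λ a → con (+ 1) :+ a :* con (+ 4) := con (+ 4) :* a :+ con (+ 1)) ≡.refl (z ℤM./ℕ 4))))
    ... | 2 | _ | e = z ℤM./ℕ 4 , inj₂ (inj₂ (inj₁ (≡.trans e (solve 1 (λ a → con (+ 2) :+ a :* con (+ 4) := con (+ 4) :* a :+ con (+ 2)) ≡.refl (z ℤM./ℕ 4)))))
    ... | 3 | _ | e = z ℤM./ℕ 4 , inj₂ (inj₂ (inj₂ (≡.trans e (solve 1 (λ a → con (+ 3) :+ a :* con (+ 4) := con (+ 4) :* a :+ con (+ 3)) ≡.refl (z ℤM./ℕ 4)))))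
    ... | suc (suc (suc (suc _))) | s≤s (s≤s (s≤s (s≤s ()))) | _

  private
    pow1 pow2 pow3 : ∀ {n} → Polynomial n → Polynomial n
    pow1 b = b :* con (+ 1)
    pow2 b = b :* (b :* con (+ 1))
    pow3 b = b :* (b :* (b :* con (+ 1)))

    base : ∀ {n} → Polynomial n → Polynomial n → Polynomial n
    base t u = con (+ 1) :+ con (+ 4) :* t :* u

    diff : ∀ {n} → Polynomial n → Polynomial n → Polynomial n → Polynomial n
    diff t z b = (con (+ 1) :+ con (+ 4) :* t :* z) :- b

    modulus : ∀ {n} → Polynomial n → Polynomial n
    modulus t = con (+ 4) :* (con (+ 4) :* t)

  -- With P = 4t one has (1 + Pu)ʲ ≡ 1 + P j u modulo 4P, and j ↦ j u permutes the residues modulo 4.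
  power-hits : ∀ t u w → u ≡ + 4 ℤ.* w ℤ.+ + 1 ⊎ u ≡ + 4 ℤ.* w ℤ.+ + 3 → ∀ z → ∃ λ (j : Fin 4) →
               (+ 4 ℤ.* (+ 4 ℤ.* t)) ℤD.∣ ((+ 1 ℤ.+ + 4 ℤ.* t ℤ.* z) ℤ.- (+ 1 ℤ.+ + 4 ℤ.* t ℤ.* u) ℤ.^ toℕ j)
  power-hits t u w u≡ z with mod4 z | u≡
  ... | a , inj₁ ≡.refl | _ = 0F , ℤD.divides a
    (solve 2 (λ t a → diff t (con (+ 4) :* a) (con (+ 1)) := a :* modulus t) ≡.refl t a)
  -- In each case j is chosen with j u ≡ z mod 4. The quotient is (z - j u)/4 minus the higher
  -- binomial terms of (1 + 4tu)ʲ divided by 16t.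
  ... | a , inj₂ (inj₁ ≡.refl) | inj₁ ≡.refl = 1F , ℤD.divides (a ℤ.- w)
    (solve 3 (λ t a w → diff t (con (+ 4) :* a :+ con (+ 1)) (pow1 (base t (con (+ 4) :* w :+ con (+ 1)))) := (a :- w) :* modulus t) ≡.refl t a w)
  ... | a , inj₂ (inj₂ (inj₁ ≡.refl)) | inj₁ ≡.refl = 2F , ℤD.divides (a ℤ.- + 2 ℤ.* w ℤ.- t ℤ.* (u ℤ.* u))
    (solve 3 (λ t a w → let u = con (+ 4) :* w :+ con (+ 1) in
      diff t (con (+ 4) :* a :+ con (+ 2)) (pow2 (base t u)) := (a :- con (+ 2) :* w :- t :* (u :* u)) :* modulus t) ≡.refl t a w)
  ... | a , inj₂ (inj₂ (inj₂ ≡.refl)) | inj₁ ≡.refl = 3F , ℤD.divides (a ℤ.- + 3 ℤ.* w ℤ.- + 3 ℤ.* t ℤ.* (u ℤ.* u) ℤ.- + 4 ℤ.* t ℤ.* t ℤ.* (u ℤ.* u ℤ.* u))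
    (solve 3 (λ t a w → let u = con (+ 4) :* w :+ con (+ 1) in
      diff t (con (+ 4) :* a :+ con (+ 3)) (pow3 (base t u)) :=
      (a :- con (+ 3) :* w :- con (+ 3) :* t :* (u :* u) :- con (+ 4) :* t :* t :* (u :* u :* u)) :* modulus t) ≡.refl t a w)
  ... | a , inj₂ (inj₁ ≡.refl) | inj₂ ≡.refl = 3F , ℤD.divides (a ℤ.- + 3 ℤ.* w ℤ.- + 2 ℤ.- + 3 ℤ.* t ℤ.* (u ℤ.* u) ℤ.- + 4 ℤ.* t ℤ.* t ℤ.* (u ℤ.* u ℤ.* u))
    (solve 3 (λ t a w → let u = con (+ 4) :* w :+ con (+ 3) in
      diff t (con (+ 4) :* a :+ con (+ 1)) (pow3 (base t u)) :=
      (a :- con (+ 3) :* w :- con (+ 2) :- con (+ 3) :* t :* (u :* u) :- con (+ 4) :* t :* t :* (u :* u :* u)) :* modulus t) ≡.refl t a w)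
  ... | a , inj₂ (inj₂ (inj₁ ≡.refl)) | inj₂ ≡.refl = 2F , ℤD.divides (a ℤ.- + 2 ℤ.* w ℤ.- + 1 ℤ.- t ℤ.* (u ℤ.* u))
    (solve 3 (λ t a w → let u = con (+ 4) :* w :+ con (+ 3) in
      diff t (con (+ 4) :* a :+ con (+ 2)) (pow2 (base t u)) := (a :- con (+ 2) :* w :- con (+ 1) :- t :* (u :* u)) :* modulus t) ≡.refl t a w)
  ... | a , inj₂ (inj₂ (inj₂ ≡.refl)) | inj₂ ≡.refl = 1F , ℤD.divides (a ℤ.- w)
    (solve 3 (λ t a w → diff t (con (+ 4) :* a :+ con (+ 3)) (pow1 (base t (con (+ 4) :* w :+ con (+ 3)))) := (a :- w) :* modulus t) ≡.refl t a w)

  private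
    pos-^ : ∀ x n → + (x ℕ.^ n) ≡ (+ x) ℤ.^ n
    pos-^ x zero = ≡.refl
    pos-^ x (suc n) = ≡.trans (ℤP.pos-* x (x ℕ.^ n)) (≡.cong (+ x ℤ.*_) (pos-^ x n))

    odd-mod4 : ∀ v → ∃ λ w → + suc (2 ℕ.* v) ≡ + 4 ℤ.* w ℤ.+ + 1 ⊎ + suc (2 ℕ.* v) ≡ + 4 ℤ.* w ℤ.+ + 3
    odd-mod4 v with parity v
    ... | inj₁ (w , ≡.refl) = + w , inj₁ (≡.trans (≡.cong +_ (ℕP.+-comm 1 (2 ℕ.* (2 ℕ.* w))))
        (≡.cong (ℤ._+ + 1) (≡.trans (≡.cong +_ (≡.sym (ℕP.*-assoc 2 2 w))) (ℤP.pos-* 4 w))))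
    ... | inj₂ (w , ≡.refl) = + w , inj₂ (≡.trans (≡.cong +_ (ℕS.solve 1 (λ w → ℕS.con 1 ℕS.:+ ℕS.con 2 ℕS.:* (ℕS.con 1 ℕS.:+ ℕS.con 2 ℕS.:* w) ℕS.:=
          ℕS.con 4 ℕS.:* w ℕS.:+ ℕS.con 3) ≡.refl w)) (≡.cong (ℤ._+ + 3) (ℤP.pos-* 4 w)))
      where
      module ℕS = +-*-Solver

  -- Modulo 2^(c+2) only ±1 are possible; the powers of 5^(2^c) run through the four lifts of 1
  -- modulo 2^(c+4), and their negatives through those of -1.
  fourth-roots : ∀ c q a → q ≡ suc (2 ℕ.* a) → 2 ℕ.^ (4 ℕ.+ c) ℕD.∣ (q ℕ.^ 4 ℕ.∸ 1) → ∃ λ (j : Fin 4) →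
    (+ q ≡ℤ + (5 ℕ.^ (toℕ j ℕ.* 2 ℕ.^ c)) [mod 2 ℕ.^ (4 ℕ.+ c) ]) ⊎ (+ q ≡ℤ ℤ.- + (5 ℕ.^ (toℕ j ℕ.* 2 ℕ.^ c)) [mod 2 ℕ.^ (4 ℕ.+ c) ])
  fourth-roots c q a q≡ d = Sum.[ plus , minus ]′ (near-±1 c a (≡.subst (λ q → 2 ℕ.^ (4 ℕ.+ c) ℕD.∣ (q ℕ.^ 4 ℕ.∸ 1)) q≡ d))
    where
    open ≡.≡-Reasoning
    t : ℤ
    t = + (2 ℕ.^ c)
    v = proj₁ (5^2^ c)
    u : ℤ
    u = + suc (2 ℕ.* v)
    hits = power-hits t u (proj₁ (odd-mod4 v)) (proj₂ (odd-mod4 v))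
    quadruple : ∀ x → + (4 ℕ.* 2 ℕ.^ c ℕ.* x) ≡ + 4 ℤ.* t ℤ.* + x
    quadruple x = ≡.trans (ℤP.pos-* (4 ℕ.* 2 ℕ.^ c) x) (≡.cong (ℤ._* + x) (ℤP.pos-* 4 (2 ℕ.^ c)))
    power : ∀ (j : Fin 4) → + (5 ℕ.^ (toℕ j ℕ.* 2 ℕ.^ c)) ≡ (+ 1 ℤ.+ + 4 ℤ.* t ℤ.* u) ℤ.^ toℕ j
    power j = begin
      + (5 ℕ.^ (toℕ j ℕ.* 2 ℕ.^ c))          ≡⟨ ≡.cong (λ e → + (5 ℕ.^ e)) (ℕP.*-comm (toℕ j) (2 ℕ.^ c)) ⟩
      + (5 ℕ.^ (2 ℕ.^ c ℕ.* toℕ j))          ≡⟨ ≡.cong +_ (≡.sym (ℕP.^-*-assoc 5 (2 ℕ.^ c) (toℕ j))) ⟩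
      + ((5 ℕ.^ (2 ℕ.^ c)) ℕ.^ toℕ j)        ≡⟨ pos-^ (5 ℕ.^ (2 ℕ.^ c)) (toℕ j) ⟩
      (+ (5 ℕ.^ (2 ℕ.^ c))) ℤ.^ toℕ j        ≡⟨ ≡.cong (ℤ._^ toℕ j) (≡.trans (≡.cong +_ (proj₂ (5^2^ c))) (≡.cong (λ z → + 1 ℤ.+ z) (quadruple (suc (2 ℕ.* v))))) ⟩
      (+ 1 ℤ.+ + 4 ℤ.* t ℤ.* u) ℤ.^ toℕ j    ∎
    modulus≡ : + (2 ℕ.^ (4 ℕ.+ c)) ≡ + 4 ℤ.* (+ 4 ℤ.* t)
    modulus≡ = begin
      + (2 ℕ.* (2 ℕ.* (2 ℕ.* (2 ℕ.* 2 ℕ.^ c))))  ≡⟨ ≡.cong +_ (ℕS.solve 1 (λ x → ℕS.con 2 ℕS.:* (ℕS.con 2 ℕS.:* (ℕS.con 2 ℕS.:* (ℕS.con 2 ℕS.:* x)))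
                                                     ℕS.:= ℕS.con 4 ℕS.:* (ℕS.con 4 ℕS.:* x)) ≡.refl (2 ℕ.^ c)) ⟩
      + (4 ℕ.* (4 ℕ.* 2 ℕ.^ c))                  ≡⟨ ≡.trans (ℤP.pos-* 4 (4 ℕ.* 2 ℕ.^ c)) (≡.cong (+ 4 ℤ.*_) (ℤP.pos-* 4 (2 ℕ.^ c))) ⟩
      + 4 ℤ.* (+ 4 ℤ.* t)                        ∎
      where
      module ℕS = +-*-Solver
    to-unsigned : ∀ {x y} → x ≡ y → (+ 4 ℤ.* (+ 4 ℤ.* t)) ℤD.∣ y → (+ (2 ℕ.^ (4 ℕ.+ c))) ℤU.∣ x
    to-unsigned e f = ℤD.∣⇒∣ᵤ (≡.subst₂ ℤD._∣_ (≡.sym modulus≡) (≡.sym e) f)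
    plus : (∃ λ z → suc (2 ℕ.* a) ≡ suc (z ℕ.* (4 ℕ.* 2 ℕ.^ c))) → _
    plus (z , e) = proj₁ (hits (+ z)) , inj₁ (to-unsigned (≡.cong₂ ℤ._-_ q-value (power (proj₁ (hits (+ z))))) (proj₂ (hits (+ z))))
      where
      q-value : + q ≡ + 1 ℤ.+ + 4 ℤ.* t ℤ.* + z
      q-value = ≡.trans (≡.cong +_ (≡.trans q≡ (≡.trans e (≡.cong suc (ℕP.*-comm z (4 ℕ.* 2 ℕ.^ c)))))) (≡.cong (λ z → + 1 ℤ.+ z) (quadruple z))
    minus : (∃ λ z → suc (suc (2 ℕ.* a)) ≡ z ℕ.* (4 ℕ.* 2 ℕ.^ c)) → _
    -- -q = 1 + 4t(-z), so the exponent j is found for -z and the divisibility negated.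
    minus (z , e) = proj₁ (hits (ℤ.- + z)) , inj₂ (to-unsigned (begin
        + q ℤ.- (ℤ.- + (5 ℕ.^ (toℕ j ℕ.* 2 ℕ.^ c)))   ≡⟨ ≡.cong₂ (λ x y → x ℤ.- (ℤ.- y)) q-value (power j) ⟩
        (+ 4 ℤ.* t ℤ.* + z ℤ.- + 1) ℤ.- (ℤ.- B)        ≡⟨ solve 3 (λ t z B → (con (+ 4) :* t :* z :- con (+ 1)) :- (:- B) := :- ((con (+ 1) :+ con (+ 4) :* t :* (:- z)) :- B)) ≡.refl t (+ z) B ⟩
        ℤ.- ((+ 1 ℤ.+ + 4 ℤ.* t ℤ.* (ℤ.- + z)) ℤ.- B)  ∎) (ℤD.∣m⇒∣-m (proj₂ (hits (ℤ.- + z)))))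
      where
      j = proj₁ (hits (ℤ.- + z))
      B = (+ 1 ℤ.+ + 4 ℤ.* t ℤ.* u) ℤ.^ toℕ j
      q-value : + q ≡ + 4 ℤ.* t ℤ.* + z ℤ.- + 1
      q-value = begin
        + q                            ≡⟨ solve 1 (λ q → q := (con (+ 1) :+ q) :- con (+ 1)) ≡.refl (+ q) ⟩
        + suc q ℤ.- + 1                ≡⟨ ≡.cong (λ x → + x ℤ.- + 1) (≡.trans (≡.cong suc q≡) (≡.trans e (ℕP.*-comm z (4 ℕ.* 2 ℕ.^ c)))) ⟩
        + (4 ℕ.* 2 ℕ.^ c ℕ.* z) ℤ.- + 1 ≡⟨ ≡.cong (ℤ._- + 1) (quadruple z) ⟩
        + 4 ℤ.* t ℤ.* + z ℤ.- + 1      ∎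

-- The criterion

Case-i Case-ii Case-iii Case-iv : ℕ → ℕ → ℕ → Set
Case-i n h M = (Mstar M ≡ℤ + 4 [mod 17 ] ⊎ Mstar M ≡ℤ ℤ.- + 4 [mod 17 ])
  ∧ (T h (n ℕ.∸ 3) ≡ℚ ι (ℤ.- + 4) [mod M ]) ∧ (N h (n ℕ.∸ 3) ≡ℚ ι (+ 4) [mod M ])
Case-ii n h M = ((Mstar M ≡ℤ + 2 [mod 17 ] ⊎ Mstar M ≡ℤ ℤ.- + 2 [mod 17 ]) ⊎ (Mstar M ≡ℤ + 8 [mod 17 ] ⊎ Mstar M ≡ℤ ℤ.- + 8 [mod 17 ]))
  ∧ (T h (n ℕ.∸ 3) ≡ℚ ι (+ 0) [mod M ]) ∧ (N h (n ℕ.∸ 3) ≡ℚ ι (+ 0) [mod M ])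
Case-iii n h M = (((Mstar M ≡ℤ + 3 [mod 17 ] ⊎ Mstar M ≡ℤ ℤ.- + 3 [mod 17 ]) ⊎ (Mstar M ≡ℤ + 5 [mod 17 ] ⊎ Mstar M ≡ℤ ℤ.- + 5 [mod 17 ]))
    ⊎ ((Mstar M ≡ℤ + 6 [mod 17 ] ⊎ Mstar M ≡ℤ ℤ.- + 6 [mod 17 ]) ⊎ (Mstar M ≡ℤ + 7 [mod 17 ] ⊎ Mstar M ≡ℤ ℤ.- + 7 [mod 17 ])))
  ∧ (T h (n ℕ.∸ 3) ≡ℚ ι (+ 0) [mod M ]) ∧ (N h (n ℕ.∸ 3) ≡ℚ ι (ℤ.- + 2) [mod M ])
Case-iv n h M = (Mstar M ≡ℤ ℤ.- + 1 [mod 17 ])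
  ∧ (X h (n ℕ.∸ 4) ≡ℚ ι (ℤ.- + 8) [mod M ]) ∧ (Y h (n ℕ.∸ 4) ≡ℚ ι (+ 24) [mod M ])
  ∧ (Z h (n ℕ.∸ 4) ≡ℚ ι (ℤ.- + 32) [mod M ]) ∧ (W h (n ℕ.∸ 4) ≡ℚ ι (+ 16) [mod M ])

Criterion : ℕ → ℕ → ℕ → Set
Criterion n h M = Case-i n h M ⊎ Case-ii n h M ⊎ Case-iii n h M ⊎ Case-iv n h M

Mstar-plus : ∀ M y → M ≡ suc (y ℕ.* 4) → Mstar M ≡ + M
Mstar-plus M y ≡.refl = ≡.cong (λ z → if z ℕ.≡ᵇ 0 then + M else ℤ.- (+ M)) half
  where
  half : (y ℕ.* 4) ℕM./ 2 ℕM.% 2 ≡ 0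
  half = ≡.trans (≡.cong (ℕM._% 2) (≡.trans (≡.cong (ℕM._/ 2) (≡.sym (ℕP.*-assoc y 2 2))) (ℕM.m*n/n≡m (y ℕ.* 2) 2))) (ℕM.m*n%n≡0 y 2)

Mstar-minus : ∀ M y → M ≡ 3 ℕ.+ y ℕ.* 4 → Mstar M ≡ ℤ.- + M
Mstar-minus M y ≡.refl = ≡.cong (λ z → if z ℕ.≡ᵇ 0 then + M else ℤ.- (+ M)) half
  where
  half : (2 ℕ.+ y ℕ.* 4) ℕM./ 2 ℕM.% 2 ≡ 1
  half = ≡.trans (≡.cong (ℕM._% 2) (≡.trans (≡.cong (λ z → (2 ℕ.+ z) ℕM./ 2) (≡.sym (ℕP.*-assoc y 2 2))) (ℕM.m*n/n≡m (suc (y ℕ.* 2)) 2)))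
    (ℕM.[m+kn]%n≡m%n 1 y 2)

∣Mstar∣ : ∀ M → ℤ.∣ Mstar M ∣ ≡ M
∣Mstar∣ M with ((M ℕ.∸ 1) ℕM./ 2) ℕM.% 2 ℕ.≡ᵇ 0
... | true = ≡.refl
... | false = ℤP.∣-i∣≡∣i∣ (+ M)

17∤2^ : ∀ n → ¬ 17 ℕD.∣ 2 ℕ.^ n
17∤2^ zero d = contradiction (ℕD.∣1⇒≡1 d) (λ ())
17∤2^ (suc n) d = Sum.[ ℕD.>⇒∤ (s≤s (s≤s (s≤s z≤n))) , 17∤2^ n ]′ (euclidsLemma 2 (2 ℕ.^ n) prime-17 d)

-- M divisible by 17 would force 17 ∣ c.
17∤-from-residue : ∀ M c → .{{_ : ℕ.NonZero ℤ.∣ c ∣}} → ℤ.∣ c ∣ ℕ.< 17 → Mstar M ≡ℤ c [mod 17 ] → ¬ 17 ℕD.∣ M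
17∤-from-residue M c c<17 e 17∣M = ℕD.>⇒∤ c<17 (ℤD.∣⇒∣ᵤ {+ 17} {c} (≡.subst ((+ 17) ℤD.∣_) rearrange
    (ℤD.∣m∣n⇒∣m-n (ℤD.∣ᵤ⇒∣ {+ 17} {Mstar M} (≡.subst (17 ℕD.∣_) (≡.sym (∣Mstar∣ M)) 17∣M)) (ℤD.∣ᵤ⇒∣ e))))
  where
  open ℤSolver.+-*-Solver
  rearrange : Mstar M ℤ.- (Mstar M ℤ.- c) ≡ c
  rearrange = solve 2 (λ m c → m :- (m :- c) := c) ≡.refl (Mstar M) c

-- 17 must be invertible modulo every prime divisor of M for α₁ and α₂ to reduce. The criterion
-- itself supplies this, as each case prescribes a nonzero residue of M*.
criterion⇒17∤ : ∀ n h M → Criterion n h M → ¬ 17 ℕD.∣ M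
criterion⇒17∤ n h M = Sum.[ (λ { (c , _) → Sum.[ f (+ 4) , f (ℤ.- + 4) ]′ c })
  , Sum.[ (λ { (c , _) → Sum.[ Sum.[ f (+ 2) , f (ℤ.- + 2) ]′ , Sum.[ f (+ 8) , f (ℤ.- + 8) ]′ ]′ c })
  , Sum.[ (λ { (c , _) → Sum.[ Sum.[ Sum.[ f (+ 3) , f (ℤ.- + 3) ]′ , Sum.[ f (+ 5) , f (ℤ.- + 5) ]′ ]′
                             , Sum.[ Sum.[ f (+ 6) , f (ℤ.- + 6) ]′ , Sum.[ f (+ 7) , f (ℤ.- + 7) ]′ ]′ ]′ c })
  , (λ { (c , _) → f (ℤ.- + 1) c }) ]′ ]′ ]′
  where
  f : ∀ c → {{_ : ℕ.NonZero ℤ.∣ c ∣}} → {c<17 : Bool.T (ℤ.∣ c ∣ ℕ.<ᵇ 17)} → Mstar M ≡ℤ c [mod 17 ] → ¬ 17 ℕD.∣ M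
  f c {c<17 = c<17} = 17∤-from-residue M c (ℕP.<ᵇ⇒< ℤ.∣ c ∣ 17 c<17)

split-power : ∀ h a b → h ℕ.* 2 ℕ.^ (a ℕ.+ b) ≡ h ℕ.* 2 ℕ.^ b ℕ.* 2 ℕ.^ a
split-power h a b = ≡.trans (≡.cong (h ℕ.*_) (≡.trans (ℕP.^-distribˡ-+-* 2 a b) (ℕP.*-comm (2 ℕ.^ a) (2 ℕ.^ b)))) (≡.sym (ℕP.*-assoc h (2 ℕ.^ b) (2 ℕ.^ a)))

module Necessity (c h M : ℕ) (pp : Prime M) (17∤h : ¬ 17 ℕD.∣ h) (17∤M : ¬ 17 ℕD.∣ M) (m : ℕ) (odd : M ≡ suc (2 ℕ.* m)) where
  private
    i₁₇ = inverse-of-17 M pp 17∤M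
  open PrimeModulus M pp (proj₁ i₁₇) (proj₂ i₁₇) (+ suc m) (inverse-of-2 M m odd) (m , odd)
  open Alpha M pp (proj₁ i₁₇) (proj₂ i₁₇) using (A₁; A₂)
  open Reciprocity M pp (proj₁ i₁₇) (proj₂ i₁₇)
  open Cyclotomic M using (R; emb)
  open CommutativeRing R using (_≈_; sym; trans)
  open PowerLemmas R using (_^_; ^-congʳ)

  17∤h2^ : ∀ k → ¬ 17 ℕD.∣ h ℕ.* 2 ℕ.^ k
  17∤h2^ k d = Sum.[ 17∤h , 17∤2^ k ]′ (euclidsLemma h (2 ℕ.^ k) prime-17 d)

  private
    -- With n = 7 + c this is h · 2^(n-3) = (M ∓ 1)/8.
    K = h ℕ.* 2 ℕ.^ (4 ℕ.+ c)

    M≡ : ∀ {r} → M ℕ.% 17 ≡ r → M ≡ r ℕ.+ M ℕ./ 17 ℕ.* 17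
    M≡ e = ≡.trans (ℕM.m≡m%n+[m/n]*n M 17) (≡.cong (ℕ._+ M ℕ./ 17 ℕ.* 17) e)

  congruences : ∀ {j t u} → A₁ ^ K ≈ root j → TN-residues j t u →
    (T h (4 ℕ.+ c) ≡ℚ ι t [mod M ]) ∧ (N h (4 ℕ.+ c) ≡ℚ ι u [mod M ])
  congruences {j} {t} {u} e f = ℤD.∣⇒∣ᵤ (proj₁ v) , ℤD.∣⇒∣ᵤ (proj₂ v)
    where v = TN-congruences h (4 ℕ.+ c) {j} {t} {u} e f

  case-i : _ → ∀ j → TN-residues j -[1+ 3 ] (+ 4) → A₁ ^ K ≈ root j → Criterion (7 ℕ.+ c) h M
  case-i star j f e = inj₁ (star , congruences {j} {ℤ.- + 4} {+ 4} e f)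

  case-ii : _ → ∀ j → TN-residues j (+ 0) (+ 0) → A₁ ^ K ≈ root j → Criterion (7 ℕ.+ c) h M
  case-ii star j f e = inj₂ (inj₁ (star , congruences {j} {+ 0} {+ 0} e f))

  case-iii : _ → ∀ j → TN-residues j (+ 0) -[1+ 1 ] → A₁ ^ K ≈ root j → Criterion (7 ℕ.+ c) h M
  case-iii star j f e = inj₂ (inj₂ (inj₁ (star , congruences {j} {+ 0} {ℤ.- + 2} e f)))

  case-iv′ : Mstar M ≡ℤ ℤ.- + 1 [mod 17 ] → A₂ ^ (h ℕ.* 2 ℕ.^ (3 ℕ.+ c)) ≈ emb -[1+ 0 ] → Criterion (7 ℕ.+ c) h M
  case-iv′ star e = inj₂ (inj₂ (inj₂ (star , ℤD.∣⇒∣ᵤ (proj₁ v) , ℤD.∣⇒∣ᵤ (proj₁ (proj₂ v)) , ℤD.∣⇒∣ᵤ (proj₁ (proj₂ (proj₂ v))) , ℤD.∣⇒∣ᵤ (proj₂ (proj₂ (proj₂ v))))))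
    where v = XYZW-congruences h (3 ℕ.+ c) e

  residue-cases : ((r : Fin 16) → M ℕ.% 17 ≡ suc (toℕ r) → Criterion (7 ℕ.+ c) h M) → Criterion (7 ℕ.+ c) h M
  residue-cases f = go (Fin.fromℕ< (ℕM.m%n<n M 17)) (≡.sym (FinP.toℕ-fromℕ< (ℕM.m%n<n M 17)))
    where
    go : (r : Fin 17) → M ℕ.% 17 ≡ toℕ r → Criterion (7 ℕ.+ c) h M
    go Fin.zero e = contradiction (ℕD.m%n≡0⇒n∣m M 17 e) 17∤M
    go (Fin.suc r) e = f r e

  module Plus (M≡suc : M ≡ suc (h ℕ.* 2 ℕ.^ (7 ℕ.+ c))) where
    private
      s = h ℕ.* 2 ℕ.^ (3 ℕ.+ c)

      Mstar≡ : Mstar M ≡ + M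
      Mstar≡ = Mstar-plus M (h ℕ.* 2 ℕ.^ (5 ℕ.+ c)) (≡.trans M≡suc (≡.cong suc (split-power h 2 (5 ℕ.+ c))))

      M≡s : M ≡ suc (s ℕ.* 16)
      M≡s = ≡.trans M≡suc (≡.cong suc (split-power h 4 (3 ℕ.+ c)))

      star : ∀ {ρ} → M ℕ.% 17 ≡ ρ → ∀ x z → + ρ ℤ.- x ≡ z ℤ.* + 17 → Mstar M ≡ℤ x [mod 17 ]
      star {ρ} e x z f = ℤD.∣⇒∣ᵤ (ℤD.divides (+ (M ℕ./ 17) ℤ.+ z) (begin
        Mstar M ℤ.- x                           ≡⟨ ≡.cong (ℤ._- x) (≡.trans Mstar≡ (≡.cong +_ (M≡ e))) ⟩
        (+ ρ ℤ.+ + (M ℕ./ 17 ℕ.* 17)) ℤ.- x     ≡⟨ ≡.cong (λ y → (+ ρ ℤ.+ y) ℤ.- x) (ℤP.pos-* (M ℕ./ 17) 17) ⟩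
        (+ ρ ℤ.+ + (M ℕ./ 17) ℤ.* + 17) ℤ.- x   ≡⟨ solve 3 (λ r q x → (r :+ q :* con (+ 17)) :- x := q :* con (+ 17) :+ (r :- x)) ≡.refl (+ ρ) (+ (M ℕ./ 17)) x ⟩
        + (M ℕ./ 17) ℤ.* + 17 ℤ.+ (+ ρ ℤ.- x)   ≡⟨ ≡.cong (λ y → + (M ℕ./ 17) ℤ.* + 17 ℤ.+ y) f ⟩
        + (M ℕ./ 17) ℤ.* + 17 ℤ.+ z ℤ.* + 17    ≡⟨ ℤP.*-distribʳ-+ (+ 17) (+ (M ℕ./ 17)) z ⟨
        (+ (M ℕ./ 17) ℤ.+ z) ℤ.* + 17           ∎))
        where
        open ≡.≡-Reasoning
        open ℤSolver.+-*-Solver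

      -- M ≡ 1 mod 17 would make 17 divide h · 2ⁿ.
      excluded : M ℕ.% 17 ≡ 1 → Criterion (7 ℕ.+ c) h M
      excluded e = contradiction (ℕD.divides (M ℕ./ 17) (ℕP.suc-injective (≡.trans (≡.sym M≡suc) (M≡ e)))) (17∤h2^ (7 ℕ.+ c))

      power : ∀ r → M ℕ.% 17 ≡ suc (toℕ r) → A₁ ^ K ≈ root (14 ℕ.* discreteLog (Fin.suc r))
      power r e = A₁-plus s r e K (≡.trans M≡suc (≡.cong suc (split-power h 3 (4 ℕ.+ c)))) M≡s

      case-iv : M ℕ.% 17 ≡ 16 → Mstar M ≡ℤ ℤ.- + 1 [mod 17 ] → Criterion (7 ℕ.+ c) h M
      case-iv e star = case-iv′ star (A₂-plus s e M≡s)

    -- The number j given in each line is 14 · log r mod 16; `root` reduces its argument modulo 16,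
    -- so `power` fits without rewriting. At r = 16 this j is 0, and α₂ takes over.
    outcome : (r : Fin 16) → M ℕ.% 17 ≡ suc (toℕ r) → Criterion (7 ℕ.+ c) h M
    outcome 0F e = excluded e
    outcome 1F e = case-ii (inj₁ (inj₁ (star e (+ 2) (+ 0) ≡.refl))) 4 residues-4 (power 1F e)
    outcome 2F e = case-iii (inj₁ (inj₁ (inj₁ (star e (+ 3) (+ 0) ≡.refl)))) 14 residues-14 (power 2F e)
    outcome 3F e = case-i (inj₁ (star e (+ 4) (+ 0) ≡.refl)) 8 residues-8 (power 3F e)
    outcome 4F e = case-iii (inj₁ (inj₂ (inj₁ (star e (+ 5) (+ 0) ≡.refl)))) 6 residues-6 (power 4F e)
    outcome 5F e = case-iii (inj₂ (inj₁ (inj₁ (star e (+ 6) (+ 0) ≡.refl)))) 2 residues-2 (power 5F e)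
    outcome 6F e = case-iii (inj₂ (inj₂ (inj₁ (star e (+ 7) (+ 0) ≡.refl)))) 10 residues-10 (power 6F e)
    outcome 7F e = case-ii (inj₂ (inj₁ (star e (+ 8) (+ 0) ≡.refl))) 12 residues-12 (power 7F e)
    outcome 8F e = case-ii (inj₂ (inj₂ (star e (ℤ.- + 8) (+ 1) ≡.refl))) 12 residues-12 (power 8F e)
    outcome 9F e = case-iii (inj₂ (inj₂ (inj₂ (star e (ℤ.- + 7) (+ 1) ≡.refl)))) 10 residues-10 (power 9F e)
    outcome (Fin.suc 9F) e = case-iii (inj₂ (inj₁ (inj₂ (star e (ℤ.- + 6) (+ 1) ≡.refl)))) 2 residues-2 (power (Fin.suc 9F) e)
    outcome (Fin.suc (Fin.suc 9F)) e = case-iii (inj₁ (inj₂ (inj₂ (star e (ℤ.- + 5) (+ 1) ≡.refl)))) 6 residues-6 (power (Fin.suc (Fin.suc 9F)) e)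
    outcome (Fin.suc (Fin.suc (Fin.suc 9F))) e = case-i (inj₂ (star e (ℤ.- + 4) (+ 1) ≡.refl)) 8 residues-8 (power (Fin.suc (Fin.suc (Fin.suc 9F))) e)
    outcome (Fin.suc (Fin.suc (Fin.suc (Fin.suc 9F)))) e = case-iii (inj₁ (inj₁ (inj₂ (star e (ℤ.- + 3) (+ 1) ≡.refl)))) 14 residues-14 (power (Fin.suc (Fin.suc (Fin.suc (Fin.suc 9F)))) e)
    outcome (Fin.suc (Fin.suc (Fin.suc (Fin.suc (Fin.suc 9F))))) e = case-ii (inj₁ (inj₂ (star e (ℤ.- + 2) (+ 1) ≡.refl))) 4 residues-4 (power (Fin.suc (Fin.suc (Fin.suc (Fin.suc (Fin.suc 9F))))) e)
    outcome (Fin.suc (Fin.suc (Fin.suc (Fin.suc (Fin.suc (Fin.suc 9F)))))) e = case-iv e (star e (ℤ.- + 1) (+ 1) ≡.refl)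

  module Minus (suc-M≡ : suc M ≡ h ℕ.* 2 ℕ.^ (7 ℕ.+ c)) where
    private
      pred-of : ∀ x → ¬ x ≡ 0 → ∃ λ y → x ≡ suc y
      pred-of zero ne = contradiction ≡.refl ne
      pred-of (suc y) _ = y , ≡.refl

      -- The results on gᵖ⁺¹ take the quotients (M + 1)/2ᵃ as successors; they are nonzero because
      -- suc M is.
      positive : ∀ a b → a ℕ.+ b ≡ 7 ℕ.+ c → ∃ λ y → h ℕ.* 2 ℕ.^ b ≡ suc y
      positive a b e = pred-of (h ℕ.* 2 ℕ.^ b) λ z → contradiction (≡.trans suc-M≡ (≡.trans (≡.cong (λ n → h ℕ.* 2 ℕ.^ n) (≡.sym e))
        (≡.trans (split-power h a b) (≡.cong (ℕ._* 2 ℕ.^ a) z)))) λ ()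

      s = proj₁ (positive 4 (3 ℕ.+ c) ≡.refl)
      k = proj₁ (positive 3 (4 ℕ.+ c) ≡.refl)
      y = proj₁ (positive 2 (5 ℕ.+ c) ≡.refl)

      scaled : ∀ a b x → a ℕ.+ b ≡ 7 ℕ.+ c → h ℕ.* 2 ℕ.^ b ≡ suc x → suc M ≡ suc x ℕ.* 2 ℕ.^ a
      scaled a b x e f = ≡.trans suc-M≡ (≡.trans (≡.cong (λ n → h ℕ.* 2 ℕ.^ n) (≡.sym e)) (≡.trans (split-power h a b) (≡.cong (ℕ._* 2 ℕ.^ a) f)))

      Mstar≡ : Mstar M ≡ ℤ.- + M
      Mstar≡ = Mstar-minus M y (ℕP.suc-injective (scaled 2 (5 ℕ.+ c) y ≡.refl (proj₂ (positive 2 (5 ℕ.+ c) ≡.refl))))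

      suc-M≡s : suc M ≡ suc s ℕ.* 16
      suc-M≡s = scaled 4 (3 ℕ.+ c) s ≡.refl (proj₂ (positive 4 (3 ℕ.+ c) ≡.refl))

      star : ∀ {ρ} → M ℕ.% 17 ≡ ρ → ∀ x z → ℤ.- + ρ ℤ.- x ≡ z ℤ.* + 17 → Mstar M ≡ℤ x [mod 17 ]
      star {ρ} e x z f = ℤD.∣⇒∣ᵤ (ℤD.divides (ℤ.- + (M ℕ./ 17) ℤ.+ z) (begin
        Mstar M ℤ.- x                               ≡⟨ ≡.cong (ℤ._- x) (≡.trans Mstar≡ (≡.cong (λ y → ℤ.- + y) (M≡ e))) ⟩
        ℤ.- (+ ρ ℤ.+ + (M ℕ./ 17 ℕ.* 17)) ℤ.- x     ≡⟨ ≡.cong (λ y → ℤ.- (+ ρ ℤ.+ y) ℤ.- x) (ℤP.pos-* (M ℕ./ 17) 17) ⟩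
        ℤ.- (+ ρ ℤ.+ + (M ℕ./ 17) ℤ.* + 17) ℤ.- x   ≡⟨ solve 3 (λ r q x → :- (r :+ q :* con (+ 17)) :- x := (:- q) :* con (+ 17) :+ (:- r :- x)) ≡.refl (+ ρ) (+ (M ℕ./ 17)) x ⟩
        (ℤ.- + (M ℕ./ 17)) ℤ.* + 17 ℤ.+ (ℤ.- + ρ ℤ.- x) ≡⟨ ≡.cong (λ y → (ℤ.- + (M ℕ./ 17)) ℤ.* + 17 ℤ.+ y) f ⟩
        (ℤ.- + (M ℕ./ 17)) ℤ.* + 17 ℤ.+ z ℤ.* + 17  ≡⟨ ℤP.*-distribʳ-+ (+ 17) (ℤ.- + (M ℕ./ 17)) z ⟨
        (ℤ.- + (M ℕ./ 17) ℤ.+ z) ℤ.* + 17           ∎))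
        where
        open ≡.≡-Reasoning
        open ℤSolver.+-*-Solver

      excluded : M ℕ.% 17 ≡ 16 → Criterion (7 ℕ.+ c) h M
      excluded e = contradiction (ℕD.divides (suc (M ℕ./ 17)) (≡.trans (≡.sym suc-M≡) (≡.cong suc (M≡ e)))) (17∤h2^ (7 ℕ.+ c))

      power : ∀ r → M ℕ.% 17 ≡ suc (toℕ r) → A₁ ^ K ≈ root (2 ℕ.* (discreteLog (Fin.suc r) ℕ.+ 8))
      power r e = trans (^-congʳ A₁ (proj₂ (positive 3 (4 ℕ.+ c) ≡.refl)))
        (A₁-minus s r e k (scaled 3 (4 ℕ.+ c) k ≡.refl (proj₂ (positive 3 (4 ℕ.+ c) ≡.refl))) (ℕP.suc-injective suc-M≡s))

      case-iv : M ℕ.% 17 ≡ 1 → Mstar M ≡ℤ ℤ.- + 1 [mod 17 ] → Criterion (7 ℕ.+ c) h M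
      case-iv e star = case-iv′ star (trans (^-congʳ A₂ (proj₂ (positive 4 (3 ℕ.+ c) ≡.refl))) (A₂-minus s s e suc-M≡s (ℕP.suc-injective suc-M≡s)))

    -- Here M* = -M, so the residue r of M appears as -r, and j is 2(log r + 8) mod 16. α₂ is needed
    -- at r = 1, and r = 16 is impossible.
    outcome : (r : Fin 16) → M ℕ.% 17 ≡ suc (toℕ r) → Criterion (7 ℕ.+ c) h M
    outcome 0F e = case-iv e (star e (ℤ.- + 1) (+ 0) ≡.refl)
    outcome 1F e = case-ii (inj₁ (inj₂ (star e (ℤ.- + 2) (+ 0) ≡.refl))) 12 residues-12 (power 1F e)
    outcome 2F e = case-iii (inj₁ (inj₁ (inj₂ (star e (ℤ.- + 3) (+ 0) ≡.refl)))) 2 residues-2 (power 2F e)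
    outcome 3F e = case-i (inj₂ (star e (ℤ.- + 4) (+ 0) ≡.refl)) 8 residues-8 (power 3F e)
    outcome 4F e = case-iii (inj₁ (inj₂ (inj₂ (star e (ℤ.- + 5) (+ 0) ≡.refl)))) 10 residues-10 (power 4F e)
    outcome 5F e = case-iii (inj₂ (inj₁ (inj₂ (star e (ℤ.- + 6) (+ 0) ≡.refl)))) 14 residues-14 (power 5F e)
    outcome 6F e = case-iii (inj₂ (inj₂ (inj₂ (star e (ℤ.- + 7) (+ 0) ≡.refl)))) 6 residues-6 (power 6F e)
    outcome 7F e = case-ii (inj₂ (inj₂ (star e (ℤ.- + 8) (+ 0) ≡.refl))) 4 residues-4 (power 7F e)
    outcome 8F e = case-ii (inj₂ (inj₁ (star e (+ 8) -[1+ 0 ] ≡.refl))) 4 residues-4 (power 8F e)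
    outcome 9F e = case-iii (inj₂ (inj₂ (inj₁ (star e (+ 7) -[1+ 0 ] ≡.refl)))) 6 residues-6 (power 9F e)
    outcome (Fin.suc 9F) e = case-iii (inj₂ (inj₁ (inj₁ (star e (+ 6) -[1+ 0 ] ≡.refl)))) 14 residues-14 (power (Fin.suc 9F) e)
    outcome (Fin.suc (Fin.suc 9F)) e = case-iii (inj₁ (inj₂ (inj₁ (star e (+ 5) -[1+ 0 ] ≡.refl)))) 10 residues-10 (power (Fin.suc (Fin.suc 9F)) e)
    outcome (Fin.suc (Fin.suc (Fin.suc 9F))) e = case-i (inj₁ (star e (+ 4) -[1+ 0 ] ≡.refl)) 8 residues-8 (power (Fin.suc (Fin.suc (Fin.suc 9F))) e)
    outcome (Fin.suc (Fin.suc (Fin.suc (Fin.suc 9F)))) e = case-iii (inj₁ (inj₁ (inj₁ (star e (+ 3) -[1+ 0 ] ≡.refl)))) 2 residues-2 (power (Fin.suc (Fin.suc (Fin.suc (Fin.suc 9F)))) e)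
    outcome (Fin.suc (Fin.suc (Fin.suc (Fin.suc (Fin.suc 9F))))) e = case-ii (inj₁ (inj₁ (star e (+ 2) -[1+ 0 ] ≡.refl))) 12 residues-12 (power (Fin.suc (Fin.suc (Fin.suc (Fin.suc (Fin.suc 9F))))) e)
    outcome (Fin.suc (Fin.suc (Fin.suc (Fin.suc (Fin.suc (Fin.suc 9F)))))) e = excluded e

necessity : ∀ c h M → Prime M → ¬ 17 ℕD.∣ h → (M ≡ h ℕ.* 2 ℕ.^ (7 ℕ.+ c) ℕ.+ 1 ⊎ M ≡ h ℕ.* 2 ℕ.^ (7 ℕ.+ c) ℕ.∸ 1) → 0 ℕ.< h → Criterion (7 ℕ.+ c) h M
necessity c h M pp 17∤h (inj₁ e) 0<h = residue-cases (Plus.outcome M≡suc)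
  where
  M≡suc : M ≡ suc (h ℕ.* 2 ℕ.^ (7 ℕ.+ c))
  M≡suc = ≡.trans e (ℕP.+-comm _ 1)
  -- A prime divisible by 17 is 17 itself, but 16 is not a positive multiple of 2⁷, and neither is
  -- 18 in the other form of M.
  17∤M : ¬ 17 ℕD.∣ M
  17∤M d = Sum.[ (λ ()) , (λ 17≡M → ℕD.>⇒∤ (ℕP.<ᵇ⇒< 16 128 _) (ℕD.divides (h ℕ.* 2 ℕ.^ c)
    (≡.trans (ℕP.suc-injective (≡.trans 17≡M M≡suc)) (split-power h 7 c)))) ]′ (prime⇒irreducible pp d)
  open Necessity c h M pp 17∤h 17∤M (h ℕ.* 2 ℕ.^ (6 ℕ.+ c))
    (≡.trans M≡suc (≡.cong suc (≡.trans (split-power h 1 (6 ℕ.+ c)) (ℕP.*-comm (h ℕ.* 2 ℕ.^ (6 ℕ.+ c)) 2))))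
necessity c h M pp 17∤h (inj₂ e) 0<h = residue-cases (Minus.outcome suc-M≡)
  where
  instance
    h≢0 : ℕ.NonZero h
    h≢0 = ℕ.>-nonZero 0<h
  suc-M≡ : suc M ≡ h ℕ.* 2 ℕ.^ (7 ℕ.+ c)
  suc-M≡ = ≡.trans (≡.cong suc e) (ℕP.suc-pred (h ℕ.* 2 ℕ.^ (7 ℕ.+ c)) {{ℕP.m*n≢0 h (2 ℕ.^ (7 ℕ.+ c)) {{h≢0}} {{ℕP.m^n≢0 2 (7 ℕ.+ c)}}}})
  17∤M : ¬ 17 ℕD.∣ M
  17∤M d = Sum.[ (λ ()) , (λ 17≡M → ℕD.>⇒∤ (ℕP.<ᵇ⇒< 18 128 _) (ℕD.divides (h ℕ.* 2 ℕ.^ c)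
    (≡.trans (≡.cong suc 17≡M) (≡.trans suc-M≡ (split-power h 7 c))))) ]′ (prime⇒irreducible pp d)
  odd-pred : ∀ m → suc M ≡ m ℕ.* 2 → ∃ λ l → M ≡ suc (2 ℕ.* l)
  odd-pred zero ()
  odd-pred (suc l) f = l , ≡.trans (ℕP.suc-injective f) (≡.cong suc (ℕP.*-comm l 2))
  odd = odd-pred (h ℕ.* 2 ℕ.^ (6 ℕ.+ c)) (≡.trans suc-M≡ (split-power h 1 (6 ℕ.+ c)))
  open Necessity c h M pp 17∤h 17∤M (proj₁ odd) (proj₂ odd)

module Sufficiency (c h M m : ℕ) (M≡odd : M ≡ suc (2 ℕ.* m)) (criterion : Criterion (7 ℕ.+ c) h M) where
  private
    17∤M = criterion⇒17∤ (7 ℕ.+ c) h M criterion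

  -- For n = 7 + c, cases (i), (ii), (iii) yield 2^(n-2), 2^(n-1), 2ⁿ and case (iv) only 2^(n-3);
  -- the weakest one fixes the common modulus.
  fourth-power : ∀ q → Prime q → q ℕD.∣ M → (∃ λ a → q ≡ suc (2 ℕ.* a)) ∧ (2 ℕ.^ (4 ℕ.+ c) ℕD.∣ (q ℕ.^ 4 ℕ.∸ 1))
  fourth-power q pq q∣M = odd , Sum.[ i , Sum.[ ii , Sum.[ iii , iv ]′ ]′ ]′ criterion
    where
    odd : ∃ λ a → q ≡ suc (2 ℕ.* a)
    odd = Sum.[ (λ { (a , e) → contradiction (≡.subst (2 ℕD.∣_) M≡odd (ℕD.∣-trans (ℕD.divides a (≡.trans e (ℕP.*-comm 2 a))) q∣M)) (odd⇒2∤ m) })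
              , (λ o → o) ]′ (parity q)
    i₁₇ = inverse-of-17 q pq (λ d → 17∤M (ℕD.∣-trans d q∣M))
    open PrimeDivisor q pq (proj₁ i₁₇) (proj₂ i₁₇) (+ suc (proj₁ odd)) (inverse-of-2 q (proj₁ odd) (proj₂ odd)) odd
    reduce : ∀ {x} z → x ≡ℚ ι z [mod M ] → x ≡ᵖ z
    reduce {x} z d = ℤD.∣ᵤ⇒∣ {+ q} {↥ (x ℚ.- ι z)} (ℕD.∣-trans q∣M d)
    shrink : ∀ d → 2 ℕ.^ (d ℕ.+ (4 ℕ.+ c)) ℕD.∣ (q ℕ.^ 4 ℕ.∸ 1) → 2 ℕ.^ (4 ℕ.+ c) ℕD.∣ (q ℕ.^ 4 ℕ.∸ 1)
    shrink d = ℕD.∣-trans (ℕD.divides (2 ℕ.^ d) (ℕP.^-distribˡ-+-* 2 d (4 ℕ.+ c)))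
    i : Case-i (7 ℕ.+ c) h M → _
    i (_ , t , n) = shrink 1 (Converse₁.converse-i h (4 ℕ.+ c) (reduce {T h (4 ℕ.+ c)} (ℤ.- + 4) t) (reduce {N h (4 ℕ.+ c)} (+ 4) n))
    ii : Case-ii (7 ℕ.+ c) h M → _
    ii (_ , t , n) = shrink 2 (Converse₁.converse-ii h (4 ℕ.+ c) (reduce {T h (4 ℕ.+ c)} (+ 0) t) (reduce {N h (4 ℕ.+ c)} (+ 0) n))
    iii : Case-iii (7 ℕ.+ c) h M → _
    iii (_ , t , n) = shrink 3 (Converse₁.converse-iii h (4 ℕ.+ c) (reduce {T h (4 ℕ.+ c)} (+ 0) t) (reduce {N h (4 ℕ.+ c)} (ℤ.- + 2) n))
    iv : Case-iv (7 ℕ.+ c) h M → _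
    iv (_ , x , y , z , w) = Converse₂.converse-iv h (3 ℕ.+ c) (reduce {X h (3 ℕ.+ c)} (ℤ.- + 8) x) (reduce {Y h (3 ℕ.+ c)} (+ 24) y)
      (reduce {Z h (3 ℕ.+ c)} (ℤ.- + 32) z) (reduce {W h (3 ℕ.+ c)} (+ 16) w)

NoSmallDivisor : ℕ → ℕ → Set
NoSmallDivisor n M = (Q : ℕ) → 1 ℕ.< Q → Q ℕ.< 2 ℕ.^ (n ℕ.∸ 3) →
  ∃ (λ (j : Fin 4) →
    (+ Q ≡ℤ + (5 ℕ.^ (toℕ j ℕ.* 2 ℕ.^ (n ℕ.∸ 7))) [mod 2 ℕ.^ (n ℕ.∸ 3) ])
    ⊎ (+ Q ≡ℤ ℤ.- + (5 ℕ.^ (toℕ j ℕ.* 2 ℕ.^ (n ℕ.∸ 7))) [mod 2 ℕ.^ (n ℕ.∸ 3) ])) →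
  ¬ (Q ℕD.∣ M)

sufficiency : ∀ c h M → (∃ λ m → M ≡ suc (2 ℕ.* m)) → 1 ℕ.< M → M ℕ.< 2 ℕ.^ (4 ℕ.+ c) ℕ.* 2 ℕ.^ (4 ℕ.+ c) →
              NoSmallDivisor (7 ℕ.+ c) M → Criterion (7 ℕ.+ c) h M → Prime M
sufficiency c h M (m , odd) 1<M M< none criterion = rough∧square>⇒prime {{ℕ.n>1⇒nonTrivial 1<M}} rough M<
  where
  open Sufficiency c h M m odd criterion
  rough : (2 ℕ.^ (4 ℕ.+ c)) Rough M
  -- The order argument speaks of primes only, so the divisor d is replaced by a prime factor q ≤ d.
  rough (ℕD.hasNonTrivialDivisor {d} {{nt}} d< d∣M) =
    none q (ℕ.nonTrivial⇒n>1 q {{prime⇒nonTrivial pq}}) (ℕP.≤-<-trans (ℕD.∣⇒≤ {{ℕ.nonTrivial⇒nonZero d {{nt}}}} q∣d) d<)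
      (fourth-roots c q (proj₁ (proj₁ fp)) (proj₂ (proj₁ fp)) (proj₂ fp)) (ℕD.∣-trans q∣d d∣M)
    where
    factor = prime-divisor d (ℕ.nonTrivial⇒n>1 d {{nt}})
    q = proj₁ factor
    pq = proj₁ (proj₂ factor)
    q∣d = proj₂ (proj₂ factor)
    fp = fourth-power q pq (ℕD.∣-trans q∣d d∣M)

module Bounds (c h M : ℕ) (0<h : 0 ℕ.< h) (h< : h ℕ.< 2 ℕ.^ suc c)
              (form : M ≡ h ℕ.* 2 ℕ.^ (7 ℕ.+ c) ℕ.+ 1 ⊎ M ≡ h ℕ.* 2 ℕ.^ (7 ℕ.+ c) ℕ.∸ 1) where
  private
    B = 2 ℕ.^ (7 ℕ.+ c)
    instance
      B≢0 : ℕ.NonZero B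
      B≢0 = ℕP.m^n≢0 2 (7 ℕ.+ c)
      h≢0 : ℕ.NonZero h
      h≢0 = ℕ.>-nonZero 0<h
    B≥4 : 4 ℕ.≤ B
    B≥4 = ℕP.^-monoʳ-≤ 2 {2} {7 ℕ.+ c} (s≤s (s≤s z≤n))
    hB≥4 : 4 ℕ.≤ h ℕ.* B
    hB≥4 = ℕP.≤-trans B≥4 (ℕP.m≤n*m B h)
    -- Here h < 2^(n-6) is used: (n - 6) + n = 2(n - 3), so M stays below the square of 2^(n-3).
    upper : suc (h ℕ.* B) ℕ.< 2 ℕ.^ (4 ℕ.+ c) ℕ.* 2 ℕ.^ (4 ℕ.+ c)
    upper = begin-strict
      suc (h ℕ.* B)                       <⟨ ℕP.+-monoˡ-< (h ℕ.* B) (ℕP.≤-trans (s≤s (s≤s z≤n)) B≥4) ⟩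
      B ℕ.+ h ℕ.* B                       ≡⟨⟩
      suc h ℕ.* B                         ≤⟨ ℕP.*-monoˡ-≤ B h< ⟩
      2 ℕ.^ suc c ℕ.* B                   ≡⟨ ≡.sym (ℕP.^-distribˡ-+-* 2 (suc c) (7 ℕ.+ c)) ⟩
      2 ℕ.^ (suc c ℕ.+ (7 ℕ.+ c))         ≡⟨ ≡.cong (2 ℕ.^_) (solve 1 (λ c → con 1 :+ c :+ (con 7 :+ c) := con 4 :+ c :+ (con 4 :+ c)) ≡.refl c) ⟩
      2 ℕ.^ (4 ℕ.+ c ℕ.+ (4 ℕ.+ c))       ≡⟨ ℕP.^-distribˡ-+-* 2 (4 ℕ.+ c) (4 ℕ.+ c) ⟩
      2 ℕ.^ (4 ℕ.+ c) ℕ.* 2 ℕ.^ (4 ℕ.+ c) ∎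
      where
      open ℕP.≤-Reasoning
      open +-*-Solver
    even : h ℕ.* B ≡ 2 ℕ.* (h ℕ.* 2 ℕ.^ (6 ℕ.+ c))
    even = ≡.trans (split-power h 1 (6 ℕ.+ c)) (ℕP.*-comm (h ℕ.* 2 ℕ.^ (6 ℕ.+ c)) 2)

  bounds : (∃ λ m → M ≡ suc (2 ℕ.* m)) ∧ (1 ℕ.< M) ∧ (M ℕ.< 2 ℕ.^ (4 ℕ.+ c) ℕ.* 2 ℕ.^ (4 ℕ.+ c))
  bounds = Sum.[ plus , minus ]′ form
    where
    plus : M ≡ h ℕ.* B ℕ.+ 1 → _
    plus e = (h ℕ.* 2 ℕ.^ (6 ℕ.+ c) , ≡.trans M≡ (≡.cong suc even))
           , ≡.subst (1 ℕ.<_) (≡.sym M≡) (s≤s (ℕP.≤-trans (s≤s z≤n) hB≥4)) , ≡.subst (ℕ._< 2 ℕ.^ (4 ℕ.+ c) ℕ.* 2 ℕ.^ (4 ℕ.+ c)) (≡.sym M≡) upper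
      where
      M≡ : M ≡ suc (h ℕ.* B)
      M≡ = ≡.trans e (ℕP.+-comm (h ℕ.* B) 1)
    minus : M ≡ h ℕ.* B ℕ.∸ 1 → _
    minus e = pred-odd (h ℕ.* 2 ℕ.^ (6 ℕ.+ c)) (≡.trans suc-M even)
            , ℕP.≤-pred (≡.subst (3 ℕ.≤_) (≡.sym suc-M) (ℕP.≤-trans (s≤s (s≤s (s≤s z≤n))) hB≥4))
            , ℕP.<-trans (ℕP.n<1+n M) (ℕP.<-trans (ℕP.n<1+n (suc M)) (≡.subst (λ x → suc x ℕ.< 2 ℕ.^ (4 ℕ.+ c) ℕ.* 2 ℕ.^ (4 ℕ.+ c)) (≡.sym suc-M) upper))
      where
      suc-M : suc M ≡ h ℕ.* B
      suc-M = ≡.trans (≡.cong suc e) (ℕP.suc-pred (h ℕ.* B) {{ℕP.m*n≢0 h B}})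
      pred-odd : ∀ l → suc M ≡ 2 ℕ.* l → ∃ λ m → M ≡ suc (2 ℕ.* m)
      pred-odd zero ()
      pred-odd (suc l) f = l , ℕP.suc-injective (≡.trans f (≡.cong suc (ℕP.+-suc l (l ℕ.+ 0))))

primality-criterion : (c h M : ℕ) → 0 ℕ.< h → h ℕ.< 2 ℕ.^ suc c → ¬ (17 ℕD.∣ h) →
  (M ≡ h ℕ.* 2 ℕ.^ (7 ℕ.+ c) ℕ.+ 1 ⊎ M ≡ h ℕ.* 2 ℕ.^ (7 ℕ.+ c) ℕ.∸ 1) → NoSmallDivisor (7 ℕ.+ c) M →
  Prime M ⇔ Criterion (7 ℕ.+ c) h M
primality-criterion c h M 0<h h< 17∤h form none = mk⇔ (λ pp → necessity c h M pp 17∤h form 0<h)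
  (sufficiency c h M (proj₁ b) (proj₁ (proj₂ b)) (proj₂ (proj₂ b)) none)
  where b = Bounds.bounds c h M 0<h h< form

-- Once n is literally 7 + c, the truncated subtractions from n compute and the two forms of the
-- statement agree.
criterion-for : ∀ n h M → (∃ λ c → 7 ℕ.+ c ≡ n) → 0 ℕ.< h → h ℕ.< 2 ℕ.^ (n ℕ.∸ 6) → ¬ (17 ℕD.∣ h) →
  (M ≡ h ℕ.* 2 ℕ.^ n ℕ.+ 1 ⊎ M ≡ h ℕ.* 2 ℕ.^ n ℕ.∸ 1) → NoSmallDivisor n M → Prime M ⇔ Criterion n h M
criterion-for _ h M (c , ≡.refl) = primality-criterion c h M

open import Data.Nat using (_+_; _*_; _∸_; _^_; _≤_; _<_; _%_)
open import Data.Nat.Divisibility using (_∣_)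
open import Data.Integer using (-_)
open import Data.Product using (_×_)

theorem3p1 : (n h M : ℕ) → 7 ≤ n → h % 2 ≡ 1 → 0 < h → h < 2 ^ (n ∸ 6) → ¬ (17 ∣ h) →
  (M ≡ h * 2 ^ n + 1 ⊎ M ≡ h * 2 ^ n ∸ 1) →
  ((Q : ℕ) → 1 < Q → Q < 2 ^ (n ∸ 3) →
    ∃ (λ (j : Fin 4) →
      (+ Q ≡ℤ + (5 ^ (toℕ j * 2 ^ (n ∸ 7))) [mod 2 ^ (n ∸ 3) ])
      ⊎ (+ Q ≡ℤ - + (5 ^ (toℕ j * 2 ^ (n ∸ 7))) [mod 2 ^ (n ∸ 3) ])) →
    ¬ (Q ∣ M)) →
  Prime M ⇔
    (((Mstar M ≡ℤ + 4 [mod 17 ] ⊎ Mstar M ≡ℤ - + 4 [mod 17 ])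
        × (T h (n ∸ 3) ≡ℚ ι (- + 4) [mod M ]) × (N h (n ∸ 3) ≡ℚ ι (+ 4) [mod M ]))
    ⊎ (((Mstar M ≡ℤ + 2 [mod 17 ] ⊎ Mstar M ≡ℤ - + 2 [mod 17 ])
          ⊎ (Mstar M ≡ℤ + 8 [mod 17 ] ⊎ Mstar M ≡ℤ - + 8 [mod 17 ]))
        × (T h (n ∸ 3) ≡ℚ ι (+ 0) [mod M ]) × (N h (n ∸ 3) ≡ℚ ι (+ 0) [mod M ]))
    ⊎ ((((Mstar M ≡ℤ + 3 [mod 17 ] ⊎ Mstar M ≡ℤ - + 3 [mod 17 ])
           ⊎ (Mstar M ≡ℤ + 5 [mod 17 ] ⊎ Mstar M ≡ℤ - + 5 [mod 17 ]))
          ⊎ ((Mstar M ≡ℤ + 6 [mod 17 ] ⊎ Mstar M ≡ℤ - + 6 [mod 17 ])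
           ⊎ (Mstar M ≡ℤ + 7 [mod 17 ] ⊎ Mstar M ≡ℤ - + 7 [mod 17 ])))
        × (T h (n ∸ 3) ≡ℚ ι (+ 0) [mod M ]) × (N h (n ∸ 3) ≡ℚ ι (- + 2) [mod M ]))
    ⊎ ((Mstar M ≡ℤ - + 1 [mod 17 ])
        × (X h (n ∸ 4) ≡ℚ ι (- + 8) [mod M ]) × (Y h (n ∸ 4) ≡ℚ ι (+ 24) [mod M ])
        × (Z h (n ∸ 4) ≡ℚ ι (- + 32) [mod M ]) × (W h (n ∸ 4) ≡ℚ ι (+ 16) [mod M ])))
theorem3p1 n h M 7≤n _ 0<h h< 17∤h form none = criterion-for n h M (ℕP.m≤n⇒∃[o]m+o≡n 7≤n) 0<h h< 17∤h form none
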